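{- For every $\varepsilon>0$ and every integer $g$, there exist a finite graph $G$ of girth at least $g$ and a probability distribution $D$ with finite support over weight functions $w:E(G)\to\mathbb{R}_{>0}$ such that every (randomized) algorithm $a$ for the graphic matroid secretary problem on $G$ satisfies $$\mathbb{E}_{w\sim D}\left[\frac{\mathbb{E}[w(a(G,w))]}{OPT(G,w)}\right]<\frac1e+\varepsilon,$$ where the inner expectation is over the uniformly random arrival order and the algorithm's randomness. Consequently, for every $g$, no algorithm for the graphic matroid secretary problem on graphs of girth at least $g$ achieves a competitive ratio smaller than $e$.
   Context: Graphic matroid secretary problem: edges of a fixed known graph $G$ carry weights; edges arrive one at a time in uniformly random order, revealing their weight; the algorithm must irrevocably accept or reject each edge on arrival, keeping the accepted set acyclic. The algorithm may know $G$ and $D$ in advance and may be randomized. $w(a(G,w))$ denotes the total weight of edges accepted by $a$ and $OPT(G,w)$ the maximum weight of an acyclic edge set. The girth of a graph is the length of its shortest cycle. An algorithm is $\alpha$-competitive on a family of weighted graphs if $\alpha\,\mathbb{E}[ALG]\ge OPT$ for every member. -}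

module Defs where

open import Data.Bool using (Bool; true; false; if_then_else_)
open import Data.Fin using (Fin; toℕ)
import Data.Fin.Properties as Fin
open import Data.Fin.Subset using (Subset; inside; outside; ⁅_⁆; _∪_; _∈_) renaming (⊥ to ∅; ⊤ to full)
open import Data.Fin.Subset.Properties using (_∈?_)
open import Data.Integer using (ℤ; +_)
import Data.Integer as ℤ
import Data.Integer.Properties as ℤ
open import Data.List using (List; []; _∷_; map; filter; foldr; concatMap; allFin; _++_)
open import Data.List.Relation.Binary.Pointwise using (Pointwise)
open import Data.Nat using (ℕ; zero; suc; _!)
import Data.Nat as ℕ
open import Data.Nat.Properties using (_!≢0)
open import Data.Nat.DivMod using (_mod_)
import Data.Nat.Properties as ℕ
open import Data.Product using (Σ; ∃; _×_; _,_; proj₁; proj₂)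
open import Data.Rational using (ℚ; 0ℚ; 1ℚ; ½)
import Data.Rational as ℚ
import Data.Rational.Properties as ℚ
import Data.Rational.Unnormalised as ℚᵘ
import Data.Rational.Unnormalised.Properties as ℚᵘ
open import Data.Rational.Solver using (module +-*-Solver)
open import Data.Sum using (_⊎_; inj₁; inj₂)
open import Data.Vec using (Vec; []; _∷_; lookup)
import Data.Vec.Functional as Vector
open import Function.Definitions using (Injective)
open import Relation.Binary.PropositionalEquality using (_≡_; refl; sym; trans; cong; cong₂; subst; subst₂)
open import Relation.Nullary using (¬_; Dec)
open import Relation.Nullary.Decidable using (map′; _×-dec_; _⊎-dec_; _→-dec_; ¬?)

private
  ∣-∣≤ : ∀ {p q} → p ℚ.≤ q → ℚ.- p ℚ.≤ q → ℚ.∣ p ∣ ℚ.≤ q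
  ∣-∣≤ {p} {q} p≤q -p≤q with ℚ.∣p∣≡p∨∣p∣≡-p p
  ... | inj₁ eq = subst (ℚ._≤ q) (sym eq) p≤q
  ... | inj₂ eq = subst (ℚ._≤ q) (sym eq) -p≤q

  p≤∣p∣ : ∀ p → p ℚ.≤ ℚ.∣ p ∣
  p≤∣p∣ p with ℚ.≤-total 0ℚ p
  ... | inj₁ 0≤p = ℚ.≤-reflexive (sym (ℚ.0≤p⇒∣p∣≡p 0≤p))
  ... | inj₂ p≤0 = ℚ.≤-trans p≤0 (ℚ.0≤∣p∣ p)

  -- A bound on  p - q  and one on  q - p  together bound  ∣ p - q ∣ .
  ∣-∣≤′ : ∀ p q δ → p ℚ.≤ q ℚ.+ δ → q ℚ.≤ p ℚ.+ δ → ℚ.∣ p ℚ.- q ∣ ℚ.≤ δ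
  ∣-∣≤′ p q δ a b = ∣-∣≤
    (subst (p ℚ.- q ℚ.≤_) (solve 2 (λ q δ → q :+ δ :- q := δ) refl q δ) (ℚ.+-monoˡ-≤ (ℚ.- q) a))
    (subst₂ ℚ._≤_ (solve 2 (λ p q → q :- p := :- (p :- q)) refl p q)
                  (solve 2 (λ p δ → p :+ δ :- p := δ) refl p δ) (ℚ.+-monoˡ-≤ (ℚ.- p) b))
    where open +-*-Solver

  ∣-∣≤⇒≤ : ∀ p q δ → ℚ.∣ p ℚ.- q ∣ ℚ.≤ δ → p ℚ.≤ q ℚ.+ δ
  ∣-∣≤⇒≤ p q δ a =
    subst (ℚ._≤ q ℚ.+ δ) (solve 2 (λ p q → q :+ (p :- q) := p) refl p q)
      (ℚ.+-monoʳ-≤ q (ℚ.≤-trans (p≤∣p∣ (p ℚ.- q)) a))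
    where open +-*-Solver

  module Identities where
    open +-*-Solver

    move : ∀ c h r → c ℚ.* (h ℚ.* r) ≡ h ℚ.* (c ℚ.* r)
    move = solve 3 (λ c h r → c :* (h :* r) := h :* (c :* r)) refl

    split-product : ∀ a c b d → a ℚ.* (b ℚ.- d) ℚ.+ d ℚ.* (a ℚ.- c) ≡ a ℚ.* b ℚ.- c ℚ.* d
    split-product = solve 4 (λ a c b d → a :* (b :- d) :+ d :* (a :- c) := a :* b :- c :* d) refl

    split-recip : ∀ a b r s → (b ℚ.- a) ℚ.* (r ℚ.* s) ≡ (b ℚ.* s) ℚ.* r ℚ.- (a ℚ.* r) ℚ.* s
    split-recip = solve 4 (λ a b r s → (b :- a) :* (r :* s) := (b :* s) :* r :- (a :* r) :* s) refl

    pair-squares : ∀ d h t → d ℚ.* (h ℚ.* h) ℚ.* (t ℚ.* t) ≡ d ℚ.* ((h ℚ.* t) ℚ.* (h ℚ.* t))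
    pair-squares = solve 3 (λ d h t → d :* (h :* h) :* (t :* t) := d :* ((h :* t) :* (h :* t))) refl

  open Identities

  half+half : ∀ δ → δ ℚ.* ½ ℚ.+ δ ℚ.* ½ ≡ δ
  half+half δ = trans (sym (ℚ.*-distribˡ-+ δ ½ ½)) (ℚ.*-identityʳ δ)

  pos* : ∀ {p q} → 0ℚ ℚ.< p → 0ℚ ℚ.< q → 0ℚ ℚ.< p ℚ.* q
  pos* {p} {q} 0<p 0<q = ℚ.positive⁻¹ (p ℚ.* q) {{ℚ.pos*pos⇒pos p {{ℚ.positive 0<p}} q {{ℚ.positive 0<q}}}}

  half-pos : ∀ {δ} → 0ℚ ℚ.< δ → 0ℚ ℚ.< δ ℚ.* ½
  half-pos 0<δ = pos* 0<δ (ℚ.positive⁻¹ ½)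

  *-mono-≤ : ∀ {a b c d} → 0ℚ ℚ.≤ b → 0ℚ ℚ.≤ c → a ℚ.≤ c → b ℚ.≤ d → a ℚ.* b ℚ.≤ c ℚ.* d
  *-mono-≤ {a} {b} {c} {d} 0≤b 0≤c a≤c b≤d = ℚ.≤-trans
    (ℚ.*-monoʳ-≤-nonNeg b {{ℚ.nonNegative 0≤b}} a≤c)
    (ℚ.*-monoˡ-≤-nonNeg c {{ℚ.nonNegative 0≤c}} b≤d)

recip : (p : ℚ) → 0ℚ ℚ.< p → ℚ
recip p 0<p = (ℚ.1/ p) {{ℚ.>-nonZero 0<p}}

private
  recip-pos : ∀ {p} (0<p : 0ℚ ℚ.< p) → 0ℚ ℚ.< recip p 0<p
  recip-pos {p} 0<p = ℚ.positive⁻¹ (recip p 0<p) {{ℚ.1/pos⇒pos p {{ℚ.positive 0<p}}}}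

  recip-inverse : ∀ {p} (0<p : 0ℚ ℚ.< p) → p ℚ.* recip p 0<p ≡ 1ℚ
  recip-inverse {p} 0<p = ℚ.*-inverseʳ p {{ℚ.>-nonZero 0<p}}

  recip-anti : ∀ {p q} (0<p : 0ℚ ℚ.< p) (0<q : 0ℚ ℚ.< q) → p ℚ.≤ q → recip q 0<q ℚ.≤ recip p 0<p
  recip-anti {p} {q} 0<p 0<q p≤q = subst₂ ℚ._≤_
    (trans (solve 3 (λ p r s → p :* (r :* s) := p :* r :* s) refl p r s)
      (trans (cong (ℚ._* s) (recip-inverse 0<p)) (ℚ.*-identityˡ s)))
    (trans (solve 3 (λ q r s → q :* (r :* s) := q :* s :* r) refl q r s)
      (trans (cong (ℚ._* r) (recip-inverse 0<q)) (ℚ.*-identityˡ r)))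
    (ℚ.*-monoʳ-≤-nonNeg (r ℚ.* s) {{ℚ.nonNegative (ℚ.<⇒≤ (pos* (recip-pos 0<p) (recip-pos 0<q)))}} p≤q)
    where
    open +-*-Solver
    r = recip p 0<p
    s = recip q 0<q

Cauchy : (ℕ → ℚ) → Set
Cauchy x = ∀ δ → 0ℚ ℚ.< δ → ∃ λ N → ∀ m n → N ℕ.≤ m → N ℕ.≤ n → ℚ.∣ x m ℚ.- x n ∣ ℚ.≤ δ

-- Real numbers as Cauchy sequences of rationals; their equality is _≃_.
record ℝ : Set where
  constructor mkℝ
  field
    seq    : ℕ → ℚ
    cauchy : Cauchy seq
open ℝ public

infix 4 _≃_ _≤_ _<_

_≃_ _≤_ _<_ : ℝ → ℝ → Set
x ≃ y = ∀ δ → 0ℚ ℚ.< δ → ∃ λ N → ∀ n → N ℕ.≤ n → ℚ.∣ seq x n ℚ.- seq y n ∣ ℚ.≤ δ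
x ≤ y = ∀ δ → 0ℚ ℚ.< δ → ∃ λ N → ∀ n → N ℕ.≤ n → seq x n ℚ.≤ seq y n ℚ.+ δ
x < y = ∃ λ δ → 0ℚ ℚ.< δ × ∃ λ N → ∀ n → N ℕ.≤ n → seq x n ℚ.+ δ ℚ.≤ seq y n

private
  -- Opaque (like the proofs below), so that normalizing a real number does not
  -- unfold them.
  abstract
    const-cauchy : ∀ q → Cauchy (λ _ → q)
    const-cauchy q δ 0<δ = 0 , λ _ _ _ _ →
      subst (ℚ._≤ δ) (sym (cong ℚ.∣_∣ (ℚ.+-inverseʳ q))) (ℚ.<⇒≤ 0<δ)

fromℚ : ℚ → ℝ
fromℚ q = mkℝ (λ _ → q) (const-cauchy q)

0ℝ 1ℝ : ℝ
0ℝ = fromℚ 0ℚ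
1ℝ = fromℚ 1ℚ

private
  abstract
    +-cauchy : ∀ {x y} → Cauchy x → Cauchy y → Cauchy (λ n → x n ℚ.+ y n)
    +-cauchy {x} {y} cx cy δ 0<δ with cx (δ ℚ.* ½) (half-pos 0<δ) | cy (δ ℚ.* ½) (half-pos 0<δ)
    ... | M , f | N , g = M ℕ.⊔ N , λ m n p q → subst₂ ℚ._≤_
      (cong ℚ.∣_∣ (solve 4 (λ a b c d → (a :- b) :+ (c :- d) := (a :+ c) :- (b :+ d)) refl (x m) (x n) (y m) (y n)))
      (half+half δ)
      (ℚ.≤-trans (ℚ.∣p+q∣≤∣p∣+∣q∣ (x m ℚ.- x n) (y m ℚ.- y n))
        (ℚ.+-mono-≤ (f m n (ℕ.m⊔n≤o⇒m≤o M N p) (ℕ.m⊔n≤o⇒m≤o M N q))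
                    (g m n (ℕ.m⊔n≤o⇒n≤o M N p) (ℕ.m⊔n≤o⇒n≤o M N q))))
      where open +-*-Solver

    neg-cauchy : ∀ {x} → Cauchy x → Cauchy (λ n → ℚ.- x n)
    neg-cauchy {x} cx δ 0<δ with cx δ 0<δ
    ... | N , f = N , λ m n p q → subst (ℚ._≤ δ)
      (cong ℚ.∣_∣ (solve 2 (λ a b → a :- b := (:- b) :- (:- a)) refl (x n) (x m))) (f n m q p)
      where open +-*-Solver

    ⊔-cauchy : ∀ {x y} → Cauchy x → Cauchy y → Cauchy (λ n → x n ℚ.⊔ y n)
    ⊔-cauchy {x} {y} cx cy δ 0<δ with cx δ 0<δ | cy δ 0<δ
    ... | M , f | N , g = M ℕ.⊔ N , λ m n p q →
      ∣-∣≤′ (x m ℚ.⊔ y m) (x n ℚ.⊔ y n) δ (bound m n p q) (bound n m q p)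
      where
      bound : ∀ m n → M ℕ.⊔ N ℕ.≤ m → M ℕ.⊔ N ℕ.≤ n → x m ℚ.⊔ y m ℚ.≤ (x n ℚ.⊔ y n) ℚ.+ δ
      bound m n p q = ℚ.⊔-lub {(x n ℚ.⊔ y n) ℚ.+ δ} {x m} {y m}
        (ℚ.≤-trans (∣-∣≤⇒≤ (x m) (x n) δ (f m n (ℕ.m⊔n≤o⇒m≤o M N p) (ℕ.m⊔n≤o⇒m≤o M N q)))
          (ℚ.+-monoˡ-≤ δ {x n} {x n ℚ.⊔ y n} (ℚ.p≤p⊔q (x n) (y n))))
        (ℚ.≤-trans (∣-∣≤⇒≤ (y m) (y n) δ (g m n (ℕ.m⊔n≤o⇒n≤o M N p) (ℕ.m⊔n≤o⇒n≤o M N q)))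
          (ℚ.+-monoˡ-≤ δ {y n} {x n ℚ.⊔ y n} (ℚ.p≤q⊔p (x n) (y n))))

    eventually-bounded : ∀ {x} → Cauchy x → ∃ λ B → 0ℚ ℚ.< B × ∃ λ N → ∀ n → N ℕ.≤ n → ℚ.∣ x n ∣ ℚ.≤ B
    eventually-bounded {x} cx with cx 1ℚ (ℚ.positive⁻¹ 1ℚ)
    ... | N , f = ℚ.∣ x N ∣ ℚ.+ 1ℚ
      , ℚ.<-≤-trans (ℚ.positive⁻¹ 1ℚ) (subst (ℚ._≤ ℚ.∣ x N ∣ ℚ.+ 1ℚ) (ℚ.+-identityˡ 1ℚ) (ℚ.+-monoˡ-≤ 1ℚ (ℚ.0≤∣p∣ (x N))))
      , N , λ n p → subst (λ a → ℚ.∣ a ∣ ℚ.≤ ℚ.∣ x N ∣ ℚ.+ 1ℚ)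
          (solve 2 (λ a b → a :+ (b :- a) := b) refl (x N) (x n))
          (ℚ.≤-trans (ℚ.∣p+q∣≤∣p∣+∣q∣ (x N) (x n ℚ.- x N)) (ℚ.+-monoʳ-≤ ℚ.∣ x N ∣ (f n N p ℕ.≤-refl)))
      where open +-*-Solver

    ∣*∣≤ : ∀ p q {c d} → 0ℚ ℚ.≤ c → ℚ.∣ p ∣ ℚ.≤ c → ℚ.∣ q ∣ ℚ.≤ d → ℚ.∣ p ℚ.* q ∣ ℚ.≤ c ℚ.* d
    ∣*∣≤ p q {c} {d} 0≤c p≤c q≤d = subst (ℚ._≤ c ℚ.* d) (sym (ℚ.∣p*q∣≡∣p∣*∣q∣ p q)) (*-mono-≤ (ℚ.0≤∣p∣ q) 0≤c p≤c q≤d)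

    cancel : ∀ h {c} (0<c : 0ℚ ℚ.< c) → c ℚ.* (h ℚ.* recip c 0<c) ≡ h
    cancel h {c} 0<c = trans (move c h (recip c 0<c))
      (trans (cong (h ℚ.*_) (recip-inverse 0<c)) (ℚ.*-identityʳ h))

    *-close : ∀ a c b d h {A B} (0<A : 0ℚ ℚ.< A) (0<B : 0ℚ ℚ.< B) → ℚ.∣ a ∣ ℚ.≤ A → ℚ.∣ d ∣ ℚ.≤ B →
              ℚ.∣ a ℚ.- c ∣ ℚ.≤ h ℚ.* recip B 0<B → ℚ.∣ b ℚ.- d ∣ ℚ.≤ h ℚ.* recip A 0<A →
              ℚ.∣ a ℚ.* b ℚ.- c ℚ.* d ∣ ℚ.≤ h ℚ.+ h
    *-close a c b d h 0<A 0<B a≤A d≤B ac bd = subst₂ ℚ._≤_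
      (cong ℚ.∣_∣ (split-product a c b d))
      (cong₂ ℚ._+_ (cancel h 0<A) (cancel h 0<B))
      (ℚ.≤-trans (ℚ.∣p+q∣≤∣p∣+∣q∣ (a ℚ.* (b ℚ.- d)) (d ℚ.* (a ℚ.- c)))
        (ℚ.+-mono-≤ (∣*∣≤ a (b ℚ.- d) (ℚ.<⇒≤ 0<A) a≤A bd) (∣*∣≤ d (a ℚ.- c) (ℚ.<⇒≤ 0<B) d≤B ac)))

    *-cauchy : ∀ {x y} → Cauchy x → Cauchy y → Cauchy (λ n → x n ℚ.* y n)
    *-cauchy {x} {y} cx cy δ 0<δ = go (eventually-bounded {x} cx) (eventually-bounded {y} cy)
      where
      h : ℚ
      h = δ ℚ.* ½
      go : (∃ λ A → 0ℚ ℚ.< A × ∃ λ N → ∀ n → N ℕ.≤ n → ℚ.∣ x n ∣ ℚ.≤ A) →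
           (∃ λ B → 0ℚ ℚ.< B × ∃ λ N → ∀ n → N ℕ.≤ n → ℚ.∣ y n ∣ ℚ.≤ B) →
           ∃ λ N → ∀ m n → N ℕ.≤ m → N ℕ.≤ n → ℚ.∣ x m ℚ.* y m ℚ.- x n ℚ.* y n ∣ ℚ.≤ δ
      go (A , 0<A , K , a) (B , 0<B , L , b) = (K ℕ.⊔ L) ℕ.⊔ (M ℕ.⊔ N) , λ m n p q →
        subst (ℚ.∣ x m ℚ.* y m ℚ.- x n ℚ.* y n ∣ ℚ.≤_) (half+half δ)
          (*-close (x m) (x n) (y m) (y n) h 0<A 0<B
            (a m (ℕ.m⊔n≤o⇒m≤o K L (ℕ.m⊔n≤o⇒m≤o (K ℕ.⊔ L) (M ℕ.⊔ N) p)))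
            (b n (ℕ.m⊔n≤o⇒n≤o K L (ℕ.m⊔n≤o⇒m≤o (K ℕ.⊔ L) (M ℕ.⊔ N) q)))
            (proj₂ f m n (ℕ.m⊔n≤o⇒m≤o M N (ℕ.m⊔n≤o⇒n≤o (K ℕ.⊔ L) (M ℕ.⊔ N) p))
                         (ℕ.m⊔n≤o⇒m≤o M N (ℕ.m⊔n≤o⇒n≤o (K ℕ.⊔ L) (M ℕ.⊔ N) q)))
            (proj₂ g m n (ℕ.m⊔n≤o⇒n≤o M N (ℕ.m⊔n≤o⇒n≤o (K ℕ.⊔ L) (M ℕ.⊔ N) p))
                         (ℕ.m⊔n≤o⇒n≤o M N (ℕ.m⊔n≤o⇒n≤o (K ℕ.⊔ L) (M ℕ.⊔ N) q))))
        where
        f : ∃ λ M → ∀ m n → M ℕ.≤ m → M ℕ.≤ n → ℚ.∣ x m ℚ.- x n ∣ ℚ.≤ h ℚ.* recip B 0<B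
        f = cx (h ℚ.* recip B 0<B) (pos* (half-pos 0<δ) (recip-pos 0<B))
        g : ∃ λ N → ∀ m n → N ℕ.≤ m → N ℕ.≤ n → ℚ.∣ y m ℚ.- y n ∣ ℚ.≤ h ℚ.* recip A 0<A
        g = cy (h ℚ.* recip A 0<A) (pos* (half-pos 0<δ) (recip-pos 0<A))
        M N : ℕ
        M = proj₁ f
        N = proj₁ g

    ⊔-pos : ∀ p {δ} → 0ℚ ℚ.< δ → 0ℚ ℚ.< p ℚ.⊔ δ
    ⊔-pos p {δ} 0<δ = ℚ.<-≤-trans 0<δ (ℚ.p≤q⊔p p δ)

    -- ∣ 1/a - 1/b ∣ = ∣ b - a ∣ / (a b) ≤ ∣ b - a ∣ / η²  for  a , b ≥ η > 0 .
    recip-close : ∀ {a b η δ} (0<a : 0ℚ ℚ.< a) (0<b : 0ℚ ℚ.< b) (0<η : 0ℚ ℚ.< η) → 0ℚ ℚ.< δ →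
                  η ℚ.≤ a → η ℚ.≤ b → ℚ.∣ b ℚ.- a ∣ ℚ.≤ δ ℚ.* (η ℚ.* η) →
                  ℚ.∣ recip a 0<a ℚ.- recip b 0<b ∣ ℚ.≤ δ
    recip-close {a} {b} {η} {δ} 0<a 0<b 0<η 0<δ η≤a η≤b close = subst₂ ℚ._≤_
      (trans (cong (ℚ.∣ b ℚ.- a ∣ ℚ.*_) (sym (ℚ.0≤p⇒∣p∣≡p 0≤rs)))
        (trans (sym (ℚ.∣p*q∣≡∣p∣*∣q∣ (b ℚ.- a) (r ℚ.* s))) (cong ℚ.∣_∣ difference)))
      (trans (pair-squares δ η (recip η 0<η))
        (trans (cong (λ u → δ ℚ.* (u ℚ.* u)) (recip-inverse 0<η)) (ℚ.*-identityʳ δ)))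
      (*-mono-≤ 0≤rs (ℚ.<⇒≤ (pos* 0<δ (pos* 0<η 0<η))) close rs≤)
      where
      r s : ℚ
      r = recip a 0<a
      s = recip b 0<b
      0≤rs : 0ℚ ℚ.≤ r ℚ.* s
      0≤rs = ℚ.<⇒≤ (pos* (recip-pos 0<a) (recip-pos 0<b))
      rs≤ : r ℚ.* s ℚ.≤ recip η 0<η ℚ.* recip η 0<η
      rs≤ = *-mono-≤ (ℚ.<⇒≤ (recip-pos 0<b)) (ℚ.<⇒≤ (recip-pos 0<η))
              (recip-anti 0<η 0<a η≤a) (recip-anti 0<η 0<b η≤b)
      difference : (b ℚ.- a) ℚ.* (r ℚ.* s) ≡ r ℚ.- s
      difference = trans (split-recip a b r s)
        (trans (cong₂ (λ u v → u ℚ.* r ℚ.- v ℚ.* s) (recip-inverse 0<b) (recip-inverse 0<a))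
          (cong₂ ℚ._-_ (ℚ.*-identityˡ r) (ℚ.*-identityˡ s)))

    recip-cauchy : ∀ {x η} (0<η : 0ℚ ℚ.< η) (x-pos : ∀ n → 0ℚ ℚ.< x n) → (∀ n → η ℚ.≤ x n) →
                   Cauchy x → Cauchy (λ n → recip (x n) (x-pos n))
    recip-cauchy {x} {η} 0<η x-pos η≤x cx δ 0<δ = proj₁ f , λ m n p q →
      recip-close (x-pos m) (x-pos n) 0<η 0<δ (η≤x m) (η≤x n) (proj₂ f n m q p)
      where
      f : ∃ λ N → ∀ m n → N ℕ.≤ m → N ℕ.≤ n → ℚ.∣ x m ℚ.- x n ∣ ℚ.≤ δ ℚ.* (η ℚ.* η)
      f = cx (δ ℚ.* (η ℚ.* η)) (pos* 0<δ (pos* 0<η 0<η))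

infixl 6 _+_ _-_ _⊔_
infixl 7 _*_
infix  8 -_

_+_ _*_ _⊔_ : ℝ → ℝ → ℝ
x + y = mkℝ (λ n → seq x n ℚ.+ seq y n) (+-cauchy {seq x} {seq y} (cauchy x) (cauchy y))
x * y = mkℝ (λ n → seq x n ℚ.* seq y n) (*-cauchy {seq x} {seq y} (cauchy x) (cauchy y))
x ⊔ y = mkℝ (λ n → seq x n ℚ.⊔ seq y n) (⊔-cauchy {seq x} {seq y} (cauchy x) (cauchy y))

-_ : ℝ → ℝ
- x = mkℝ (λ n → ℚ.- seq x n) (neg-cauchy {seq x} (cauchy x))

_-_ : ℝ → ℝ → ℝ
x - y = x + (- y)

-- The proof of positivity provides  η > 0  with  seq x n ≥ η  eventually, so
-- truncating the terms below at  η  does not change the real number.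
inv : (x : ℝ) → 0ℝ < x → ℝ
inv x (η , 0<η , _) = mkℝ
  (λ n → recip (seq x n ℚ.⊔ η) (⊔-pos (seq x n) 0<η))
  (recip-cauchy {λ n → seq x n ℚ.⊔ η} 0<η (λ n → ⊔-pos (seq x n) 0<η) (λ n → ℚ.p≤q⊔p (seq x n) η)
    (⊔-cauchy {seq x} {λ _ → η} (cauchy x) (cauchy (fromℚ η))))

∑ : ∀ {n} → (Fin n → ℝ) → ℝ
∑ = Vector.foldr _+_ 0ℝ

1/_! : ℕ → ℚ
1/ n ! = (+ 1 ℚ./ (n !)) {{n !≢0}}

-- Partial sums of  e = ∑ 1/k! .
expSum : ℕ → ℚ
expSum zero    = 1/ 0 !
expSum (suc n) = expSum n ℚ.+ 1/ (suc n) !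

private
  abstract
    1/-anti : ∀ a b .{{_ : ℕ.NonZero a}} .{{_ : ℕ.NonZero b}} → a ℕ.≤ b → + 1 ℚ./ b ℚ.≤ + 1 ℚ./ a
    1/-anti a@(suc _) b@(suc _) a≤b = ℚ.toℚᵘ-cancel-≤
      (ℚᵘ.≤-trans (ℚᵘ.≤-reflexive (ℚ.toℚᵘ-fromℚᵘ (+ 1 ℚᵘ./ b)))
        (ℚᵘ.≤-trans (ℚᵘ.*≤* (ℤ.*-monoˡ-≤-nonNeg (+ 1) (ℤ.+≤+ a≤b)))
          (ℚᵘ.≤-reflexive (ℚᵘ.≃-sym (ℚ.toℚᵘ-fromℚᵘ (+ 1 ℚᵘ./ a))))))

    1/n-pos : ∀ a .{{_ : ℕ.NonZero a}} → 0ℚ ℚ.< + 1 ℚ./ a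
    1/n-pos a = ℚ.positive⁻¹ (+ 1 ℚ./ a) {{ℚ.normalize-pos 1 a}}

    1/!-pos : ∀ n → 0ℚ ℚ.< 1/ n !
    1/!-pos n = 1/n-pos (n !) {{n !≢0}}

    1/-double : ∀ a .{{_ : ℕ.NonZero a}} .{{_ : ℕ.NonZero (2 ℕ.* a)}} →
                + 1 ℚ./ (2 ℕ.* a) ℚ.+ + 1 ℚ./ (2 ℕ.* a) ≡ + 1 ℚ./ a
    1/-double a@(suc k) = ℚ.toℚᵘ-injective
      (ℚᵘ.≃-trans (ℚ.toℚᵘ-homo-+ h h)
        (ℚᵘ.≃-trans (ℚᵘ.+-cong (ℚ.toℚᵘ-fromℚᵘ (+ 1 ℚᵘ./ (2 ℕ.* a))) (ℚ.toℚᵘ-fromℚᵘ (+ 1 ℚᵘ./ (2 ℕ.* a))))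
          (ℚᵘ.≃-trans (ℚᵘ.*≡* (cong +_ (lem a))) (ℚᵘ.≃-sym (ℚ.toℚᵘ-fromℚᵘ (+ 1 ℚᵘ./ a))))))
      where
      h : ℚ
      h = + 1 ℚ./ (2 ℕ.* a)
      open import Data.Nat.Tactic.RingSolver using (solve-∀)
      lem : ∀ a → (1 ℕ.* (2 ℕ.* a) ℕ.+ 1 ℕ.* (2 ℕ.* a)) ℕ.* a ≡ 1 ℕ.* ((2 ℕ.* a) ℕ.* (2 ℕ.* a))
      lem = solve-∀

    expSum-mono : ∀ {m n} → m ℕ.≤′ n → expSum m ℚ.≤ expSum n
    expSum-mono (ℕ.≤′-reflexive refl) = ℚ.≤-refl
    expSum-mono {n = suc n} (ℕ.≤′-step p) = ℚ.≤-trans (expSum-mono p)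
      (subst (ℚ._≤ expSum (suc n)) (ℚ.+-identityʳ (expSum n)) (ℚ.+-monoʳ-≤ (expSum n) (ℚ.<⇒≤ (1/!-pos (suc n)))))

    double-≤ : ∀ x y z → x ℚ.≤ y → y ℚ.+ y ≡ z → x ℚ.+ x ℚ.≤ z
    double-≤ x y z x≤y refl = ℚ.+-mono-≤ {x} {y} {x} {y} x≤y x≤y

    1/-halves : ∀ a b .{{_ : ℕ.NonZero a}} .{{_ : ℕ.NonZero (2 ℕ.* a)}} .{{_ : ℕ.NonZero b}} → 2 ℕ.* a ℕ.≤ b →
                + 1 ℚ./ b ℚ.+ + 1 ℚ./ b ℚ.≤ + 1 ℚ./ a
    1/-halves a b 2a≤b = double-≤ (+ 1 ℚ./ b) (+ 1 ℚ./ (2 ℕ.* a)) (+ 1 ℚ./ a) (1/-anti (2 ℕ.* a) b 2a≤b) (1/-double a)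

    1/!-halves : ∀ n → 1/ (2 ℕ.+ n) ! ℚ.+ 1/ (2 ℕ.+ n) ! ℚ.≤ 1/ (1 ℕ.+ n) !
    1/!-halves n = 1/-halves ((1 ℕ.+ n) !) ((2 ℕ.+ n) !)
      {{(1 ℕ.+ n) !≢0}} {{ℕ.m*n≢0 2 ((1 ℕ.+ n) !) {{_}} {{(1 ℕ.+ n) !≢0}}}} {{(2 ℕ.+ n) !≢0}}
      (ℕ.*-monoˡ-≤ ((1 ℕ.+ n) !) (ℕ.m≤m+n 2 n))

    expSum-tail : ∀ {m n} → suc m ℕ.≤′ n → expSum n ℚ.+ 1/ n ! ℚ.≤ expSum (suc m) ℚ.+ 1/ (suc m) !
    expSum-tail (ℕ.≤′-reflexive refl) = ℚ.≤-refl
    expSum-tail {n = suc zero} (ℕ.≤′-step (ℕ.≤′-reflexive ()))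
    expSum-tail {n = suc (suc n)} (ℕ.≤′-step p) = ℚ.≤-trans
      (subst (ℚ._≤ expSum (suc n) ℚ.+ 1/ (suc n) !) (sym (ℚ.+-assoc (expSum (suc n)) _ _))
        (ℚ.+-monoʳ-≤ (expSum (suc n)) (1/!-halves n)))
      (expSum-tail p)

    -- 1/q! ≤ 1/q ≤ δ  where q is the denominator of δ.
    1/!-small : ∀ δ → 0ℚ ℚ.< δ → ∃ λ N → 1/ (suc N) ! ℚ.≤ δ
    1/!-small δ@(ℚ.mkℚ (+ suc k) d c) 0<δ = d , ℚ.≤-trans
      (1/-anti (suc d) (suc d !) {{_}} {{suc d !≢0}} (n≤n! d))
      (ℚ.toℚᵘ-cancel-≤ (ℚᵘ.≤-trans (ℚᵘ.≤-reflexive (ℚ.toℚᵘ-fromℚᵘ (+ 1 ℚᵘ./ suc d)))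
        (ℚᵘ.*≤* (ℤ.*-monoʳ-≤-nonNeg (+ suc d) {+ 1} {+ suc k} (ℤ.+≤+ (ℕ.s≤s (ℕ.z≤n {k})))))))
      where
      n≤n! : ∀ d → suc d ℕ.≤ suc d !
      n≤n! d = ℕ.m≤m*n (suc d) (d !) {{d !≢0}}
    1/!-small (ℚ.mkℚ (+ zero) _ _) (ℚ.*<* (ℤ.+<+ ()))
    1/!-small (ℚ.mkℚ ℤ.-[1+ _ ] _ _) (ℚ.*<* ())

    expSum-cauchy : Cauchy expSum
    expSum-cauchy δ 0<δ with 1/!-small δ 0<δ
    ... | N , small = suc N , λ m n p q →
      ∣-∣≤′ (expSum m) (expSum n) δ (bound m n p q) (bound n m q p)
      where
      bound : ∀ m n → suc N ℕ.≤ m → suc N ℕ.≤ n → expSum m ℚ.≤ expSum n ℚ.+ δ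
      bound m n p q = ℚ.≤-trans
        (subst (ℚ._≤ expSum m ℚ.+ 1/ m !) (ℚ.+-identityʳ (expSum m)) (ℚ.+-monoʳ-≤ (expSum m) (ℚ.<⇒≤ (1/!-pos m))))
        (ℚ.≤-trans (expSum-tail (ℕ.≤⇒≤′ p)) (ℚ.+-mono-≤ (expSum-mono (ℕ.≤⇒≤′ q)) small))

e : ℝ
e = mkℝ expSum expSum-cauchy

e>0 : 0ℝ < e
e>0 = 1ℚ , ℚ.positive⁻¹ 1ℚ , 0 , λ n _ → expSum-mono (ℕ.≤⇒≤′ (ℕ.z≤n {n}))

1/e : ℝ
1/e = inv e e>0

-- Finite simple undirected graphs.
record Graph : Set where
  field
    #V #E : ℕ
    ends  : Fin #E → Fin #V × Fin #V

  V : Set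
  V = Fin #V

  E : Set
  E = Fin #E

  -- Edges are undirected: the order of the two ends is immaterial.
  Joins : E → V → V → Set
  Joins f u v = ends f ≡ (u , v) ⊎ ends f ≡ (v , u)

  field
    loopless    : ∀ f u → ¬ Joins f u u
    no-parallel : ∀ f f′ u v → Joins f u v → Joins f′ u v → f ≡ f′

module _ (G : Graph) where
  open Graph G

  -- The vertices of a cycle of length 3 + k are listed in cyclic order. In a
  -- simple graph every cycle has at least three vertices, and the vertices
  -- determine the edges.
  record IsCycle (S : Subset #E) {k : ℕ} (v : Vec V (3 ℕ.+ k)) : Set where
    constructor mkCycle
    field
      distinct : Injective _≡_ _≡_ (lookup v)
      closed   : ∀ i → ∃ λ f → f ∈ S × Joins f (lookup v i) (lookup v (suc (toℕ i) mod (3 ℕ.+ k)))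

  HasCycle : Subset #E → Set
  HasCycle S = ∃ λ k → Σ (Vec V (3 ℕ.+ k)) (IsCycle S)

  Acyclic : Subset #E → Set
  Acyclic S = ¬ HasCycle S

  -- Forests have infinite girth.
  GirthAtLeast : ℤ → Set
  GirthAtLeast g = ∀ {k} (v : Vec V (3 ℕ.+ k)) → IsCycle full v → g ℤ.≤ + (3 ℕ.+ k)

private
  anyVec? : ∀ {m} n {P : Vec (Fin m) n → Set} → (∀ v → Dec (P v)) → Dec (∃ P)
  anyVec? zero    P? = map′ (λ p → [] , p) (λ { ([] , p) → p }) (P? [])
  anyVec? (suc n) P? = map′ (λ { (x , v , p) → x ∷ v , p }) (λ { (x ∷ v , p) → x , v , p })
    (Fin.any? λ x → anyVec? n (λ v → P? (x ∷ v)))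

module _ (G : Graph) where
  open Graph G

  private
    joins? : ∀ f u v → Dec (Joins f u v)
    joins? f u v = (ends f ≟ (u , v)) ⊎-dec (ends f ≟ (v , u))
      where
      open import Data.Product.Properties using (≡-dec)
      _≟_ = ≡-dec (Fin._≟_ {#V}) (Fin._≟_ {#V})

    isCycle? : ∀ S {k} (v : Vec V (3 ℕ.+ k)) → Dec (IsCycle G S v)
    isCycle? S {k} v = map′ (λ { (d , c) → mkCycle (λ {i} {j} → d i j) c })
                            (λ { (mkCycle d c) → (λ i j → d {i} {j}) , c })
      (Fin.all? (λ i → Fin.all? (λ j → (lookup v i Fin.≟ lookup v j) →-dec (i Fin.≟ j)))
       ×-dec Fin.all? (λ i → Fin.any? (λ f → (f ∈? S) ×-dec
               joins? f (lookup v i) (lookup v (suc (toℕ i) mod (3 ℕ.+ k))))))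

    hasCycle? : ∀ S → Dec (HasCycle G S)
    hasCycle? S = map′ (λ { (k , _ , c) → k , c })
      (λ { (k , v , c) → k , ℕ.≤-trans (ℕ.m≤n+m (suc k) 2) (Fin.injective⇒≤ (IsCycle.distinct c)) , v , c })
      (ℕ.anyUpTo? (λ k → anyVec? (3 ℕ.+ k) (isCycle? S)) #V)

  acyclic? : ∀ S → Dec (Acyclic G S)
  acyclic? S = ¬? (hasCycle? S)

record ℝ⁺ : Set where
  constructor _,⁺_
  field
    value    : ℝ
    positive : 0ℝ < value
open ℝ⁺ public using (value)

Weighting : Graph → Set
Weighting G = Graph.E G → ℝ⁺

weight : ∀ {m} → (Fin m → ℝ⁺) → Subset m → ℝ
weight w S = ∑ λ f → if lookup S f then value (w f) else 0ℝ

subsets : ∀ n → List (Subset n)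
subsets zero    = [] ∷ []
subsets (suc n) = map (outside ∷_) (subsets n) ++ map (inside ∷_) (subsets n)

-- The initial value 0 of the maximum is the weight of the empty forest.
OPT : (G : Graph) → Weighting G → ℝ
OPT G w = foldr _⊔_ 0ℝ (map (weight w) (filter (acyclic? G) (subsets (Graph.#E G))))

record Observation (m : ℕ) : Set where
  constructor observed
  field
    edge     : Fin m
    revealed : ℝ⁺
    accepted : Bool
open Observation public

-- Most recent arrival first.
History : ℕ → Set
History m = List (Observation m)

_≈ᵒ_ : ∀ {m} → Observation m → Observation m → Set
o ≈ᵒ o′ = edge o ≡ edge o′ × value (revealed o) ≃ value (revealed o′) × accepted o ≡ accepted o′

acceptedSet : ∀ {m} → History m → Subset m
acceptedSet []      = ∅
acceptedSet (o ∷ h) = if accepted o then ⁅ edge o ⁆ ∪ acceptedSet h else acceptedSet h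

-- A randomized algorithm: accept h f x is the probability with which edge f,
-- arriving with weight x, is accepted, conditionally on everything seen and
-- decided before (h). As h records the past decisions, this covers arbitrary
-- correlation between the random choices made at different arrivals.
record Algorithm (G : Graph) : Set where
  open Graph G
  field
    accept   : History #E → E → ℝ⁺ → ℝ
    accept≥0 : ∀ h f x → 0ℝ ≤ accept h f x
    accept≤1 : ∀ h f x → accept h f x ≤ 1ℝ
    feasible : ∀ h f x → ¬ Acyclic G (⁅ f ⁆ ∪ acceptedSet h) → accept h f x ≃ 0ℝ
    -- The decision depends on the real weights, not on the Cauchy sequences
    -- representing them.
    respects : ∀ {h h′} f {x x′} → Pointwise _≈ᵒ_ h h′ → value x ≃ value x′ →
               accept h f x ≃ accept h′ f x′

module _ {G : Graph} (a : Algorithm G) (w : Weighting G) where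
  open Graph G
  open Algorithm a

  -- The expected final weight when history h has occurred and the remaining
  -- edges arrive in the given order.
  expectedFrom : History #E → List E → ℝ
  expectedFrom h []       = weight w (acceptedSet h)
  expectedFrom h (f ∷ fs) =
      p * expectedFrom (observed f (w f) true ∷ h) fs
    + (1ℝ - p) * expectedFrom (observed f (w f) false ∷ h) fs
    where p = accept h f (w f)

insertions : ∀ {A : Set} → A → List A → List (List A)
insertions x []       = (x ∷ []) ∷ []
insertions x (y ∷ ys) = (x ∷ y ∷ ys) ∷ map (y ∷_) (insertions x ys)

permutations : ∀ {A : Set} → List A → List (List A)
permutations []       = [] ∷ []
permutations (x ∷ xs) = concatMap (insertions x) (permutations xs)

-- The average over the  #E !  arrival orders.
𝔼ALG : {G : Graph} → Algorithm G → Weighting G → ℝ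
𝔼ALG {G} a w = fromℚ (1/ #E !) * foldr _+_ 0ℝ (map (expectedFrom a w []) (permutations (allFin #E)))
  where open Graph G

record FiniteDistribution (A : Set) : Set where
  field
    size    : ℕ
    outcome : Fin size → A
    prob    : Fin size → ℝ
    prob≥0  : ∀ i → 0ℝ ≤ prob i
    total   : ∑ prob ≃ 1ℝ

-- The expectation of a quantity indexed by the points of the support.
𝔼 : ∀ {A} (D : FiniteDistribution A) → (Fin (FiniteDistribution.size D) → ℝ) → ℝ
𝔼 D X = ∑ λ i → FiniteDistribution.prob D i * X i

HighGirthAlgorithm : ℤ → Set
HighGirthAlgorithm g = (G : Graph) → GirthAtLeast G g → Algorithm G

Competitive : (g : ℤ) → ℝ → HighGirthAlgorithm g → Set
Competitive g α a = ∀ G (girth : GirthAtLeast G g) (w : Weighting G) → OPT G w ≤ α * 𝔼ALG (a G girth) w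

{-# OPTIONS --safe #-}

-- The graph is bipartite with left vertices of degree d and far fewer right than
-- left vertices; it arises from a complete bipartite graph by repeatedly passing
-- to the cover with group (ℤ/2)^E, where a closed walk crosses every edge below an
-- even number of times, so that the girth grows.  A forest contains at most one
-- edge per left vertex plus one per right vertex.  Hence an algorithm essentially
-- plays a separate secretary problem, with d candidates, at every left vertex.
--
-- The weights at a left vertex are β^x₁, …, β^x_d for a large base β.  The codes x
-- follow a scale mixture of uniform laws: a scale t has probability about 1/t, and
-- the codes are independent and uniform on {0, …, t}.  For this law the codes seen
-- so far say (almost) nothing about the next one being a record beyond the classical
-- probability 1/k, and it is exchangeable, so for every fixed arrival order the
-- maximum is picked with probability at most the value of the classical secretary
-- problem.  That value is at most r/d if 1/r + ⋯ + 1/(d-1) ≤ 1 < 1/r + ⋯ + 1/d, and the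
-- inequality ∑_{i ≤ m} sⁱ/i! ≤ n/r for s = 1/(r+1) + ⋯ + 1/n bounds it by 1/e + O(1/d).
--
-- The expectation of a ratio is turned into a ratio of expectations by weighting a
-- product law with the sum of the maxima, a lower bound for OPT.  The left vertices
-- are then independent, and the bounds for the single vertices add up.
module Submission where

open import Data.Bool using (Bool; true; false; if_then_else_)
open import Data.Empty using (⊥)
open import Data.Fin using (Fin; zero; suc; toℕ; combine)
import Data.Fin.Properties as Fin
open import Data.Integer using (ℤ)
import Data.Integer as ℤ
import Data.Integer.Properties as ℤ
open import Data.List using (List; []; _∷_; _++_; map; concatMap; foldr; length; allFin)
import Data.List.Properties as List
open import Data.Maybe using (Maybe; just; nothing; maybe)
open import Data.Nat using (ℕ; zero; suc; _!)
import Data.Nat as ℕ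
import Data.Nat.Properties as ℕ
open import Data.Product using (Σ; Σ-syntax; ∃; _×_; _,_; proj₁; proj₂)
open import Data.Sum using (_⊎_; inj₁; inj₂)
open import Data.Vec using (Vec; []; _∷_)
import Data.Vec.Properties as Vec
open import Function using (_∘_)
open import Relation.Binary.Definitions using (DecidableEquality)
open import Relation.Binary.PropositionalEquality
open import Relation.Nullary using (¬_; Dec; does; yes; no; contradiction)

-- Ranks alone would give the classical problem, but the algorithm sees the weights too, and codes
-- uniform on a known range would betray how close a record is to the top; hence the mixture over
-- scales. A code vector has density 1/((t+1)⋯(t+d+1)) at scale `t`, not 1/(t+1)^(d+1), because sums
-- of such terms telescope exactly. The price is additive: the game is bounded in terms of `H N`,
-- whereas the true mass is only known to be at least `H N` - d(d+1)/2. As `H` diverges, many scales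
-- make this harmless.
--
-- The parameters depend on each other in the order base, degree `d`, number `N` of scales, and
-- number `M` of left vertices of the uncovered graph: each right vertex may bring one additional
-- edge, of weight up to `W` = β^N, so `M` has to exceed `W` by far.
--
-- Acceptance probabilities are Cauchy sequences, on which no case distinction is possible. For each
-- index n, the n-th terms are turned into the probabilities of a rational algorithm; the estimates
-- for these algorithms are uniform in n, and only they are carried over to the reals.

-- Rational arithmetic, the embedding of the naturals, finite sums.

module Rationals where
  open import Data.Integer.Tactic.RingSolver using () renaming (solve-∀ to ℤ-solve-∀)
  open import Data.Rational
  open import Data.Rational.Properties
  import Data.Rational.Unnormalised as ℚᵘ
  import Data.Rational.Unnormalised.Properties as ℚᵘ
  open import Data.Rational.Solver using (module +-*-Solver)

  ≤-diff : ∀ {a b} e → 0ℚ ≤ e → b ≡ a + e → a ≤ b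
  ≤-diff {a} e 0≤e refl = subst (_≤ a + e) (+-identityʳ a) (+-monoʳ-≤ a 0≤e)

  diff-≤ : ∀ {a b} → a ≤ b → 0ℚ ≤ b - a
  diff-≤ {a} {b} a≤b = subst (_≤ b - a) (+-inverseʳ a) (+-monoˡ-≤ (- a) a≤b)

  0≤+ : ∀ {a b} → 0ℚ ≤ a → 0ℚ ≤ b → 0ℚ ≤ a + b
  0≤+ {a} {b} = +-mono-≤ {0ℚ} {a} {0ℚ} {b}

  *-monoˡ : ∀ {a b} c → 0ℚ ≤ c → a ≤ b → c * a ≤ c * b
  *-monoˡ c 0≤c = *-monoˡ-≤-nonNeg c {{nonNegative 0≤c}}

  *-monoʳ : ∀ {a b} c → 0ℚ ≤ c → a ≤ b → a * c ≤ b * c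
  *-monoʳ c 0≤c = *-monoʳ-≤-nonNeg c {{nonNegative 0≤c}}

  *-mono : ∀ {a b c d} → 0ℚ ≤ a → 0ℚ ≤ d → a ≤ b → c ≤ d → a * c ≤ b * d
  *-mono {a} {b} {c} {d} 0≤a 0≤d a≤b c≤d = ≤-trans (*-monoˡ a 0≤a c≤d) (*-monoʳ d 0≤d a≤b)

  0≤* : ∀ {a b} → 0ℚ ≤ a → 0ℚ ≤ b → 0ℚ ≤ a * b
  0≤* {a} {b} 0≤a 0≤b = subst (_≤ a * b) (*-zeroʳ a) (*-monoˡ a 0≤a 0≤b)

  0<* : ∀ {a b} → 0ℚ < a → 0ℚ < b → 0ℚ < a * b
  0<* {a} {b} 0<a 0<b = positive⁻¹ (a * b) {{pos*pos⇒pos a {{positive 0<a}} b {{positive 0<b}}}}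

  0<1 : 0ℚ < 1ℚ
  0<1 = positive⁻¹ 1ℚ

  0≤1 : 0ℚ ≤ 1ℚ
  0≤1 = <⇒≤ 0<1

  0<-factor : ∀ {t q w} → 0ℚ < t → 0ℚ ≤ w → t ≤ q * w → 0ℚ < q
  0<-factor {t} {q} {w} 0<t 0≤w t≤qw with 0ℚ <? q
  ... | yes 0<q = 0<q
  ... | no 0≮q  = contradiction (<-≤-trans 0<t (≤-trans t≤qw (≤-trans (*-monoʳ w 0≤w (≮⇒≥ 0≮q)) (≤-reflexive (*-zeroˡ w))))) (<-irrefl refl)

  p<p+1 : ∀ p → p < p + 1ℚ
  p<p+1 p = subst (_< p + 1ℚ) (+-identityʳ p) (+-monoʳ-< p {0ℚ} {1ℚ} 0<1)

  -- Recursive, so that `ι (suc n)` unfolds to `1ℚ + ι n` and the ring solver can treat it as such;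
  -- `ι≡` gives the link to fractions.
  ι : ℕ → ℚ
  ι zero    = 0ℚ
  ι (suc n) = 1ℚ + ι n

  0≤ι : ∀ n → 0ℚ ≤ ι n
  0≤ι zero    = ≤-refl
  0≤ι (suc n) = 0≤+ 0≤1 (0≤ι n)

  0<ι : ∀ n → 0ℚ < ι (suc n)
  0<ι n = <-≤-trans 0<1 (≤-diff (ι n) (0≤ι n) refl)

  ι-+ : ∀ m n → ι (m ℕ.+ n) ≡ ι m + ι n
  ι-+ zero    n = sym (+-identityˡ (ι n))
  ι-+ (suc m) n = trans (cong (1ℚ +_) (ι-+ m n)) (sym (+-assoc 1ℚ (ι m) (ι n)))

  ι-* : ∀ m n → ι (m ℕ.* n) ≡ ι m * ι n
  ι-* zero    n = sym (*-zeroˡ (ι n))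
  ι-* (suc m) n = trans (ι-+ n (m ℕ.* n)) (trans (cong (ι n +_) (ι-* m n))
    (solve 2 (λ a b → b :+ a :* b := (con 1ℚ :+ a) :* b) refl (ι m) (ι n)))
    where open +-*-Solver

  ι-mono : ∀ {m n} → m ℕ.≤ n → ι m ≤ ι n
  ι-mono {m} {n} m≤n = ≤-diff (ι (n ℕ.∸ m)) (0≤ι (n ℕ.∸ m)) (trans (cong ι (sym (ℕ.m+[n∸m]≡n m≤n))) (ι-+ m (n ℕ.∸ m)))

  ι≡ : ∀ n → ι n ≡ ℤ.+ n / 1
  ι≡ zero    = refl
  ι≡ (suc n) = trans (cong (_+_ 1ℚ) (ι≡ n)) (toℚᵘ-injective
    (ℚᵘ.≃-trans (toℚᵘ-homo-+ 1ℚ (ℤ.+ n / 1))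
      (ℚᵘ.≃-trans (ℚᵘ.+-congʳ ℚᵘ.1ℚᵘ (toℚᵘ-fromℚᵘ (ℤ.+ n ℚᵘ./ 1)))
        (ℚᵘ.≃-trans (ℚᵘ.*≡* {p = ℚᵘ.1ℚᵘ ℚᵘ.+ (ℤ.+ n ℚᵘ./ 1)} {q = ℤ.+ suc n ℚᵘ./ 1} (numerators (ℤ.+ n)))
          (ℚᵘ.≃-sym (toℚᵘ-fromℚᵘ (ℤ.+ suc n ℚᵘ./ 1)))))))
    where
    numerators : ∀ z → (ℤ.+ 1 ℤ.* ℤ.+ 1 ℤ.+ z ℤ.* ℤ.+ 1) ℤ.* ℤ.+ 1 ≡ (ℤ.+ 1 ℤ.+ z) ℤ.* (ℤ.+ 1 ℤ.* ℤ.+ 1)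
    numerators = ℤ-solve-∀

  1/n*n : ∀ n .{{_ : ℕ.NonZero n}} → (ℤ.+ 1 / n) * ι n ≡ 1ℚ
  1/n*n n@(suc m) = trans (cong ((ℤ.+ 1 / n) *_) (ι≡ n)) (toℚᵘ-injective
    (ℚᵘ.≃-trans (toℚᵘ-homo-* (ℤ.+ 1 / n) (ℤ.+ n / 1))
      (ℚᵘ.≃-trans (ℚᵘ.*-cong (toℚᵘ-fromℚᵘ (ℤ.+ 1 ℚᵘ./ n)) (toℚᵘ-fromℚᵘ (ℤ.+ n ℚᵘ./ 1)))
        (ℚᵘ.*≡* {p = (ℤ.+ 1 ℚᵘ./ n) ℚᵘ.* (ℤ.+ n ℚᵘ./ 1)} {q = ℚᵘ.1ℚᵘ} (numerators (ℤ.+ n))))))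
    where
    numerators : ∀ z → (ℤ.+ 1 ℤ.* z) ℤ.* ℤ.+ 1 ≡ ℤ.+ 1 ℤ.* (z ℤ.* ℤ.+ 1)
    numerators = ℤ-solve-∀

  -- rcp n = 1 / (n + 1)
  rcp : ℕ → ℚ
  rcp n = ℤ.+ 1 / suc n

  rcp* : ∀ n → rcp n * ι (suc n) ≡ 1ℚ
  rcp* n = 1/n*n (suc n)

  0<rcp : ∀ n → 0ℚ < rcp n
  0<rcp n = positive⁻¹ (rcp n) {{normalize-pos 1 (suc n)}}

  0≤rcp : ∀ n → 0ℚ ≤ rcp n
  0≤rcp n = <⇒≤ (0<rcp n)

  cancelˡ : ∀ {a b} r s → 0ℚ ≤ r → r * s ≡ 1ℚ → s * a ≤ s * b → a ≤ b
  cancelˡ {a} {b} r s 0≤r rs sa≤sb = subst₂ _≤_ (back a) (back b) (*-monoˡ r 0≤r sa≤sb)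
    where
    back : ∀ a → r * (s * a) ≡ a
    back a = trans (sym (*-assoc r s a)) (trans (cong (_* a) rs) (*-identityˡ a))

  rcp-anti : ∀ {m n} → m ℕ.≤ n → rcp n ≤ rcp m
  rcp-anti {m} {n} m≤n = cancelˡ (rcp n) (ι (suc n)) (0≤rcp n) (rcp* n)
    (subst₂ _≤_ (trans (rcp* m) (trans (sym (rcp* n)) (*-comm (rcp n) (ι (suc n))))) (*-comm (rcp m) (ι (suc n)))
      (*-monoˡ (rcp m) (0≤rcp m) (ι-mono (ℕ.s≤s m≤n))))

  -- The numerator serves as the bound, because the denominator is at least 1.
  archimedean : ∀ q → ∃ λ n → q ≤ ι n
  archimedean q@(mkℚ (ℤ.+ n) d c) = n , subst (q ≤_) (sym (ι≡ n)) (toℚᵘ-cancel-≤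
    (ℚᵘ.≤-trans (ℚᵘ.*≤* (ℤ.*-monoˡ-≤-nonNeg (ℤ.+ n) (ℤ.+≤+ (ℕ.s≤s ℕ.z≤n))))
      (ℚᵘ.≤-reflexive (ℚᵘ.≃-sym (toℚᵘ-fromℚᵘ (ℤ.+ n ℚᵘ./ 1))))))
  archimedean (mkℚ ℤ.-[1+ n ] d c) = 0 , *≤* ℤ.-≤+

  sumL : ∀ {A : Set} → List A → (A → ℚ) → ℚ
  sumL []       f = 0ℚ
  sumL (x ∷ xs) f = f x + sumL xs f

  module _ {A : Set} where
    open +-*-Solver

    sumL-cong : ∀ (l : List A) {f g} → (∀ x → f x ≡ g x) → sumL l f ≡ sumL l g
    sumL-cong []       e = refl
    sumL-cong (x ∷ xs) e = cong₂ _+_ (e x) (sumL-cong xs e)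

    sumL-mono : ∀ (l : List A) {f g} → (∀ x → f x ≤ g x) → sumL l f ≤ sumL l g
    sumL-mono []       e = ≤-refl
    sumL-mono (x ∷ xs) e = +-mono-≤ (e x) (sumL-mono xs e)

    sumL-+ : ∀ (l : List A) f g → sumL l (λ x → f x + g x) ≡ sumL l f + sumL l g
    sumL-+ []       f g = refl
    sumL-+ (x ∷ xs) f g = trans (cong (f x + g x +_) (sumL-+ xs f g))
      (solve 4 (λ a b c d → a :+ b :+ (c :+ d) := a :+ c :+ (b :+ d)) refl (f x) (g x) (sumL xs f) (sumL xs g))

    sumL-* : ∀ (l : List A) c f → sumL l (λ x → c * f x) ≡ c * sumL l f
    sumL-* []       c f = sym (*-zeroʳ c)
    sumL-* (x ∷ xs) c f = trans (cong (c * f x +_) (sumL-* xs c f)) (sym (*-distribˡ-+ c (f x) (sumL xs f)))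

    sumL-*ʳ : ∀ (l : List A) c f → sumL l (λ x → f x * c) ≡ sumL l f * c
    sumL-*ʳ l c f = trans (sumL-cong l (λ x → *-comm (f x) c)) (trans (sumL-* l c f) (*-comm c (sumL l f)))

    sumL-const : ∀ (l : List A) c → sumL l (λ _ → c) ≡ ι (length l) * c
    sumL-const []       c = sym (*-zeroˡ c)
    sumL-const (x ∷ xs) c = trans (cong (c +_) (sumL-const xs c))
      (solve 2 (λ n c → c :+ n :* c := (con 1ℚ :+ n) :* c) refl (ι (length xs)) c)

    sumL-0 : ∀ (l : List A) → sumL l (λ _ → 0ℚ) ≡ 0ℚ
    sumL-0 l = trans (sumL-const l 0ℚ) (*-zeroʳ (ι (length l)))

    sumL-0≤ : ∀ (l : List A) {f} → (∀ x → 0ℚ ≤ f x) → 0ℚ ≤ sumL l f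
    sumL-0≤ []       e = ≤-refl
    sumL-0≤ (x ∷ xs) e = 0≤+ (e x) (sumL-0≤ xs e)

    sumL-++ : ∀ (k l : List A) f → sumL (k ++ l) f ≡ sumL k f + sumL l f
    sumL-++ []       l f = sym (+-identityˡ (sumL l f))
    sumL-++ (x ∷ xs) l f = trans (cong (f x +_) (sumL-++ xs l f)) (sym (+-assoc (f x) (sumL xs f) (sumL l f)))

  sumL-map : ∀ {A B : Set} (g : A → B) l f → sumL (map g l) f ≡ sumL l (λ x → f (g x))
  sumL-map g []       f = refl
  sumL-map g (x ∷ xs) f = cong (f (g x) +_) (sumL-map g xs f)

  sumL-concatMap : ∀ {A B : Set} (g : A → List B) l f → sumL (concatMap g l) f ≡ sumL l (λ x → sumL (g x) f)
  sumL-concatMap g []       f = refl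
  sumL-concatMap g (x ∷ xs) f = trans (sumL-++ (g x) (concatMap g xs) f) (cong (sumL (g x) f +_) (sumL-concatMap g xs f))

  sumL-swap : ∀ {A B : Set} (k : List A) (l : List B) (f : A → B → ℚ) →
              sumL k (λ x → sumL l (f x)) ≡ sumL l (λ y → sumL k (λ x → f x y))
  sumL-swap []       l f = sym (sumL-0 l)
  sumL-swap (x ∷ xs) l f = trans (cong (sumL l (f x) +_) (sumL-swap xs l f))
    (sym (sumL-+ l (f x) (λ y → sumL xs (λ x′ → f x′ y))))

-- Harmonic numbers and the exponential inequality behind 1/e.

module Harmonic where
  open import Data.Rational hiding (1/_)
  open import Data.Rational.Properties
  open import Data.Rational.Solver using (module +-*-Solver)
  open import Data.Empty using (⊥-elim)
  open import Relation.Nullary.Decidable using (toWitness)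
  open import Defs using (expSum; 1/_!)
  open Rationals

  H : ℕ → ℚ
  H zero    = 0ℚ
  H (suc n) = H n + rcp n

  -- Each of the `m` added terms is at least the first term after the block. For `m = suc n` this is
  -- the doubling argument for divergence: the block contributes at least 1/2.
  H-mono-+ : ∀ n m → H n + ι m * rcp (n ℕ.+ m) ≤ H (n ℕ.+ m)
  H-mono-+ n zero    = ≤-reflexive (trans (cong (H n +_) (*-zeroˡ (rcp (n ℕ.+ 0)))) (trans (+-identityʳ (H n)) (cong H (sym (ℕ.+-identityʳ n)))))
  H-mono-+ n (suc m) rewrite ℕ.+-suc n m = begin
    H n + ι (suc m) * q  ≡⟨ solve 3 (λ h m q → h :+ (con 1ℚ :+ m) :* q := (h :+ m :* q) :+ q) refl (H n) (ι m) q ⟩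
    (H n + ι m * q) + q  ≤⟨ +-mono-≤ (+-monoʳ-≤ (H n) (*-monoˡ (ι m) (0≤ι m) q≤p)) q≤p ⟩
    (H n + ι m * p) + p  ≤⟨ +-monoˡ-≤ p (H-mono-+ n m) ⟩
    H (n ℕ.+ m) + p  ∎
    where
    open ≤-Reasoning
    open +-*-Solver
    p = rcp (n ℕ.+ m)
    q = rcp (suc (n ℕ.+ m))
    q≤p : q ≤ p
    q≤p = rcp-anti (ℕ.n≤1+n (n ℕ.+ m))

  H-mono : ∀ {m n} → m ℕ.≤ n → H m ≤ H n
  H-mono {m} {n} m≤n = subst (λ k → H m ≤ H k) (ℕ.m+[n∸m]≡n m≤n)
    (≤-trans (≤-diff _ (0≤* (0≤ι (n ℕ.∸ m)) (0≤rcp (m ℕ.+ (n ℕ.∸ m)))) refl) (H-mono-+ m (n ℕ.∸ m)))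

  0≤H : ∀ n → 0ℚ ≤ H n
  0≤H n = H-mono {0} {n} ℕ.z≤n

  H-double : ∀ n → H n + ½ ≤ H (n ℕ.+ suc n)
  H-double n = subst (λ h → H n + h ≤ H (n ℕ.+ suc n)) half (H-mono-+ n (suc n))
    where
    open +-*-Solver
    a = ι (suc n)
    r = rcp (n ℕ.+ suc n)
    r[a+a] : r * (a + a) ≡ 1ℚ
    r[a+a] = trans (cong (r *_) (sym (ι-+ (suc n) (suc n)))) (rcp* (n ℕ.+ suc n))
    half : a * r ≡ ½
    half = trans (solve 2 (λ a r → a :* r := con ½ :* (r :* (a :+ a))) refl a r) (trans (cong (½ *_) r[a+a]) refl)

  H-halves : ∀ k → ∃ λ n → ι k * ½ ≤ H n
  H-halves zero = 0 , ≤-refl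
  H-halves (suc k) with H-halves k
  ... | n , le = n ℕ.+ suc n , ≤-trans
    (≤-trans (≤-reflexive (solve 1 (λ k → (con 1ℚ :+ k) :* con ½ := k :* con ½ :+ con ½) refl (ι k))) (+-monoˡ-≤ ½ le))
    (H-double n)
    where open +-*-Solver

  H-diverges : ∀ q → ∃ λ n → q ≤ H n
  H-diverges q with archimedean q
  ... | k , q≤k with H-halves (k ℕ.+ k)
  ... | n , le = n , ≤-trans q≤k (subst (_≤ H n) (trans (cong (_* ½) (ι-+ k k))
     (solve 1 (λ k → (k :+ k) :* con ½ := k) refl (ι k))) le)
    where open +-*-Solver

  -- Divergence supplies an index where `H` exceeds `q`; the search runs downwards from there to the
  -- last index at which `H` is at most `q`.
  crossing : ∀ m q → H m ≤ q → ∃ λ n → m ℕ.≤ n × H n ≤ q × q < H (suc n)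
  crossing m q m≤q = go (proj₁ far) (proj₂ far)
    where
    far : ∃ λ k → q < H (m ℕ.+ k)
    far = n , <-≤-trans (p<p+1 q) (≤-trans (proj₂ (H-diverges (q + 1ℚ))) (H-mono (ℕ.m≤n+m n m)))
      where n = proj₁ (H-diverges (q + 1ℚ))
    go : ∀ k → q < H (m ℕ.+ k) → ∃ λ n → m ℕ.≤ n × H n ≤ q × q < H (suc n)
    go zero    lt = ⊥-elim (<-irrefl refl (<-≤-trans lt (subst (λ j → H j ≤ q) (sym (ℕ.+-identityʳ m)) m≤q)))
    go (suc k) lt with q <? H (m ℕ.+ k)
    ... | yes lt′ = go k lt′
    ... | no ≮  = m ℕ.+ k , ℕ.m≤m+n m k , ≮⇒≥ ≮ , subst (λ j → q < H j) (ℕ.+-suc m k) lt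

  expTerm : ℕ → ℚ → ℚ
  expTerm zero    s = 1ℚ
  expTerm (suc i) s = expTerm i s * s * rcp i

  expPoly : ℕ → ℚ → ℚ
  expPoly zero    s = 1ℚ
  expPoly (suc m) s = expPoly m s + expTerm (suc m) s

  1/!-suc : ∀ n → 1/ (suc n) ! ≡ 1/ n ! * 1ℚ * rcp n
  1/!-suc n = begin
    a  ≡⟨ *-identityʳ a ⟨
    a * 1ℚ  ≡⟨ cong (a *_) prod ⟨
    a * (b * ι (n !) * (rcp n * ι (suc n)))  ≡⟨ solve 5 (λ a b f r s → a :* (b :* f :* (r :* s)) := (a :* (s :* f)) :* (b :* con 1ℚ :* r)) refl a b (ι (n !)) (rcp n) (ι (suc n)) ⟩
    a * (ι (suc n) * ι (n !)) * c  ≡⟨ cong (λ z → a * z * c) (ι-* (suc n) (n !)) ⟨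
    a * ι ((suc n) !) * c  ≡⟨ cong (_* c) (1/n*n ((suc n) !) {{(suc n) ℕ.!≢0}}) ⟩
    1ℚ * c  ≡⟨ *-identityˡ c ⟩
    c  ∎
    where
    open ≡-Reasoning
    open +-*-Solver
    a = 1/ (suc n) !
    b = 1/ n !
    c = b * 1ℚ * rcp n
    prod : b * ι (n !) * (rcp n * ι (suc n)) ≡ 1ℚ
    prod = cong₂ _*_ (1/n*n (n !) {{n ℕ.!≢0}}) (rcp* n)

  expTerm-1 : ∀ i → expTerm i 1ℚ ≡ 1/ i !
  expTerm-1 zero    = refl
  expTerm-1 (suc i) = trans (cong (λ z → z * 1ℚ * rcp i) (expTerm-1 i)) (sym (1/!-suc i))

  expPoly-1 : ∀ m → expPoly m 1ℚ ≡ expSum m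
  expPoly-1 zero    = refl
  expPoly-1 (suc m) = cong₂ _+_ (expPoly-1 m) (expTerm-1 (suc m))

  0≤expTerm : ∀ i {s} → 0ℚ ≤ s → 0ℚ ≤ expTerm i s
  0≤expTerm zero    0≤s = 0≤1
  0≤expTerm (suc i) 0≤s = 0≤* (0≤* (0≤expTerm i 0≤s) 0≤s) (0≤rcp i)

  expTerm-mono : ∀ i {x y} → 0ℚ ≤ x → x ≤ y → expTerm i x ≤ expTerm i y
  expTerm-mono zero    0≤x x≤y = ≤-refl
  expTerm-mono (suc i) 0≤x x≤y = *-monoʳ (rcp i) (0≤rcp i)
    (*-mono (0≤expTerm i 0≤x) (≤-trans 0≤x x≤y) (expTerm-mono i 0≤x x≤y) x≤y)

  expPoly-mono : ∀ m {x y} → 0ℚ ≤ x → x ≤ y → expPoly m x ≤ expPoly m y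
  expPoly-mono zero    0≤x x≤y = ≤-refl
  expPoly-mono (suc m) 0≤x x≤y = +-mono-≤ (expPoly-mono m 0≤x x≤y) (expTerm-mono (suc m) 0≤x x≤y)

  0≤expPoly : ∀ m {s} → 0ℚ ≤ s → 0ℚ ≤ expPoly m s
  0≤expPoly zero    0≤s = 0≤1
  0≤expPoly (suc m) 0≤s = 0≤+ (0≤expPoly m 0≤s) (0≤expTerm (suc m) 0≤s)

  -- Mean value estimates.
  expTerm-step : ∀ i y h → 0ℚ ≤ y → 0ℚ ≤ h → expTerm (suc i) (y + h) ≤ expTerm (suc i) y + h * expTerm i (y + h)
  expTerm-step zero y h 0≤y 0≤h = ≤-reflexive
    (solve 2 (λ y h → con 1ℚ :* (y :+ h) :* con 1ℚ := con 1ℚ :* y :* con 1ℚ :+ h :* con 1ℚ) refl y h)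
    where open +-*-Solver
  expTerm-step (suc j) y h 0≤y 0≤h = begin
    tx * (y + h) * r  ≡⟨ solve 4 (λ t y h r → t :* (y :+ h) :* r := (y :* t :+ h :* t) :* r) refl tx y h r ⟩
    (y * tx + h * tx) * r  ≤⟨ *-monoʳ r (0≤rcp (suc j)) (+-monoˡ-≤ (h * tx) (*-monoˡ y 0≤y (expTerm-step j y h 0≤y 0≤h))) ⟩
    (y * (ty + h * u) + h * tx) * r  ≡⟨ solve 6 (λ y t h u tx r → (y :* (t :+ h :* u) :+ h :* tx) :* r := (y :* t :+ h :* (y :* u) :+ h :* tx) :* r) refl y ty h u tx r ⟩
    (y * ty + h * (y * u) + h * tx) * r ≤⟨ *-monoʳ r (0≤rcp (suc j)) (+-monoˡ-≤ (h * tx) (+-monoʳ-≤ (y * ty) (*-monoˡ h 0≤h (*-monoʳ u 0≤u y≤x)))) ⟩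
    (y * ty + h * (x * u) + h * tx) * r ≡⟨ cong (λ z → (y * ty + h * z + h * tx) * r) xu ⟩
    (y * ty + h * (ι (suc j) * tx) + h * tx) * r ≡⟨ solve 6 (λ y t h n tx r → (y :* t :+ h :* (n :* tx) :+ h :* tx) :* r := t :* y :* r :+ h :* tx :* (r :* (con 1ℚ :+ n))) refl y ty h (ι (suc j)) tx r ⟩
    ty * y * r + h * tx * (r * ι (suc (suc j))) ≡⟨ cong (λ z → ty * y * r + h * tx * z) (rcp* (suc j)) ⟩
    ty * y * r + h * tx * 1ℚ  ≡⟨ cong (ty * y * r +_) (*-identityʳ (h * tx)) ⟩
    ty * y * r + h * tx  ∎
    where
    open ≤-Reasoning
    open +-*-Solver
    x = y + h
    u = expTerm j x
    tx = expTerm (suc j) x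
    ty = expTerm (suc j) y
    r = rcp (suc j)
    y≤x : y ≤ x
    y≤x = ≤-diff h 0≤h refl
    0≤u : 0ℚ ≤ u
    0≤u = 0≤expTerm j (0≤+ 0≤y 0≤h)
    xu : x * u ≡ ι (suc j) * tx
    xu = trans (sym (*-identityʳ (x * u))) (trans (cong (x * u *_) (sym (rcp* j)))
      (solve 4 (λ x u r n → x :* u :* (r :* n) := n :* (u :* x :* r)) refl x u (rcp j) (ι (suc j))))

  expPoly-step′ : ∀ m y h → 0ℚ ≤ y → 0ℚ ≤ h → expPoly (suc m) (y + h) ≤ expPoly (suc m) y + h * expPoly m (y + h)
  expPoly-step′ zero y h 0≤y 0≤h = ≤-trans (+-monoʳ-≤ 1ℚ (expTerm-step 0 y h 0≤y 0≤h))
    (≤-reflexive (sym (+-assoc 1ℚ (expTerm 1 y) (h * 1ℚ))))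
  expPoly-step′ (suc m) y h 0≤y 0≤h = ≤-trans
    (+-mono-≤ (expPoly-step′ m y h 0≤y 0≤h) (expTerm-step (suc m) y h 0≤y 0≤h))
    (≤-reflexive (solve 5 (λ a b h p t → (a :+ h :* p) :+ (b :+ h :* t) := (a :+ b) :+ h :* (p :+ t)) refl
       (expPoly (suc m) y) (expTerm (suc (suc m)) y) h (expPoly m (y + h)) (expTerm (suc m) (y + h))))
    where open +-*-Solver

  -- Rearranged, (1 - h) P(y + h) ≤ P(y) for the truncated exponential P. The lower degree obtained
  -- in `expPoly-step′` is given up so that the same polynomial stands on both sides and the
  -- inequality can be iterated.
  expPoly-step : ∀ m y h → 0ℚ ≤ y → 0ℚ ≤ h → expPoly m (y + h) ≤ expPoly m y + h * expPoly m (y + h)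
  expPoly-step zero    y h 0≤y 0≤h = ≤-diff (h * 1ℚ) (0≤* 0≤h 0≤1) refl
  expPoly-step (suc m) y h 0≤y 0≤h = ≤-trans (expPoly-step′ m y h 0≤y 0≤h)
    (+-monoʳ-≤ (expPoly (suc m) y) (*-monoˡ h 0≤h (≤-diff _ (0≤expTerm (suc m) (0≤+ 0≤y 0≤h)) refl)))

  -- ln (k / r) ≥ 1/(r+1) + … + 1/k  in exponentiated form.
  expPoly-H : ∀ m r k → 1 ℕ.≤ r → ι r * expPoly m (H (r ℕ.+ k) - H r) ≤ ι (r ℕ.+ k)
  expPoly-H m r zero 1≤r = ≤-reflexive (trans (cong (λ z → ι r * expPoly m z) (trans (cong (λ j → H j - H r) (ℕ.+-identityʳ r)) (+-inverseʳ (H r))))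
    (trans (cong (ι r *_) (expPoly-0 m)) (trans (*-identityʳ (ι r)) (cong ι (sym (ℕ.+-identityʳ r))))))
    where
    expTerm-0 : ∀ i → expTerm (suc i) 0ℚ ≡ 0ℚ
    expTerm-0 i = trans (cong (_* rcp i) (*-zeroʳ (expTerm i 0ℚ))) (*-zeroˡ (rcp i))
    expPoly-0 : ∀ m → expPoly m 0ℚ ≡ 1ℚ
    expPoly-0 zero    = refl
    expPoly-0 (suc m) = cong₂ _+_ (expPoly-0 m) (expTerm-0 m)
  expPoly-H m r@(suc r′) (suc k) 1≤r = subst (λ j → ι r * expPoly m (H j - H r) ≤ ι j) (sym (ℕ.+-suc r k)) goal
    where
    open ≤-Reasoning
    open +-*-Solver
    n = r ℕ.+ k
    h = rcp n
    y = H n - H r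
    x = y + h
    0≤y : 0ℚ ≤ y
    0≤y = diff-≤ (H-mono (ℕ.m≤m+n r k))
    hn : h * ι (suc n) ≡ 1ℚ
    hn = rcp* n
    -- With h = 1/(n+1) the step inequality says n P(x) ≤ (n+1) P(y), which matches the growth of
    -- the right side from n to n+1. The common factor n avoids a division until the very end.
    key : ι n * (ι r * expPoly m x) ≤ ι n * ι (suc n)
    key = begin
      ι n * (ι r * expPoly m x)
        ≡⟨ solve 3 (λ n r e → n :* (r :* e) := r :* ((con 1ℚ :+ n) :* e) :+ :- (r :* e)) refl (ι n) (ι r) (expPoly m x) ⟩
      ι r * (ι (suc n) * expPoly m x) + - (ι r * expPoly m x)
        ≤⟨ +-monoˡ-≤ (- (ι r * expPoly m x)) (*-monoˡ (ι r) (0≤ι r) (*-monoˡ (ι (suc n)) (0≤ι (suc n)) (expPoly-step m y h 0≤y (0≤rcp n)))) ⟩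
      ι r * (ι (suc n) * (expPoly m y + h * expPoly m x)) + - (ι r * expPoly m x)
        ≡⟨ solve 5 (λ r s a h b → r :* (s :* (a :+ h :* b)) :+ :- (r :* b) := s :* (r :* a) :+ r :* ((h :* s) :* b) :+ :- (r :* b)) refl (ι r) (ι (suc n)) (expPoly m y) h (expPoly m x) ⟩
      ι (suc n) * (ι r * expPoly m y) + ι r * ((h * ι (suc n)) * expPoly m x) + - (ι r * expPoly m x)
        ≡⟨ cong (λ z → ι (suc n) * (ι r * expPoly m y) + ι r * (z * expPoly m x) + - (ι r * expPoly m x)) hn ⟩
      ι (suc n) * (ι r * expPoly m y) + ι r * (1ℚ * expPoly m x) + - (ι r * expPoly m x)
        ≡⟨ solve 4 (λ s r a b → s :* (r :* a) :+ r :* (con 1ℚ :* b) :+ :- (r :* b) := s :* (r :* a)) refl (ι (suc n)) (ι r) (expPoly m y) (expPoly m x) ⟩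
      ι (suc n) * (ι r * expPoly m y)
        ≤⟨ *-monoˡ (ι (suc n)) (0≤ι (suc n)) (expPoly-H m r k 1≤r) ⟩
      ι (suc n) * ι n
        ≡⟨ *-comm (ι (suc n)) (ι n) ⟩
      ι n * ι (suc n) ∎
    goal : ι r * expPoly m (H (suc n) - H r) ≤ ι (suc n)
    goal = subst (λ z → ι r * expPoly m z ≤ ι (suc n))
      (solve 3 (λ a h b → a :- b :+ h := a :+ h :- b) refl (H n) h (H r))
      (cancelˡ (rcp (r′ ℕ.+ k)) (ι n) (0≤rcp (r′ ℕ.+ k)) (rcp* (r′ ℕ.+ k)) key)

  -- Evaluating at 1 instead of the larger harmonic difference turns the polynomial into a partial
  -- sum of e. This is the form in which r/n ≤ 1/e is used, without any mention of the real number
  -- e.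
  expSum-H : ∀ m r n → 1 ℕ.≤ r → r ℕ.≤ n → 1ℚ ≤ H n - H r → ι r * expSum m ≤ ι n
  expSum-H m r n 1≤r r≤n 1≤ = ≤-trans
    (*-monoˡ (ι r) (0≤ι r) (subst (_≤ expPoly m (H n - H r)) (expPoly-1 m) (expPoly-mono m 0≤1 1≤)))
    (subst (λ j → ι r * expPoly m (H j - H r) ≤ ι j) (ℕ.m+[n∸m]≡n r≤n) (expPoly-H m r (n ℕ.∸ r) 1≤r))

  -- The instance r = 1, n = 4, since 1/2 + 1/3 + 1/4 = 13/12 is at least 1.
  expSum≤4 : ∀ m → expSum m ≤ ι 4
  expSum≤4 m = subst (_≤ ι 4) (*-identityˡ (expSum m))
    (expSum-H m 1 4 ℕ.≤-refl (ℕ.s≤s ℕ.z≤n) (toWitness {a? = 1ℚ ≤? H 4 - H 1} _))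

-- Optimal stopping in the classical secretary problem.

module Stopping where
  open import Data.Rational hiding (1/_)
  open import Data.Rational.Properties
  open import Data.Rational.Solver using (module +-*-Solver)
  open import Data.Empty using (⊥-elim)
  open import Defs using (expSum)
  open Rationals
  open Harmonic

  -- v k bounds the value of continuing after k of the d = 1 + d′ candidates, for
  -- the reward k / d of stopping at a record: the k-th candidate is a record
  -- with probability 1 / k.
  record StoppingValue (d′ : ℕ) (v : ℕ → ℚ) : Set where
    field
      0≤v    : ∀ k → k ℕ.≤ suc d′ → 0ℚ ≤ v k
      record-value : ∀ k → k ℕ.≤ d′ → ∃ λ μ →
        v (suc k) ≤ μ × ι (suc k) * rcp d′ ≤ μ × ι k * v (suc k) + μ ≤ ι (suc k) * v k

  -- The threshold rule that skips r = 1 + r′ candidates.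
  module Threshold (r′ d′ : ℕ) (sum≤1 : H d′ - H r′ ≤ 1ℚ) where
    open +-*-Solver

    S : ℕ → ℚ
    S k = H d′ - H (ℕ.pred k)

    A : ℚ
    A = ι (suc r′) * rcp d′

    -- The success probability (k/d)(1/k + ⋯ + 1/(d-1)) of rejecting `k` candidates and then taking
    -- the first record, with d = 1 + `d′`.
    late : ℕ → ℚ
    late k = ι k * rcp d′ * S k

    value : ∀ k → Dec (k ℕ.≤ r′) → ℚ
    value k (yes _) = A
    value k (no _)  = late k

    -- Up to the threshold the exact value is replaced by the simpler bound r/d; it dominates `late`
    -- at r because the sum starting at 1/r is at most 1.
    v : ℕ → ℚ
    v k = value k (k ℕ.≤? r′)

    0≤A : 0ℚ ≤ A
    0≤A = 0≤* (0≤ι (suc r′)) (0≤rcp d′)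

    0≤k/d : ∀ k → 0ℚ ≤ ι k * rcp d′
    0≤k/d k = 0≤* (0≤ι k) (0≤rcp d′)

    S≤1 : ∀ {k} → r′ ℕ.< k → S k ≤ 1ℚ
    S≤1 {suc k} (ℕ.s≤s r′≤k) = ≤-trans (+-monoʳ-≤ (H d′) (neg-antimono-≤ (H-mono r′≤k))) sum≤1

    late≤ : ∀ {k} → r′ ℕ.< k → late k ≤ ι k * rcp d′
    late≤ {k} r′<k = subst (late k ≤_) (*-identityʳ (ι k * rcp d′)) (*-monoˡ (ι k * rcp d′) (0≤k/d k) (S≤1 r′<k))

    early-v≤A : ∀ k → k ℕ.≤ suc r′ → v k ≤ A
    early-v≤A k k≤r with k ℕ.≤? r′
    ... | yes _   = ≤-refl
    ... | no k≰r′ with ℕ.≤-antisym k≤r (ℕ.≰⇒> k≰r′)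
    ... | refl = late≤ (ℕ.≰⇒> k≰r′)

    -- An equality in fact: passing from `S k` to `S (suc k)` drops the summand 1/k, and this loss
    -- is exactly compensated by the reward of the next record.
    late-step : ∀ k → r′ ℕ.< k → ι k * late (suc k) + ι (suc k) * rcp d′ ≤ ι (suc k) * late k
    late-step (suc k) _ = ≤-reflexive (begin
      ι K * (ι (suc K) * q * (H d′ - (H k + rcp k))) + ι (suc K) * q
        ≡⟨ solve 6 (λ a b q h g r → a :* (b :* q :* (h :- (g :+ r))) :+ b :* q
                := b :* (a :* q :* (h :- g)) :+ b :* q :* (con 1ℚ :- r :* a)) refl (ι K) (ι (suc K)) q (H d′) (H k) (rcp k) ⟩
      ι (suc K) * late K + ι (suc K) * q * (1ℚ - rcp k * ι K)
        ≡⟨ cong (λ z → ι (suc K) * late K + ι (suc K) * q * (1ℚ - z)) (rcp* k) ⟩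
      ι (suc K) * late K + ι (suc K) * q * 0ℚ
        ≡⟨ solve 2 (λ a b → a :+ b :* con 0ℚ := a) refl (ι (suc K) * late K) (ι (suc K) * q) ⟩
      ι (suc K) * late K ∎)
      where
      open ≡-Reasoning
      K = suc k
      q = rcp d′

    stoppingValue : StoppingValue d′ v
    stoppingValue = record { 0≤v = nonneg ; record-value = step }
      where
      nonneg : ∀ k → k ℕ.≤ suc d′ → 0ℚ ≤ v k
      nonneg k k≤d with k ℕ.≤? r′
      ... | yes _ = 0≤A
      ... | no _  = 0≤* (0≤k/d k) (diff-≤ (H-mono (ℕ.pred-mono-≤ k≤d)))
      v-late : ∀ k → r′ ℕ.< k → v k ≡ late k
      v-late k r′<k with k ℕ.≤? r′
      ... | yes k≤r′ = ⊥-elim (ℕ.<⇒≱ r′<k k≤r′)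
      ... | no _     = refl
      step : ∀ k → k ℕ.≤ d′ → ∃ λ μ → v (suc k) ≤ μ × ι (suc k) * rcp d′ ≤ μ × ι k * v (suc k) + μ ≤ ι (suc k) * v k
      step k k≤d′ with k ℕ.≤? r′
      -- Before the threshold the reward (k+1)/d of stopping is still at most r/d, so `μ` is the
      -- value of continuing. In the other case stopping is the better choice, because `S` is at
      -- most 1, and `μ` is its reward.
      ... | yes k≤r′ = A , early-v≤A (suc k) (ℕ.s≤s k≤r′) , *-monoʳ (rcp d′) (0≤rcp d′) (ι-mono (ℕ.s≤s k≤r′)) ,
        ≤-trans (+-monoˡ-≤ A (*-monoˡ (ι k) (0≤ι k) (early-v≤A (suc k) (ℕ.s≤s k≤r′))))
          (≤-reflexive (solve 2 (λ k a → k :* a :+ a := (con 1ℚ :+ k) :* a) refl (ι k) A))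
      ... | no k≰r′ = ι (suc k) * rcp d′ , subst (_≤ ι (suc k) * rcp d′) (sym eq) (late≤ r′<1+k) , ≤-refl ,
        subst (λ z → ι k * z + ι (suc k) * rcp d′ ≤ ι (suc k) * late k) (sym eq) (late-step k r′<k)
        where
        r′<k = ℕ.≰⇒> k≰r′
        r′<1+k = ℕ.m<n⇒m<1+n r′<k
        eq = v-late (suc k) r′<1+k

  secretary-value : ∀ n → ∃ λ d′ → n ℕ.≤ d′ × ∃ λ v → StoppingValue d′ v × v 0 ≤ 1ℚ ×
                    (∀ m → v 0 * expSum m ≤ 1ℚ + ι 4 * rcp d′)
  secretary-value n = d′ , ℕ.≤-trans (ℕ.n≤1+n n) r′≤d′ , v , stoppingValue , v0≤1 , bound
    where
    -- Positive, as `expSum-H` demands, and large enough to force d′ ≥ n.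
    r′ = suc n
    c : ∃ λ d′ → r′ ℕ.≤ d′ × H d′ ≤ 1ℚ + H r′ × 1ℚ + H r′ < H (suc d′)
    c = crossing r′ (1ℚ + H r′) (≤-diff 1ℚ 0≤1 (+-comm 1ℚ (H r′)))
    d′ = proj₁ c
    r′≤d′ = proj₁ (proj₂ c)
    open +-*-Solver
    sum≤1 : H d′ - H r′ ≤ 1ℚ
    sum≤1 = subst (H d′ - H r′ ≤_) (solve 2 (λ a b → a :+ b :- b := a) refl 1ℚ (H r′))
      (+-monoˡ-≤ (- H r′) (proj₁ (proj₂ (proj₂ c))))
    1≤sum : 1ℚ ≤ H (suc d′) - H r′
    1≤sum = subst (_≤ H (suc d′) - H r′) (solve 2 (λ a b → a :+ b :- b := a) refl 1ℚ (H r′))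
      (+-monoˡ-≤ (- H r′) (<⇒≤ (proj₂ (proj₂ (proj₂ c)))))
    open Threshold r′ d′ sum≤1
    v0≤1 : v 0 ≤ 1ℚ
    v0≤1 = subst (A ≤_) (trans (*-comm (ι (suc d′)) (rcp d′)) (rcp* d′)) (*-monoʳ (rcp d′) (0≤rcp d′) (ι-mono (ℕ.s≤s r′≤d′)))
    bound : ∀ m → v 0 * expSum m ≤ 1ℚ + ι 4 * rcp d′
    bound m = begin
      -- The exponential inequality applies to r′ = r - 1. The one candidate left over costs at most
      -- `expSum m`/d, hence the term 4/d.
      ι (suc r′) * q * x  ≡⟨ solve 3 (λ r q x → (con 1ℚ :+ r) :* q :* x := r :* x :* q :+ x :* q) refl (ι r′) q x ⟩
      ι r′ * x * q + x * q  ≤⟨ +-mono-≤ (*-monoʳ q (0≤rcp d′) (expSum-H m r′ (suc d′) (ℕ.s≤s ℕ.z≤n) (ℕ.m≤n⇒m≤1+n r′≤d′) 1≤sum)) (*-monoʳ q (0≤rcp d′) (expSum≤4 m)) ⟩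
      ι (suc d′) * q + ι 4 * q ≡⟨ cong (_+ ι 4 * q) (trans (*-comm (ι (suc d′)) q) (rcp* d′)) ⟩
      1ℚ + ι 4 * q  ∎
      where
      open ≤-Reasoning
      q = rcp d′
      x = expSum m

-- The scale mixture: telescoping sums, density and total mass.

module Densities where
  open import Data.List using (tabulate)
  open import Data.Rational hiding (1/_)
  open import Data.Rational.Properties
  open import Data.Rational.Solver using (module +-*-Solver)
  open Rationals
  open Harmonic

  vecs : ∀ {A : Set} → List A → ∀ n → List (Vec A n)
  vecs l zero    = [] ∷ []
  vecs l (suc n) = concatMap (λ a → map (a ∷_) (vecs l n)) l

  sumL-vecs : ∀ {A : Set} (l : List A) n f →
              sumL (vecs l (suc n)) f ≡ sumL l (λ a → sumL (vecs l n) (λ v → f (a ∷ v)))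
  sumL-vecs l n f = trans (sumL-concatMap (λ a → map (a ∷_) (vecs l n)) l f)
    (sumL-cong l (λ a → sumL-map (a ∷_) (vecs l n) f))

  ∑Fin : ∀ n → (Fin n → ℚ) → ℚ
  ∑Fin n = sumL (allFin n)

  sumL-tabulate : ∀ {A : Set} {n} (g : Fin n → A) f → sumL (tabulate g) f ≡ ∑Fin n (f ∘ g)
  sumL-tabulate {n = zero}  g f = refl
  sumL-tabulate {n = suc n} g f = cong (f (g zero) +_)
    (trans (sumL-tabulate (g ∘ suc) f) (sym (sumL-tabulate suc (f ∘ g))))

  ∑Fin-suc : ∀ n f → ∑Fin (suc n) f ≡ f zero + ∑Fin n (f ∘ suc)
  ∑Fin-suc n f = cong (f zero +_) (sumL-tabulate suc f)

  -- The shape of a sum over the next code, split at the current maximum: smaller codes leave the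
  -- maximum alone and share one bound, larger ones have bounds that telescope.
  ∑Fin-split-≤ : ∀ {a} c n (g : Fin n → ℚ) (Ψ : ℕ → ℚ) → c ℕ.≤ n →
    (∀ j → toℕ j ℕ.< c → g j ≤ a) → (∀ j → c ℕ.≤ toℕ j → g j ≤ Ψ (toℕ j) - Ψ (suc (toℕ j))) →
    ∑Fin n g ≤ ι c * a + (Ψ c - Ψ n)
  ∑Fin-split-≤ {a} zero zero g Ψ _ _ _ = ≤-reflexive
    (solve 2 (λ a p → con 0ℚ := con 0ℚ :* a :+ (p :- p)) refl a (Ψ 0))
    where open +-*-Solver
  ∑Fin-split-≤ {a} zero (suc n) g Ψ _ below above = subst₂ _≤_ (sym (∑Fin-suc n g))
    (solve 4 (λ p q r a → (p :- q) :+ (con 0ℚ :* a :+ (q :- r)) := con 0ℚ :* a :+ (p :- r)) refl (Ψ 0) (Ψ 1) (Ψ (suc n)) a)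
    (+-mono-≤ (above zero ℕ.z≤n) (∑Fin-split-≤ {a} zero n (g ∘ suc) (Ψ ∘ suc) ℕ.z≤n (λ _ ()) (λ j _ → above (suc j) ℕ.z≤n)))
    where open +-*-Solver
  ∑Fin-split-≤ {a} (suc c) (suc n) g Ψ (ℕ.s≤s c≤n) below above = subst₂ _≤_ (sym (∑Fin-suc n g))
    (solve 3 (λ a c p → a :+ (c :* a :+ p) := (con 1ℚ :+ c) :* a :+ p) refl a (ι c) (Ψ (suc c) - Ψ (suc n)))
    (+-mono-≤ (below zero (ℕ.s≤s ℕ.z≤n)) (∑Fin-split-≤ {a} c n (g ∘ suc) (Ψ ∘ suc) c≤n
      (λ j lt → below (suc j) (ℕ.s≤s lt)) (λ j le → above (suc j) (ℕ.s≤s le))))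
    where open +-*-Solver

  ∑Fin-telescope-≥ : ∀ n (g : Fin n → ℚ) (Ψ : ℕ → ℚ) → (∀ j → Ψ (toℕ j) - Ψ (suc (toℕ j)) ≤ g j) → Ψ 0 - Ψ n ≤ ∑Fin n g
  ∑Fin-telescope-≥ zero    g Ψ _     = ≤-reflexive (+-inverseʳ (Ψ 0))
  ∑Fin-telescope-≥ (suc n) g Ψ above = subst₂ _≤_
    (solve 3 (λ p q r → (p :- q) :+ (q :- r) := p :- r) refl (Ψ 0) (Ψ 1) (Ψ (suc n))) (sym (∑Fin-suc n g))
    (+-mono-≤ (above zero) (∑Fin-telescope-≥ n (g ∘ suc) (Ψ ∘ suc) (above ∘ suc)))
    where open +-*-Solver

  -- Q k c = 1 / ((c + 1) ⋯ (c + k))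
  Q : ℕ → ℕ → ℚ
  Q zero    c = 1ℚ
  Q (suc k) c = Q k c * rcp (c ℕ.+ k)

  0≤Q : ∀ k c → 0ℚ ≤ Q k c
  0≤Q zero    c = 0≤1
  0≤Q (suc k) c = 0≤* (0≤Q k c) (0≤rcp (c ℕ.+ k))

  Q-shift : ∀ k c → ι (suc (c ℕ.+ k)) * Q k (suc c) ≡ ι (suc c) * Q k c
  Q-shift zero    c = cong (λ j → ι (suc j) * 1ℚ) (ℕ.+-identityʳ c)
  Q-shift (suc k) c = begin
    ι (suc (c ℕ.+ suc k)) * (Q k (suc c) * rcp (suc c ℕ.+ k))  ≡⟨ cong (λ j → ι (suc j) * (Q k (suc c) * rcp (suc c ℕ.+ k))) (ℕ.+-suc c k) ⟩
    b * (x * s)  ≡⟨ solve 3 (λ b x s → b :* (x :* s) := x :* (s :* b)) refl b x s ⟩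
    x * (s * b)  ≡⟨ cong (x *_) (rcp* (suc c ℕ.+ k)) ⟩
    x * 1ℚ  ≡⟨ cong (x *_) (rcp* (c ℕ.+ k)) ⟨
    x * (r * a)  ≡⟨ solve 3 (λ x r a → x :* (r :* a) := a :* x :* r) refl x r a ⟩
    a * x * r  ≡⟨ cong (_* r) (Q-shift k c) ⟩
    ι (suc c) * Q k c * r  ≡⟨ *-assoc (ι (suc c)) (Q k c) r ⟩
    ι (suc c) * (Q k c * r)  ∎
    where
    open ≡-Reasoning
    open +-*-Solver
    a = ι (suc (c ℕ.+ k))
    b = ι (suc (suc (c ℕ.+ k)))
    r = rcp (c ℕ.+ k)
    s = rcp (suc c ℕ.+ k)
    x = Q k (suc c)

  -- The discrete counterpart of integrating k/t^(k+1) to 1/t^k.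
  Q-telescope : ∀ k c → ι k * Q (suc k) c ≡ Q k c - Q k (suc c)
  Q-telescope k c = begin
    n * (q * r)  ≡⟨ solve 4 (λ n q r m → n :* (q :* r) := q :* (r :* (m :+ n)) :- m :* q :* r) refl n q r m ⟩
    q * (r * (m + n)) - m * q * r  ≡⟨ cong (λ z → q * (r * z) - m * q * r) (ι-+ (suc c) k) ⟨
    q * (r * a) - m * q * r  ≡⟨ cong₂ (λ y z → q * y - z * r) (rcp* (c ℕ.+ k)) (sym (Q-shift k c)) ⟩
    q * 1ℚ - a * x * r  ≡⟨ solve 4 (λ q a x r → q :* con 1ℚ :- a :* x :* r := q :- x :* (r :* a)) refl q a x r ⟩
    q - x * (r * a)  ≡⟨ cong (λ z → q - x * z) (rcp* (c ℕ.+ k)) ⟩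
    q - x * 1ℚ  ≡⟨ cong (λ z → q - z) (*-identityʳ x) ⟩
    q - x  ∎
    where
    open ≡-Reasoning
    open +-*-Solver
    n = ι k
    m = ι (suc c)
    a = ι (suc (c ℕ.+ k))
    r = rcp (c ℕ.+ k)
    q = Q k c
    x = Q k (suc c)

  -- For forgetting one code: `suc c` is the number of codes that do not exceed the maximum `c`.
  Q-suc≤ : ∀ k c → ι (suc c) * Q (suc k) c ≤ Q k c
  Q-suc≤ k c = begin
    ι (suc c) * (Q k c * r)  ≤⟨ *-monoʳ (Q k c * r) (0≤Q (suc k) c) (ι-mono (ℕ.s≤s (ℕ.m≤m+n c k))) ⟩
    ι (suc (c ℕ.+ k)) * (Q k c * r)  ≡⟨ solve 3 (λ a q r → a :* (q :* r) := q :* (r :* a)) refl (ι (suc (c ℕ.+ k))) (Q k c) r ⟩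
    Q k c * (r * ι (suc (c ℕ.+ k)))  ≡⟨ cong (Q k c *_) (rcp* (c ℕ.+ k)) ⟩
    Q k c * 1ℚ  ≡⟨ *-identityʳ (Q k c) ⟩
    Q k c  ∎
    where
    open ≤-Reasoning
    open +-*-Solver
    r = rcp (c ℕ.+ k)

  -- The indicator of  c ≤ t .
  le : ℕ → ℕ → ℚ
  le zero    t       = 1ℚ
  le (suc c) zero    = 0ℚ
  le (suc c) (suc t) = le c t

  0≤le : ∀ c t → 0ℚ ≤ le c t
  0≤le zero    t       = 0≤1
  0≤le (suc c) zero    = ≤-refl
  0≤le (suc c) (suc t) = 0≤le c t

  le-yes : ∀ {c t} → c ℕ.≤ t → le c t ≡ 1ℚ
  le-yes ℕ.z≤n       = refl
  le-yes (ℕ.s≤s c≤t) = le-yes c≤t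

  le-no : ∀ {c t} → t ℕ.< c → le c t ≡ 0ℚ
  le-no {suc c} {zero}  _           = refl
  le-no {suc c} {suc t} (ℕ.s≤s t<c) = le-no t<c

  le-⊔ : ∀ a b t → le (a ℕ.⊔ b) t ≡ le a t * le b t
  le-⊔ zero    b       t       = sym (*-identityˡ (le b t))
  le-⊔ (suc a) zero    t       = sym (*-identityʳ (le (suc a) t))
  le-⊔ (suc a) (suc b) zero    = refl
  le-⊔ (suc a) (suc b) (suc t) = le-⊔ a b t

  ∑Fin-le : ∀ n t → t ℕ.< n → ι (suc t) ≤ ∑Fin n (λ c → le (toℕ c) t)
  ∑Fin-le (suc n) zero _ = subst (1ℚ + 0ℚ ≤_) (sym (∑Fin-suc n (λ c → le (toℕ c) 0)))
    (+-monoʳ-≤ 1ℚ (sumL-0≤ (allFin n) (λ c → 0≤le (suc (toℕ c)) 0)))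
  ∑Fin-le (suc n) (suc t) (ℕ.s≤s t<n) = subst (1ℚ + ι (suc t) ≤_) (sym (∑Fin-suc n (λ c → le (toℕ c) (suc t))))
    (+-monoʳ-≤ 1ℚ (∑Fin-le n t t<n))

  maxV : ∀ {N n} → Vec (Fin N) n → ℕ
  maxV []      = 0
  maxV (c ∷ x) = toℕ c ℕ.⊔ maxV x

  pow : ℚ → ℕ → ℚ
  pow a zero    = 1ℚ
  pow a (suc k) = a * pow a k

  pow-mono : ∀ {a b} k → 0ℚ ≤ a → a ≤ b → 0ℚ ≤ pow a k × pow a k ≤ pow b k
  pow-mono zero    0≤a a≤b = 0≤1 , ≤-refl
  pow-mono (suc k) 0≤a a≤b with pow-mono k 0≤a a≤b
  ... | 0≤p , p≤q = 0≤* 0≤a 0≤p , *-mono 0≤a (≤-trans 0≤p p≤q) a≤b p≤q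

  ∑-le-maxV : ∀ N n t → sumL (vecs (allFin N) n) (λ x → le (maxV x) t) ≡ pow (∑Fin N (λ c → le (toℕ c) t)) n
  ∑-le-maxV N zero    t = refl
  ∑-le-maxV N (suc n) t = begin
    sumL (vecs l (suc n)) (λ x → le (maxV x) t)  ≡⟨ sumL-vecs l n (λ x → le (maxV x) t) ⟩
    sumL l (λ c → sumL (vecs l n) (λ x → le (toℕ c ℕ.⊔ maxV x) t))  ≡⟨ sumL-cong l (λ c → sumL-cong (vecs l n) (λ x → le-⊔ (toℕ c) (maxV x) t)) ⟩
    sumL l (λ c → sumL (vecs l n) (λ x → le (toℕ c) t * le (maxV x) t))  ≡⟨ sumL-cong l (λ c → sumL-* (vecs l n) (le (toℕ c) t) (λ x → le (maxV x) t)) ⟩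
    sumL l (λ c → le (toℕ c) t * sumL (vecs l n) (λ x → le (maxV x) t))  ≡⟨ sumL-*ʳ l (sumL (vecs l n) (λ x → le (maxV x) t)) (λ c → le (toℕ c) t) ⟩
    sumL l (λ c → le (toℕ c) t) * sumL (vecs l n) (λ x → le (maxV x) t)  ≡⟨ cong (∑Fin N (λ c → le (toℕ c) t) *_) (∑-le-maxV N n t) ⟩
    pow (∑Fin N (λ c → le (toℕ c) t)) (suc n)  ∎
    where
    open ≡-Reasoning
    l = allFin N

  triangle : ℕ → ℚ
  triangle zero    = 0ℚ
  triangle (suc k) = triangle k + ι (suc k)

  pow-Q≤ : ∀ k t → pow (ι (suc t)) k * Q (suc k) t ≤ rcp t
  pow-Q≤ zero    t = ≤-reflexive (trans (cong (λ j → 1ℚ * (1ℚ * rcp j)) (ℕ.+-identityʳ t))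
    (trans (*-identityˡ (1ℚ * rcp t)) (*-identityˡ (rcp t))))
  pow-Q≤ (suc k) t = begin
    a * p * Q (suc (suc k)) t  ≡⟨ solve 3 (λ a p q → a :* p :* q := p :* (a :* q)) refl a p (Q (suc (suc k)) t) ⟩
    p * (a * Q (suc (suc k)) t)  ≤⟨ *-monoˡ p (proj₁ (pow-mono {b = a} k (0≤ι (suc t)) ≤-refl)) (Q-suc≤ (suc k) t) ⟩
    p * Q (suc k) t  ≤⟨ pow-Q≤ k t ⟩
    rcp t  ∎
    where
    open ≤-Reasoning
    open +-*-Solver
    a = ι (suc t)
    p = pow a k

  rcp-diff : ∀ t → rcp t * rcp (suc t) ≡ rcp t - rcp (suc t)
  rcp-diff t = begin
    r * s  ≡⟨ solve 3 (λ r s a → r :* s := r :* (s :* (con 1ℚ :+ a)) :- (r :* a) :* s) refl r s (ι (suc t)) ⟩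
    r * (s * ι (suc (suc t))) - (r * ι (suc t)) * s  ≡⟨ cong₂ (λ x y → r * x - y * s) (rcp* (suc t)) (rcp* t) ⟩
    r * 1ℚ - 1ℚ * s  ≡⟨ solve 2 (λ r s → r :* con 1ℚ :- con 1ℚ :* s := r :- s) refl r s ⟩
    r - s  ∎
    where
    open ≡-Reasoning
    open +-*-Solver
    r = rcp t
    s = rcp (suc t)

  -- The right side is 1/(t+1) times the factors (t+1)/(t+1+i) for i = 1, ..., k. The i-th factor
  -- loses at most i/(t+2), in total `triangle k`/(t+2). Writing the loss as a multiple of a
  -- difference of consecutive reciprocals makes its sum over all scales a constant.
  pow-Q≥ : ∀ k t → rcp t - triangle k * (rcp t - rcp (suc t)) ≤ pow (ι (suc t)) k * Q (suc k) t
  pow-Q≥ zero    t = ≤-reflexive (trans (solve 2 (λ r x → r :- con 0ℚ :* x := con 1ℚ :* (con 1ℚ :* r)) refl (rcp t) (rcp t - rcp (suc t)))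
    (cong (λ j → 1ℚ * (1ℚ * rcp j)) (sym (ℕ.+-identityʳ t))))
    where open +-*-Solver
  pow-Q≥ (suc k) t = begin
    r - (C + n) * x  ≡⟨ solve 4 (λ r c n x → r :- (c :+ n) :* x := (r :- c :* x) :+ :- (n :* x)) refl r C n x ⟩
    (r - C * x) + - (n * x)  ≤⟨ +-mono-≤ (pow-Q≥ k t) (neg-antimono-≤ loss) ⟩
    p * q + - (n * (p * q * s))  ≡⟨ solve 4 (λ p q n s → p :* q :+ :- (n :* (p :* q :* s)) := p :* q :* (con 1ℚ :- n :* s)) refl p q n s ⟩
    p * q * (1ℚ - n * s)  ≡⟨ cong (λ z → p * q * (z - n * s)) (sym one) ⟩
    p * q * (s * (a + n) - n * s)  ≡⟨ solve 5 (λ p q s a n → p :* q :* (s :* (a :+ n) :- n :* s) := a :* p :* (q :* s)) refl p q s a n ⟩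
    a * p * (q * s)  ∎
    where
    open ≤-Reasoning
    open +-*-Solver
    a = ι (suc t)
    n = ι (suc k)
    r = rcp t
    x = rcp t - rcp (suc t)
    s = rcp (t ℕ.+ suc k)
    C = triangle k
    p = pow a k
    q = Q (suc k) t
    one : s * (a + n) ≡ 1ℚ
    one = trans (cong (s *_) (sym (ι-+ (suc t) (suc k)))) (rcp* (t ℕ.+ suc k))
    loss : n * (p * q * s) ≤ n * x
    loss = *-monoˡ n (0≤ι (suc k)) (subst (p * q * s ≤_) (rcp-diff t)
      (*-mono (0≤* (proj₁ (pow-mono {b = a} k (0≤ι (suc t)) ≤-refl)) (0≤Q (suc k) t)) (0≤rcp (suc t)) (pow-Q≤ k t)
        (rcp-anti (subst (suc t ℕ.≤_) (sym (ℕ.+-suc t k)) (ℕ.s≤s (ℕ.m≤m+n t k))))))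

  -- The (unnormalised) law of a code vector: a scale t is chosen with weight
  -- about 1/t, and the d coordinates are independent and uniform on {0, …, t}.
  density : ℕ → ℕ → ℕ → ℚ
  density N d c = ∑Fin N (λ t → le c (toℕ t) * Q (suc d) (toℕ t))

  0≤density : ∀ N d c → 0ℚ ≤ density N d c
  0≤density N d c = sumL-0≤ (allFin N) (λ t → 0≤* (0≤le c (toℕ t)) (0≤Q (suc d) (toℕ t)))

  -- The sum over all scales from `c` on telescopes; the subtracted end term, due to the cut at `N`,
  -- is dropped.
  density≤ : ∀ N d′ c → c ℕ.≤ N → density N (suc d′) c ≤ Q (suc d′) c * rcp d′
  density≤ N d′ c c≤N = begin
    density N d c  ≤⟨ ∑Fin-split-≤ {0ℚ} c N (λ t → le c (toℕ t) * Q (suc d) (toℕ t)) (λ j → Q d j * s) c≤N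
                                  (λ j lt → ≤-reflexive (trans (cong (_* Q (suc d) (toℕ j)) (le-no lt)) (*-zeroˡ (Q (suc d) (toℕ j)))))
                                  (λ j c≤j → ≤-reflexive (trans (cong (_* Q (suc d) (toℕ j)) (le-yes c≤j)) (step (toℕ j)))) ⟩
    ι c * 0ℚ + (Q d c * s - Q d N * s)  ≡⟨ solve 3 (λ c x y → c :* con 0ℚ :+ (x :- y) := x :- y) refl (ι c) (Q d c * s) (Q d N * s) ⟩
    Q d c * s - Q d N * s  ≤⟨ ≤-diff (Q d N * s) (0≤* (0≤Q d N) (0≤rcp d′)) (solve 2 (λ x y → x := x :- y :+ y) refl (Q d c * s) (Q d N * s)) ⟩
    Q d c * s  ∎
    where
    open ≤-Reasoning
    open +-*-Solver
    d = suc d′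
    s = rcp d′
    step : ∀ j → 1ℚ * Q (suc d) j ≡ Q d j * s - Q d (suc j) * s
    step j = trans (cong (_* Q (suc d) j) (sym (rcp* d′)))
      (trans (solve 3 (λ s n q → s :* n :* q := (n :* q) :* s) refl s (ι d) (Q (suc d) j))
        (trans (cong (_* s) (Q-telescope d j))
          (solve 3 (λ x y s → (x :- y) :* s := x :* s :- y :* s) refl (Q d j) (Q d (suc j)) s)))

  totalMass : ℕ → ℕ → ℚ
  totalMass N d = sumL (vecs (allFin N) d) (λ x → density N d (maxV x))

  -- After exchanging the sums, scale `t` contributes at least (t+1)^d vectors, and `pow-Q≥`
  -- applies. Thus `H N`, the mass that the game is measured against, exceeds the true one by at
  -- most a constant depending on `d`.
  totalMass≥ : ∀ N d → H N - triangle d ≤ totalMass N d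
  totalMass≥ N d = begin
    H N - C  ≤⟨ ≤-diff (C * rcp N) (0≤* (0≤triangle d) (0≤rcp N))
                                                                 (solve 3 (λ h c r → (:- con 0ℚ :- c :* con 1ℚ) :- (:- h :- c :* r) := h :- c :+ c :* r) refl (H N) C (rcp N)) ⟩
    Ψ 0 - Ψ N  ≤⟨ ∑Fin-telescope-≥ N (λ t → m t * Q (suc d) (toℕ t)) Ψ bound ⟩
    ∑Fin N (λ t → m t * Q (suc d) (toℕ t))  ≡⟨ sumL-cong (allFin N) (λ t → trans (cong (_* Q (suc d) (toℕ t)) (sym (∑-le-maxV N d (toℕ t))))
                                                                    (sym (sumL-*ʳ l (Q (suc d) (toℕ t)) (λ x → le (maxV x) (toℕ t))))) ⟩
    ∑Fin N (λ t → sumL l (λ x → le (maxV x) (toℕ t) * Q (suc d) (toℕ t)))  ≡⟨ sumL-swap (allFin N) l (λ t x → le (maxV x) (toℕ t) * Q (suc d) (toℕ t)) ⟩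
    totalMass N d  ∎
    where
    open ≤-Reasoning
    open +-*-Solver
    l = vecs (allFin N) d
    C = triangle d
    0≤triangle : ∀ k → 0ℚ ≤ triangle k
    0≤triangle zero    = ≤-refl
    0≤triangle (suc k) = 0≤+ (0≤triangle k) (0≤ι (suc k))
    m : Fin N → ℚ
    m t = pow (∑Fin N (λ c → le (toℕ c) (toℕ t))) d
    Ψ : ℕ → ℚ
    Ψ j = - H j - C * rcp j
    bound : ∀ j → Ψ (toℕ j) - Ψ (suc (toℕ j)) ≤ m j * Q (suc d) (toℕ j)
    bound j = begin
      Ψ t - Ψ (suc t)  ≡⟨ solve 4 (λ h r s c → (:- h :- c :* r) :- (:- (h :+ r) :- c :* s) := r :- c :* (r :- s)) refl (H t) (rcp t) (rcp (suc t)) C ⟩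
      rcp t - C * (rcp t - rcp (suc t))  ≤⟨ pow-Q≥ d t ⟩
      pow (ι (suc t)) d * Q (suc d) t  ≤⟨ *-monoʳ (Q (suc d) t) (0≤Q (suc d) t) (proj₂ (pow-mono d (0≤ι (suc t)) (∑Fin-le N t (Fin.toℕ<n j)))) ⟩
      m j * Q (suc d) t  ∎
      where t = toℕ j

-- The game at a single left vertex, against an arbitrary algorithm.

module Online where
  open import Data.Fin.Properties using (toℕ<n)
  open import Data.Maybe using (_<∣>_)
  open import Data.Rational hiding (1/_)
  open import Data.Rational.Properties hiding (_≟_)
  open import Data.Rational.Solver using (module +-*-Solver)
  open Rationals
  open Harmonic
  open Stopping
  open Densities

  mix : ℚ → ℚ → ℚ → ℚ
  mix p a b = p * a + (1ℚ - p) * b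

  module _ {p : ℚ} (0≤p : 0ℚ ≤ p) (p≤1 : p ≤ 1ℚ) where

    mix-mono : ∀ {a a′ b b′} → a ≤ a′ → b ≤ b′ → mix p a b ≤ mix p a′ b′
    mix-mono a≤a′ b≤b′ = +-mono-≤ (*-monoˡ p 0≤p a≤a′) (*-monoˡ (1ℚ - p) (diff-≤ p≤1) b≤b′)

    mix-≤ : ∀ {a b c} → a ≤ c → b ≤ c → mix p a b ≤ c
    mix-≤ {c = c} a≤c b≤c = ≤-trans (mix-mono a≤c b≤c)
      (≤-reflexive (solve 2 (λ p c → p :* c :+ (con 1ℚ :- p) :* c := c) refl p c))
      where open +-*-Solver

  Observed : Set → ℕ → Set
  Observed E N = List (E × Fin N × Bool)

  -- `chosen` keeps the first accepted code at the vertex and ignores later ones, which are charged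
  -- to the right vertices. The value 0 of `best` before any arrival is a default.
  record State (N : ℕ) : Set where
    constructor ⟨_,_,_⟩
    field
      arrived : ℕ
      best    : ℕ
      chosen  : Maybe (Fin N)
  open State public

  arrive : ∀ {N} → State N → Fin N → Bool → State N
  arrive ⟨ k , m , o ⟩ c b = ⟨ suc k , toℕ c ℕ.⊔ m , o <∣> (if b then just c else nothing) ⟩

  module Run {E L : Set} (left : E → L) (_≟_ : DecidableEquality L) (N : ℕ) where

    when : ∀ {u v : L} {A : Set} → Dec (u ≡ v) → A → A → A
    when (yes _) a b = a
    when (no _)  a b = b

    when-yes : ∀ {A : Set} {u v} {a b : A} → u ≡ v → when (u ≟ v) a b ≡ a
    when-yes {u = u} {v} u≡v with u ≟ v
    ... | yes _  = refl
    ... | no u≢v = contradiction u≡v u≢v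

    when-no : ∀ {A : Set} {u v} {a b : A} → ¬ u ≡ v → when (u ≟ v) a b ≡ b
    when-no {u = u} {v} u≢v with u ≟ v
    ... | yes u≡v = contradiction u≡v u≢v
    ... | no _    = refl

    state : L → Observed E N → State N
    state u []                = ⟨ 0 , 0 , nothing ⟩
    state u ((f , c , b) ∷ h) = when (left f ≟ u) (arrive (state u h) c b) (state u h)

    degree : L → List E → ℕ
    degree u []       = 0
    degree u (f ∷ fs) = when (left f ≟ u) (suc (degree u fs)) (degree u fs)

    module Algorithmic (prob : Observed E N → E → Fin N → ℚ)
      (0≤prob : ∀ h f c → 0ℚ ≤ prob h f c) (prob≤1 : ∀ h f c → prob h f c ≤ 1ℚ) where

      branch : (Observed E N → ℚ) → Observed E N → E → Fin N → ℚ
      branch ψ h f c = mix (prob h f c) (ψ ((f , c , true) ∷ h)) (ψ ((f , c , false) ∷ h))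

      expect : (E → Fin N) → (Observed E N → ℚ) → Observed E N → List E → ℚ
      expect w φ h []       = φ h
      expect w φ h (f ∷ fs) = branch (λ h′ → expect w φ h′ fs) h f (w f)

      -- The codes at `u` are summed over as they arrive, without any weights: the density depends
      -- on the final maximum only and enters at the end, through `win`. Codes at other left
      -- vertices stay as prescribed by `w`.
      resample : L → (E → Fin N) → (Observed E N → ℚ) → Observed E N → List E → ℚ
      resample u w φ h []       = φ h
      resample u w φ h (f ∷ fs) = when (left f ≟ u)
        (∑Fin N (branch (λ h′ → resample u w φ h′ fs) h f))
        (branch (λ h′ → resample u w φ h′ fs) h f (w f))

      branch-≤ : ∀ ψ {a} h f c → (∀ b → ψ ((f , c , b) ∷ h) ≤ a) → branch ψ h f c ≤ a
      branch-≤ ψ h f c le = mix-≤ (0≤prob h f c) (prob≤1 h f c) (le true) (le false)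

      module Secretary (d′ : ℕ) (v : ℕ → ℚ) (SV : StoppingValue d′ v) (u : L) (w : E → Fin N) where
        open StoppingValue SV

        win : State N → ℚ
        win s = density N (suc d′) (best s) * maybe (λ c → le (best s) (toℕ c)) 0ℚ (chosen s)

        play : Observed E N → List E → ℚ
        play = resample u w (λ h → win (state u h))

        private
          state-yes : ∀ f c b h {s} → left f ≡ u → state u h ≡ s → state u ((f , c , b) ∷ h) ≡ arrive s c b
          state-yes f c b h p eq = trans (when-yes p) (cong (λ s → arrive s c b) eq)

          state-no : ∀ f c b h {s} → ¬ left f ≡ u → state u h ≡ s → state u ((f , c , b) ∷ h) ≡ s
          state-no f c b h ¬p eq = trans (when-no ¬p) eq

          degree-yes : ∀ {k f fs} → left f ≡ u → k ℕ.+ degree u (f ∷ fs) ≡ suc d′ → suc k ℕ.+ degree u fs ≡ suc d′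
          degree-yes {k} {f} {fs} p eq = trans (sym (ℕ.+-suc k (degree u fs))) (trans (cong (k ℕ.+_) (sym (when-yes p))) eq)

          degree-no : ∀ {k f fs} → ¬ left f ≡ u → k ℕ.+ degree u (f ∷ fs) ≡ suc d′ → k ℕ.+ degree u fs ≡ suc d′
          degree-no {k} ¬p eq = trans (cong (k ℕ.+_) (sym (when-no ¬p))) eq

          full : ∀ {k} → k ℕ.+ 0 ≡ suc d′ → k ≡ suc d′
          full {k} eq = trans (sym (ℕ.+-identityʳ k)) eq

        lost : ∀ h fs {k m c} → state u h ≡ ⟨ k , m , just c ⟩ → toℕ c ℕ.< m → play h fs ≤ 0ℚ
        lost h [] {m = m} eq c<m = subst (λ s → win s ≤ 0ℚ) (sym eq)
          (≤-reflexive (trans (cong (density N (suc d′) m *_) (le-no c<m)) (*-zeroʳ (density N (suc d′) m))))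
        lost h (f ∷ fs) {m = m} eq c<m = arrival (left f ≟ u)
          where
          arrival : (at? : Dec (left f ≡ u)) →
                    when at? (∑Fin N (branch (λ h′ → play h′ fs) h f)) (branch (λ h′ → play h′ fs) h f (w f)) ≤ 0ℚ
          arrival (yes p) = ≤-trans
            (sumL-mono (allFin N) {g = λ _ → 0ℚ} (λ j → branch-≤ (λ h′ → play h′ fs) h f j (λ b →
              lost ((f , j , b) ∷ h) fs (state-yes f j b h p eq) (ℕ.<-≤-trans c<m (ℕ.m≤n⊔m (toℕ j) m)))))
            (≤-reflexive (sumL-0 (allFin N)))
          arrival (no ¬p) = branch-≤ (λ h′ → play h′ fs) h f (w f) (λ b → lost ((f , w f , b) ∷ h) fs (state-no f (w f) b h ¬p eq) c<m)

        -- The bound is k/d times `Q k m`/k: the classical chance that the best of k stays the best,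
        -- times the mass of the situation. A further code at most `m`, ties included, preserves the
        -- lead; a larger one loses for good. `Q-suc≤` then leads back from `suc k` to `k`.
        leading : ∀ h fs {k m c} → state u h ≡ ⟨ k , m , just c ⟩ → m ≡ toℕ c → k ℕ.+ degree u fs ≡ suc d′ →
                  play h fs ≤ Q k m * rcp d′
        leading h [] {k} {m} {c} eq m≡c cnt = subst (λ s → win s ≤ Q k m * rcp d′) (sym eq) (begin
          density N (suc d′) m * le m (toℕ c)  ≡⟨ cong (density N (suc d′) m *_) (le-yes (ℕ.≤-reflexive m≡c)) ⟩
          density N (suc d′) m * 1ℚ  ≡⟨ *-identityʳ _ ⟩
          density N (suc d′) m  ≤⟨ density≤ N d′ m (subst (ℕ._≤ N) (sym m≡c) (ℕ.<⇒≤ (toℕ<n c))) ⟩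
          Q (suc d′) m * rcp d′  ≡⟨ cong (λ k → Q k m * rcp d′) (full cnt) ⟨
          Q k m * rcp d′  ∎)
          where open ≤-Reasoning
        leading h (f ∷ fs) {k} {m} {c} eq m≡c cnt = arrival (left f ≟ u)
          where
          open ≤-Reasoning
          open +-*-Solver
          q = Q (suc k) m * rcp d′
          module _ (p : left f ≡ u) where
            below : ∀ j → toℕ j ℕ.< suc m → branch (λ h′ → play h′ fs) h f j ≤ q
            below j (ℕ.s≤s j≤m) = branch-≤ (λ h′ → play h′ fs) h f j (λ b → leading ((f , j , b) ∷ h) fs
              (trans (state-yes f j b h p eq) (cong (λ x → ⟨ suc k , x , just c ⟩) (ℕ.m≤n⇒m⊔n≡n j≤m))) m≡c
              (degree-yes {k} {f} {fs} p cnt))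
            above : ∀ j → suc m ℕ.≤ toℕ j → branch (λ h′ → play h′ fs) h f j ≤ 0ℚ - 0ℚ
            above j m<j = branch-≤ (λ h′ → play h′ fs) h f j (λ b → lost ((f , j , b) ∷ h) fs (state-yes f j b h p eq)
              (subst (ℕ._< toℕ j ℕ.⊔ m) m≡c (ℕ.<-≤-trans m<j (ℕ.m≤m⊔n (toℕ j) m))))
          arrival : (at? : Dec (left f ≡ u)) →
                    when at? (∑Fin N (branch (λ h′ → play h′ fs) h f)) (branch (λ h′ → play h′ fs) h f (w f)) ≤ Q k m * rcp d′
          arrival (no ¬p) = branch-≤ (λ h′ → play h′ fs) h f (w f) (λ b →
            leading ((f , w f , b) ∷ h) fs (state-no f (w f) b h ¬p eq) m≡c (degree-no {k} {f} {fs} ¬p cnt))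
          arrival (yes p) = begin
            ∑Fin N (branch (λ h′ → play h′ fs) h f)
              ≤⟨ ∑Fin-split-≤ {q} (suc m) N (branch (λ h′ → play h′ fs) h f) (λ _ → 0ℚ) (subst (ℕ._< N) (sym m≡c) (toℕ<n c)) (below p) (above p) ⟩
            ι (suc m) * q + (0ℚ - 0ℚ)
              ≡⟨ solve 3 (λ n x r → n :* (x :* r) :+ (con 0ℚ :- con 0ℚ) := n :* x :* r) refl (ι (suc m)) (Q (suc k) m) (rcp d′) ⟩
            ι (suc m) * Q (suc k) m * rcp d′
              ≤⟨ *-monoʳ (rcp d′) (0≤rcp d′) (Q-suc≤ k m) ⟩
            Q k m * rcp d′ ∎

        -- Bounds the weight of the first k codes under the mixture when their maximum is m.
        mass : ℕ → ℕ → ℚ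
        mass zero    m = H N
        mass (suc k) m = Q (suc k) m * rcp k

        0≤mass : ∀ k m → 0ℚ ≤ mass k m
        0≤mass zero    m = 0≤H N
        0≤mass (suc k) m = 0≤* (0≤Q (suc k) m) (0≤rcp k)

        -- One step of the stopping recursion. The next code is at least `m` with mass at most
        -- 1/(k+1) of `mass k m`, and below `m` with at most k/(k+1) of it, so the sum is at most (k
        -- v(k+1) + μ)/(k+1) times the mass. For k = 0 the masses add up to `H N` instead, and no
        -- code lies below m = 0.
        searching-sum : ∀ k m μ → (k ≡ 0 → m ≡ 0) → 0ℚ ≤ v (suc k) → 0ℚ ≤ μ → m ℕ.≤ N →
          ι k * v (suc k) + μ ≤ ι (suc k) * v k → (g : Fin N → ℚ) →
          (∀ j → toℕ j ℕ.< m → g j ≤ v (suc k) * mass (suc k) m) →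
          (∀ j → m ℕ.≤ toℕ j → g j ≤ μ * mass (suc k) (toℕ j)) →
          ∑Fin N g ≤ v k * mass k m
        searching-sum zero m μ m≡0 0≤v₁ 0≤μ m≤N step g below above with m≡0 refl
        ... | refl = begin
          ∑Fin N g  ≤⟨ ∑Fin-split-≤ {v 1 * mass 1 0} 0 N g (λ j → - (μ * H j)) ℕ.z≤n below (λ j le → ≤-trans (above j le) (≤-reflexive (eq (toℕ j)))) ⟩
          0ℚ * (v 1 * mass 1 0) + (- (μ * 0ℚ) - - (μ * H N))  ≡⟨ solve 4 (λ x μ h y → con 0ℚ :* x :+ (:- (μ :* con 0ℚ) :- (:- (μ :* h))) := (con 0ℚ :* y :+ μ) :* h) refl (v 1 * mass 1 0) μ (H N) (v 1) ⟩
          (0ℚ * v 1 + μ) * H N  ≤⟨ *-monoʳ (H N) (0≤H N) step ⟩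
          (1ℚ + 0ℚ) * v 0 * H N  ≡⟨ solve 2 (λ x h → (con 1ℚ :+ con 0ℚ) :* x :* h := x :* h) refl (v 0) (H N) ⟩
          v 0 * H N  ∎
          where
          open ≤-Reasoning
          open +-*-Solver
          eq : ∀ j → μ * (1ℚ * rcp (j ℕ.+ 0) * 1ℚ) ≡ - (μ * H j) - - (μ * H (suc j))
          eq j = trans (cong (λ i → μ * (1ℚ * rcp i * 1ℚ)) (ℕ.+-identityʳ j))
            (solve 3 (λ μ r h → μ :* (con 1ℚ :* r :* con 1ℚ) := :- (μ :* h) :- (:- (μ :* (h :+ r)))) refl μ (rcp j) (H j))
        searching-sum k@(suc k₀) m μ _ 0≤v₁ 0≤μ m≤N step g below above = begin
          ∑Fin N g  ≤⟨ ∑Fin-split-≤ {x * (Q (suc k) m * r)} m N g Ψ m≤N below (λ j le → ≤-trans (above j le) (≤-reflexive (eq (toℕ j)))) ⟩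
          ι m * (x * (Q (suc k) m * r)) + (Ψ m - Ψ N)
            ≡⟨ solve 6 (λ n x q r a b → n :* (x :* (q :* r)) :+ (a :- b) := (n :* q) :* (x :* r) :+ (a :- b)) refl (ι m) x (Q (suc k) m) r (Ψ m) (Ψ N) ⟩
          (ι m * Q (suc k) m) * (x * r) + (Ψ m - Ψ N)
            ≤⟨ +-mono-≤ (*-monoʳ (x * r) (0≤* 0≤v₁ (0≤rcp k)) (≤-trans (*-monoʳ (Q (suc k) m) (0≤Q (suc k) m) (ι-mono (ℕ.n≤1+n m))) (Q-suc≤ k m)))
                 (≤-diff (Ψ N) (0≤* (0≤* (0≤* 0≤μ (0≤rcp k)) (0≤rcp k₀)) (0≤Q k N)) (solve 2 (λ a b → a := a :- b :+ b) refl (Ψ m) (Ψ N))) ⟩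
          q * (x * r) + μ * r * s * q
            ≡⟨ unit (cong (λ z → q * (x * r) * z + μ * r * s * q) (sym (rcp* k₀))) ⟩
          q * (x * r) * (s * ι k) + μ * r * s * q
            ≡⟨ solve 6 (λ q x r s n μ → q :* (x :* r) :* (s :* n) :+ μ :* r :* s :* q := (n :* x :+ μ) :* (r :* s :* q)) refl q x r s (ι k) μ ⟩
          (ι k * x + μ) * (r * s * q)
            ≤⟨ *-monoʳ (r * s * q) (0≤* (0≤* (0≤rcp k) (0≤rcp k₀)) (0≤Q k m)) step ⟩
          ι (suc k) * v k * (r * s * q)
            ≡⟨ solve 5 (λ n y r s q → n :* y :* (r :* s :* q) := (r :* n) :* (y :* (q :* s))) refl (ι (suc k)) (v k) r s q ⟩
          (r * ι (suc k)) * (v k * (q * s))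
            ≡⟨ trans (cong (_* (v k * (q * s))) (rcp* k)) (*-identityˡ _) ⟩
          v k * (q * s) ∎
          where
          open ≤-Reasoning
          open +-*-Solver
          x = v (suc k)
          q = Q k m
          r = rcp k
          s = rcp k₀
          unit : ∀ {b} → q * (x * r) * 1ℚ + μ * r * s * q ≡ b → q * (x * r) + μ * r * s * q ≡ b
          unit = trans (cong (_+ μ * r * s * q) (sym (*-identityʳ (q * (x * r)))))
          Ψ : ℕ → ℚ
          Ψ j = μ * r * s * Q k j
          eq : ∀ j → μ * (Q (suc k) j * r) ≡ Ψ j - Ψ (suc j)
          eq j = trans (cong (λ z → μ * (z * r)) (trans (sym (*-identityˡ (Q (suc k) j))) (cong (_* Q (suc k) j) (sym (rcp* k₀)))))
            (trans (solve 5 (λ μ s n y r → μ :* (s :* n :* y :* r) := μ :* r :* s :* (n :* y)) refl μ s (ι k) (Q (suc k) j) r)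
              (trans (cong (μ * r * s *_) (Q-telescope k j))
                (solve 3 (λ a b c → a :* (b :- c) := a :* b :- a :* c) refl (μ * r * s) (Q k j) (Q k (suc j)))))

        -- A code equal to the maximum counts as a record, which can only favour the algorithm. For
        -- a record, `μ` dominates both the lead gained by accepting and the value of continuing; a
        -- code below the maximum is lost if accepted. The condition for k = 0 says that the default
        -- maximum hides no code.
        searching : ∀ h fs {k m} → state u h ≡ ⟨ k , m , nothing ⟩ → m ℕ.≤ N → (k ≡ 0 → m ≡ 0) →
                    k ℕ.+ degree u fs ≡ suc d′ → play h fs ≤ v k * mass k m
        searching h [] {k} {m} eq m≤N k0 cnt = subst (λ s → win s ≤ v k * mass k m) (sym eq)
          (subst (_≤ v k * mass k m) (sym (*-zeroʳ (density N (suc d′) m))) (0≤* (0≤v k (ℕ.≤-reflexive (full cnt))) (0≤mass k m)))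
        searching h (f ∷ fs) {k} {m} eq m≤N k0 cnt = arrival (left f ≟ u)
          where
          open +-*-Solver
          module _ (p : left f ≡ u) where
            cnt′ : suc k ℕ.+ degree u fs ≡ suc d′
            cnt′ = degree-yes {k} {f} {fs} p cnt
            1+k≤d : suc k ℕ.≤ suc d′
            1+k≤d = subst (suc k ℕ.≤_) cnt′ (ℕ.m≤m+n (suc k) (degree u fs))
            0≤v₁ : 0ℚ ≤ v (suc k)
            0≤v₁ = 0≤v (suc k) 1+k≤d
            below : ∀ j → toℕ j ℕ.< m → branch (λ h′ → play h′ fs) h f j ≤ v (suc k) * mass (suc k) m
            below j j<m = branch-≤ (λ h′ → play h′ fs) h f j λ
              { true  → ≤-trans (lost ((f , j , true) ∷ h) fs (state-yes f j true h p eq) (ℕ.<-≤-trans j<m (ℕ.m≤n⊔m (toℕ j) m)))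
                          (0≤* 0≤v₁ (0≤mass (suc k) m))
              ; false → searching ((f , j , false) ∷ h) fs
                          (trans (state-yes f j false h p eq) (cong (λ x → ⟨ suc k , x , nothing ⟩) (ℕ.m≤n⇒m⊔n≡n (ℕ.<⇒≤ j<m)))) m≤N (λ ()) cnt′ }
            k/d : ∀ j → Q (suc k) j * rcp d′ ≡ ι (suc k) * rcp d′ * (Q (suc k) j * rcp k)
            k/d j = trans (trans (sym (*-identityʳ _)) (cong (Q (suc k) j * rcp d′ *_) (sym (rcp* k))))
              (solve 4 (λ q d r n → q :* d :* (r :* n) := n :* d :* (q :* r)) refl (Q (suc k) j) (rcp d′) (rcp k) (ι (suc k)))
            module _ {μ : ℚ} (v₁≤μ : v (suc k) ≤ μ) (k/d≤μ : ι (suc k) * rcp d′ ≤ μ) where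
              above : ∀ j → m ℕ.≤ toℕ j → branch (λ h′ → play h′ fs) h f j ≤ μ * mass (suc k) (toℕ j)
              above j m≤j = branch-≤ (λ h′ → play h′ fs) h f j λ
                { true  → ≤-trans (leading ((f , j , true) ∷ h) fs
                            (trans (state-yes f j true h p eq) (cong (λ x → ⟨ suc k , x , just j ⟩) (ℕ.m≥n⇒m⊔n≡m m≤j))) refl cnt′)
                            (≤-trans (≤-reflexive (k/d (toℕ j))) (*-monoʳ (mass (suc k) (toℕ j)) (0≤mass (suc k) (toℕ j)) k/d≤μ))
                ; false → ≤-trans (searching ((f , j , false) ∷ h) fs
                            (trans (state-yes f j false h p eq) (cong (λ x → ⟨ suc k , x , nothing ⟩) (ℕ.m≥n⇒m⊔n≡m m≤j)))
                            (ℕ.<⇒≤ (toℕ<n j)) (λ ()) cnt′)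
                            (*-monoʳ (mass (suc k) (toℕ j)) (0≤mass (suc k) (toℕ j)) v₁≤μ) }
          arrival : (at? : Dec (left f ≡ u)) →
                    when at? (∑Fin N (branch (λ h′ → play h′ fs) h f)) (branch (λ h′ → play h′ fs) h f (w f)) ≤ v k * mass k m
          arrival (no ¬p) = branch-≤ (λ h′ → play h′ fs) h f (w f) (λ b →
            searching ((f , w f , b) ∷ h) fs (state-no f (w f) b h ¬p eq) m≤N k0 (degree-no {k} {f} {fs} ¬p cnt))
          arrival (yes p) = pass (record-value k (ℕ.s≤s⁻¹ (1+k≤d p)))
            where
            pass : (∃ λ μ → v (suc k) ≤ μ × ι (suc k) * rcp d′ ≤ μ × ι k * v (suc k) + μ ≤ ι (suc k) * v k) →
                   ∑Fin N (branch (λ h′ → play h′ fs) h f) ≤ v k * mass k m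
            pass (μ , v₁≤μ , k/d≤μ , step) = searching-sum k m μ k0 (0≤v₁ p) (≤-trans (0≤v₁ p) v₁≤μ) m≤N step
              (branch (λ h′ → play h′ fs) h f) (below p) (above p v₁≤μ k/d≤μ)

        secretary-bound : ∀ fs → degree u fs ≡ suc d′ → play [] fs ≤ v 0 * H N
        secretary-bound fs = searching [] fs refl ℕ.z≤n (λ _ → refl)

-- Bipartite graphs of large girth from iterated parity covers.

module Covers where
  open import Data.Fin using (remQuot; finToFun; funToFin; _↑ˡ_; _↑ʳ_; splitAt)
  open import Data.Fin.Subset using () renaming (⊤ to full)
  open import Data.Integer using (∣_∣)
  open import Data.List.Membership.Propositional using (_∈_; _∉_)
  open import Data.List.Membership.Propositional.Properties using (∈-∃++)
  import Data.List.Membership.DecPropositional as DecMembership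
  open import Data.List.Relation.Unary.Any using (here; there)
  open import Data.List.Relation.Unary.Linked using (Linked; []; [-]; _∷_)
  open import Data.Nat using (_+_; _*_; _^_; _≤_; _<_; z≤n; s≤s)
  open import Data.Nat.DivMod using (_mod_; _%_; m<n⇒m%n≡m; n%n≡0)
  open import Data.Product.Properties using (≡-dec)
  open import Data.Sum.Properties using (inj₁-injective; inj₂-injective)
  open import Data.Vec using (lookup)
  open import Function.Definitions using (Injective)
  open import Defs using (Graph; IsCycle; GirthAtLeast)

  linked-tail : ∀ {A : Set} {R : A → A → Set} {x xs} → Linked R (x ∷ xs) → Linked R xs
  linked-tail [-]      = []
  linked-tail (_ ∷ l) = l

  linked-prefix : ∀ {A : Set} {R : A → A → Set} xs {ys} → Linked R (xs ++ ys) → Linked R xs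
  linked-prefix []           l       = []
  linked-prefix (x ∷ [])     l       = [-]
  linked-prefix (x ∷ y ∷ xs) (r ∷ l) = r ∷ linked-prefix (y ∷ xs) l

  module Walks {V E : Set} (src tgt : E → V) (loopless : ∀ e → src e ≢ tgt e) where

    Joins : E → V → V → Set
    Joins e x y = (src e ≡ x × tgt e ≡ y) ⊎ (tgt e ≡ x × src e ≡ y)

    data Walk : V → List E → V → Set where
      []  : ∀ {x} → Walk x [] x
      _∷_ : ∀ {x e y es z} → Joins e x y → Walk y es z → Walk x (e ∷ es) z

    -- Consecutive edges must differ along the list, but the last edge may equal the first. Closed
    -- segments of such walks therefore qualify again. The first edge is not counted in `length es`.
    GirthBeyond : ℕ → Set
    GirthBeyond k = ∀ {x e es} → Walk x (e ∷ es) x → Linked _≢_ (e ∷ es) → k ≤ length es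

    walk-split : ∀ {x z} as {bs} → Walk x (as ++ bs) z → ∃ λ y → Walk x as y × Walk y bs z
    walk-split []       w       = _ , [] , w
    walk-split (a ∷ as) (j ∷ w) with walk-split as w
    ... | y , w₁ , w₂ = y , j ∷ w₁ , w₂

    joins-twice : ∀ {e x y z z′} → Joins e x y → Joins e z z′ → z ≡ y ⊎ z ≡ x
    joins-twice (inj₁ (refl , refl)) (inj₁ (refl , refl)) = inj₂ refl
    joins-twice (inj₁ (refl , refl)) (inj₂ (refl , refl)) = inj₁ refl
    joins-twice (inj₂ (refl , refl)) (inj₁ (refl , refl)) = inj₁ refl
    joins-twice (inj₂ (refl , refl)) (inj₂ (refl , refl)) = inj₂ refl

    joins-back : ∀ {e x y z} → Joins e x y → Joins e y z → x ≡ z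
    joins-back {e} (inj₁ (refl , refl)) (inj₁ (p , _)) = contradiction p (loopless e)
    joins-back (inj₁ (refl , refl)) (inj₂ (_ , q)) = q
    joins-back (inj₂ (refl , refl)) (inj₁ (_ , q)) = q
    joins-back {e} (inj₂ (refl , refl)) (inj₂ (p , _)) = contradiction (sym p) (loopless e)

    -- If `e` is crossed again in the same direction, the walk up to that point is a shorter closed
    -- walk. In the opposite direction, the edges strictly between the two crossings form one, and
    -- there are some because `e` cannot follow itself. Either way the whole walk is longer than a
    -- closed walk to which `girth` applies.
    repeat⇒longer : ∀ {k x e es} → GirthBeyond k → Walk x (e ∷ es) x → Linked _≢_ (e ∷ es) → e ∈ es → suc k ≤ length es
    repeat⇒longer {k} {x} {e} girth (j ∷ w) nb e∈es with ∈-∃++ e∈es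
    ... | as , bs , refl with walk-split as w
    ... | z , w₁ , j′ ∷ w₂ with joins-twice j j′
    ... | inj₂ refl = ℕ.≤-trans (s≤s (girth (j ∷ w₁) (linked-prefix (e ∷ as) nb)))
      (ℕ.≤-trans (ℕ.m≤m+n (suc (length as)) (length bs)) (ℕ.≤-reflexive (sym (trans (List.length-++ as) (ℕ.+-suc (length as) (length bs))))))
    ... | inj₁ refl = aux as w₁ nb
      where
      aux : ∀ as → Walk z as z → Linked _≢_ (e ∷ as ++ e ∷ bs) → suc k ≤ length (as ++ e ∷ bs)
      aux []       _  (e≢e ∷ _) = contradiction refl e≢e
      aux (a ∷ as) w₁ nb = s≤s (ℕ.≤-trans (girth w₁ (linked-prefix (a ∷ as) (linked-tail nb)))
        (ℕ.≤-trans (ℕ.m≤m+n (length as) (suc (length bs))) (ℕ.≤-reflexive (sym (List.length-++ as)))))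

  -- A cover in which crossing an edge flips the bit that belongs to it: a closed
  -- walk upstairs crosses every edge downstairs an even number of times.
  module ParityCover
    {V E V′ E′ B T : Set} (src tgt : E → V) (src′ tgt′ : E′ → V′)
    (loopless : ∀ e → src e ≢ tgt e) (loopless′ : ∀ e → src′ e ≢ tgt′ e) (_≟_ : DecidableEquality E)
    (bit : B → E → T) (flip : E → B → B)
    (flips : ∀ e b → bit (flip e b) e ≢ bit b e)
    (keeps : ∀ e e′ b → e ≢ e′ → bit (flip e b) e′ ≡ bit b e′)
    (flip-injective : ∀ e {b b′} → flip e b ≡ flip e b′ → b ≡ b′)
    (p : E′ → E) (q : V′ → V) (bits : V′ → B)
    (q-src : ∀ e → q (src′ e) ≡ src (p e)) (q-tgt : ∀ e → q (tgt′ e) ≡ tgt (p e))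
    (bits-tgt : ∀ e → bits (tgt′ e) ≡ flip (p e) (bits (src′ e)))
    (p-injective : ∀ {e e′} → p e ≡ p e′ → bits (src′ e) ≡ bits (src′ e′) → e ≡ e′)
    where

    module Down = Walks src tgt loopless
    module Up = Walks src′ tgt′ loopless′
    open Walks using ([]; _∷_)
    open DecMembership _≟_ using (_∈?_)

    joins-down : ∀ {e x y} → Up.Joins e x y → Down.Joins (p e) (q x) (q y)
    joins-down {e} (inj₁ (refl , refl)) = inj₁ (sym (q-src e) , sym (q-tgt e))
    joins-down {e} (inj₂ (refl , refl)) = inj₂ (sym (q-tgt e) , sym (q-src e))

    walk-down : ∀ {x es y} → Up.Walk x es y → Down.Walk (q x) (map p es) (q y)
    walk-down []      = []
    walk-down (j ∷ w) = joins-down j ∷ walk-down w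

    -- Unique lifting at the common vertex `y`: if both edges start or both end there, the bits at
    -- their sources agree, since flipping is injective. If one ends and the other starts there,
    -- their common image would be a loop.
    same-edge : ∀ {e e′ x y z} → Up.Joins e x y → Up.Joins e′ y z → p e ≡ p e′ → e ≡ e′
    same-edge {e} {e′} (inj₂ (_ , s)) (inj₁ (s′ , _)) eq = p-injective eq (cong bits (trans s (sym s′)))
    same-edge {e} {e′} (inj₁ (_ , t)) (inj₂ (t′ , _)) eq = p-injective eq (flip-injective (p e)
      (trans (sym (bits-tgt e)) (trans (cong bits (trans t (sym t′))) (trans (bits-tgt e′) (cong (λ d → flip d (bits (src′ e′))) (sym eq))))))
    same-edge {e} {e′} (inj₁ (_ , t)) (inj₁ (s′ , _)) eq = contradiction
      (trans (cong src eq) (trans (sym (q-src e′)) (trans (cong q (trans s′ (sym t))) (q-tgt e)))) (loopless (p e))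
    same-edge {e} {e′} (inj₂ (_ , s)) (inj₂ (t′ , _)) eq = contradiction
      (trans (sym (q-src e)) (trans (cong q (trans s (sym t′))) (trans (q-tgt e′) (cong tgt (sym eq))))) (loopless (p e))

    nonbacktracking-down : ∀ {x es y} → Up.Walk x es y → Linked _≢_ es → Linked _≢_ (map p es)
    nonbacktracking-down []           []       = []
    nonbacktracking-down (j ∷ [])     [-]      = [-]
    nonbacktracking-down (j ∷ j′ ∷ w) (ne ∷ l) = (λ eq → ne (same-edge j j′ eq)) ∷ nonbacktracking-down (j′ ∷ w) l

    crossed : ∀ {e x y} → Up.Joins e x y → bit (bits y) (p e) ≢ bit (bits x) (p e)
    crossed {e} (inj₁ (refl , refl)) eq = flips (p e) (bits (src′ e)) (trans (cong (λ b → bit b (p e)) (sym (bits-tgt e))) eq)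
    crossed {e} (inj₂ (refl , refl)) eq = flips (p e) (bits (src′ e)) (trans (cong (λ b → bit b (p e)) (sym (bits-tgt e))) (sym eq))

    uncrossed₁ : ∀ {e x y d} → Up.Joins e x y → p e ≢ d → bit (bits x) d ≡ bit (bits y) d
    uncrossed₁ {e} {d = d} (inj₁ (refl , refl)) ne = sym (trans (cong (λ b → bit b d) (bits-tgt e)) (keeps (p e) d (bits (src′ e)) ne))
    uncrossed₁ {e} {d = d} (inj₂ (refl , refl)) ne = trans (cong (λ b → bit b d) (bits-tgt e)) (keeps (p e) d (bits (src′ e)) ne)

    uncrossed : ∀ {x es y d} → Up.Walk x es y → d ∉ map p es → bit (bits x) d ≡ bit (bits y) d
    uncrossed []      _  = refl
    uncrossed (j ∷ w) d∉ = trans (uncrossed₁ j (λ eq → d∉ (here (sym eq)))) (uncrossed w (λ d∈ → d∉ (there d∈)))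

    -- The first step flips the bit of its image edge, and the remaining walk has to restore it, so
    -- that this edge recurs downstairs.
    girth-increases : ∀ {k} → Down.GirthBeyond k → Up.GirthBeyond (suc k)
    girth-increases girth {x} {e} {es} w@(j ∷ w′) nb with p e ∈? map p es
    ... | no p∉  = contradiction (sym (uncrossed w′ p∉)) (λ eq → crossed j (sym eq))
    ... | yes p∈ = subst (suc _ ≤_) (List.length-map p es)
      (Down.repeat⇒longer girth (walk-down w) (nonbacktracking-down w nb) p∈)

  -- A bipartite graph whose left vertices have degree d; r lists their neighbours.
  record System (d : ℕ) : Set where
    field
      nL nR : ℕ
      r     : Fin nL → Fin d → Fin nR
      r-injective : ∀ u → Injective _≡_ _≡_ (r u)

    V E : Set
    V = Fin nL ⊎ Fin nR
    E = Fin nL × Fin d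

    src tgt : E → V
    src (u , i) = inj₁ u
    tgt (u , i) = inj₂ (r u i)

    loopless : ∀ e → src e ≢ tgt e
    loopless e ()

    open Walks src tgt loopless public using (GirthBeyond)

  funToFin-cong : ∀ {m n} {f g : Fin m → Fin n} → (∀ i → f i ≡ g i) → funToFin f ≡ funToFin g
  funToFin-cong {zero}  eq = refl
  funToFin-cong {suc m} eq = cong₂ combine (eq zero) (funToFin-cong (λ i → eq (suc i)))

  module Bits (m : ℕ) where

    opposite : Fin 2 → Fin 2
    opposite zero    = suc zero
    opposite (suc _) = zero

    opposite≢ : ∀ x → opposite x ≢ x
    opposite≢ zero    ()
    opposite≢ (suc _) ()

    opposite-injective : ∀ x y → opposite x ≡ opposite y → x ≡ y
    opposite-injective zero       zero       _ = refl
    opposite-injective (suc zero) (suc zero) _ = refl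

    flipped : Fin m → (Fin m → Fin 2) → Fin m → Fin 2
    flipped j f i with j Fin.≟ i
    ... | yes _ = opposite (f i)
    ... | no _  = f i

    flip : Fin m → Fin (2 ^ m) → Fin (2 ^ m)
    flip j b = funToFin (flipped j (finToFun b))

    bit : Fin (2 ^ m) → Fin m → Fin 2
    bit = finToFun

    bit-flip : ∀ j b i → bit (flip j b) i ≡ flipped j (bit b) i
    bit-flip j b i = Fin.finToFun-funToFin (flipped j (finToFun b)) i

    flips : ∀ j b → bit (flip j b) j ≢ bit b j
    flips j b eq with j Fin.≟ j | bit-flip j b j
    ... | yes _  | e = opposite≢ (bit b j) (trans (sym e) eq)
    ... | no j≢j | _ = j≢j refl

    keeps : ∀ j i b → j ≢ i → bit (flip j b) i ≡ bit b i
    keeps j i b j≢i with j Fin.≟ i | bit-flip j b i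
    ... | yes eq | _ = contradiction eq j≢i
    ... | no _   | e = e

    bits-extensional : ∀ b b′ → (∀ i → bit b i ≡ bit b′ i) → b ≡ b′
    bits-extensional b b′ eq = trans (sym (Fin.funToFin-finToFin {m} {2} b))
      (trans (funToFin-cong eq) (Fin.funToFin-finToFin {m} {2} b′))

    flip-injective : ∀ j {b b′} → flip j b ≡ flip j b′ → b ≡ b′
    flip-injective j {b} {b′} eq = bits-extensional b b′ same
      where
      same : ∀ i → bit b i ≡ bit b′ i
      same i with j Fin.≟ i | bit-flip j b i | bit-flip j b′ i
      ... | yes _ | x | y = opposite-injective _ _ (trans (sym x) (trans (cong (λ c → bit c i) eq) y))
      ... | no _  | x | y = trans (sym x) (trans (cong (λ c → bit c i) eq) y)

  module Cover {d : ℕ} (S : System d) where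
    open System S
    open Bits (nL * d) using (bits-extensional) renaming (flip to flipF; bit to bitF; flips to flipsF; keeps to keepsF; flip-injective to flipF-injective)

    X : ℕ
    X = 2 ^ (nL * d)

    flip : E → Fin X → Fin X
    flip (u , i) = flipF (combine u i)

    -- The copy of `u` with bit vector `b` is joined to the copy of its i-th neighbour in which the
    -- bit of this edge is flipped. Left degrees and the ratio of the two sides stay the same.
    r′ : Fin (nL * X) → Fin d → Fin (nR * X)
    r′ u i = combine (r (proj₁ (remQuot {nL} X u)) i) (flip (proj₁ (remQuot {nL} X u) , i) (proj₂ (remQuot {nL} X u)))

    lift : System d
    lift = record
      { nL = nL * X
      ; nR = nR * X
      ; r  = r′
      ; r-injective = λ u eq → r-injective (proj₁ (remQuot {nL} X u)) (Fin.combine-injectiveˡ _ _ _ _ eq)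
      }

    module S′ = System lift

    q : S′.V → V
    q (inj₁ u) = inj₁ (proj₁ (remQuot {nL} X u))
    q (inj₂ ρ) = inj₂ (proj₁ (remQuot {nR} X ρ))

    bits : S′.V → Fin X
    bits (inj₁ u) = proj₂ (remQuot {nL} X u)
    bits (inj₂ ρ) = proj₂ (remQuot {nR} X ρ)

    p : S′.E → E
    p (u , i) = proj₁ (remQuot {nL} X u) , i

    lift-girth : ∀ {k} → GirthBeyond k → S′.GirthBeyond (suc k)
    lift-girth = PC.girth-increases
      where
      combine-injective : ∀ (e e′ : E) → combine (proj₁ e) (proj₂ e) ≡ combine (proj₁ e′) (proj₂ e′) → e ≡ e′
      combine-injective (u , i) (u′ , i′) eq with Fin.combine-injective u i u′ i′ eq
      ... | refl , refl = refl
      keeps : ∀ e e′ b → e ≢ e′ → bitF (flip e b) (combine (proj₁ e′) (proj₂ e′)) ≡ bitF b (combine (proj₁ e′) (proj₂ e′))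
      keeps (u , i) (u′ , i′) b ne = keepsF (combine u i) (combine u′ i′) b (λ eq → ne (combine-injective (u , i) (u′ , i′) eq))
      p-injective : ∀ {e e′} → p e ≡ p e′ → bits (S′.src e) ≡ bits (S′.src e′) → e ≡ e′
      p-injective {u , i} {u′ , i′} eq eq′ = cong₂ _,_
        (trans (sym (Fin.combine-remQuot {nL} X u)) (trans (cong₂ combine (cong proj₁ eq) eq′) (Fin.combine-remQuot {nL} X u′)))
        (cong proj₂ eq)
      bit′ : Fin X → E → Fin 2
      bit′ b e = bitF b (combine (proj₁ e) (proj₂ e))
      q-tgt : ∀ e → q (S′.tgt e) ≡ tgt (p e)
      q-tgt (u , i) = cong (λ z → inj₂ (proj₁ z)) (Fin.remQuot-combine {nR} {X} _ _)
      bits-tgt : ∀ e → bits (S′.tgt e) ≡ flip (p e) (bits (S′.src e))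
      bits-tgt (u , i) = cong proj₂ (Fin.remQuot-combine {nR} {X} _ _)
      flips : ∀ e b → bit′ (flip e b) e ≢ bit′ b e
      flips e = flipsF (combine (proj₁ e) (proj₂ e))
      flip-injective : ∀ e {b b′} → flip e b ≡ flip e b′ → b ≡ b′
      flip-injective e = flipF-injective (combine (proj₁ e) (proj₂ e))
      q-src : ∀ e → q (S′.src e) ≡ src (p e)
      q-src e = refl
      module PC = ParityCover src tgt S′.src S′.tgt loopless S′.loopless (≡-dec Fin._≟_ Fin._≟_) bit′ flip flips keeps flip-injective p q bits q-src q-tgt bits-tgt p-injective

  -- M left vertices, all joined to the same d right vertices, covered k times.
  high-girth-system : ∀ M d k → ∃ λ (S : System d) → let open System S in
                      (1 ≤ M → 1 ≤ nL) × nL * d ≡ nR * M × GirthBeyond k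
  high-girth-system M d zero = record { nL = M ; nR = d ; r = λ _ i → i ; r-injective = λ _ eq → eq } ,
    (λ le → le) , ℕ.*-comm M d , (λ _ _ → z≤n)
  high-girth-system M d (suc k) with high-girth-system M d k
  ... | S , pos , ratio , girth = Cover.lift S , (λ 1≤M → ℕ.*-mono-≤ (pos 1≤M) (ℕ.m^n>0 2 (nL * d))) , ratio′ , Cover.lift-girth S girth
    where
    open System S
    open Cover S using (X)
    ratio′ : nL * X * d ≡ nR * X * M
    ratio′ = trans (swap nL X d) (trans (cong (_* X) ratio) (swap nR M X))
      where
      swap : ∀ a b c → a * b * c ≡ a * c * b
      swap a b c = trans (ℕ.*-assoc a b c) (trans (cong (a *_) (ℕ.*-comm b c)) (sym (ℕ.*-assoc a c b)))

  module SystemGraph {d : ℕ} (S : System d) where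
    open System S hiding (V; E)

    edge : Fin (nL * d) → Fin nL × Fin d
    edge = remQuot {nL} d

    ends : Fin (nL * d) → Fin (nL + nR) × Fin (nL + nR)
    ends f = (proj₁ (edge f) ↑ˡ nR) , (nL ↑ʳ r (proj₁ (edge f)) (proj₂ (edge f)))

    vertex : Fin (nL + nR) → Fin nL ⊎ Fin nR
    vertex = splitAt nL

    open Walks src tgt loopless using (Joins; Walk; []; _∷_; joins-back)

    joins : ∀ {f x y} → ends f ≡ (x , y) ⊎ ends f ≡ (y , x) → Joins (edge f) (vertex x) (vertex y)
    joins (inj₁ refl) = inj₁ (sym (Fin.splitAt-↑ˡ nL _ nR) , sym (Fin.splitAt-↑ʳ nL nR _))
    joins (inj₂ refl) = inj₂ (sym (Fin.splitAt-↑ʳ nL nR _) , sym (Fin.splitAt-↑ˡ nL _ nR))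

    edge-injective : ∀ {f f′} → edge f ≡ edge f′ → f ≡ f′
    edge-injective {f} {f′} eq = trans (sym (Fin.combine-remQuot {nL} d f))
      (trans (cong (λ z → combine (proj₁ z) (proj₂ z)) eq) (Fin.combine-remQuot {nL} d f′))

    same-ends : ∀ {e e′ x y} → Joins e x y → Joins e′ x y → e ≡ e′
    same-ends {u , i} {u′ , i′} (inj₁ (refl , refl)) (inj₁ (p , q)) with inj₁-injective p
    ... | refl = cong (u ,_) (r-injective u (sym (inj₂-injective q)))
    same-ends {u , i} {u′ , i′} (inj₂ (refl , refl)) (inj₂ (p , q)) with inj₁-injective q
    ... | refl = cong (u ,_) (r-injective u (sym (inj₂-injective p)))
    same-ends (inj₁ (refl , refl)) (inj₂ (() , _))
    same-ends (inj₂ (refl , refl)) (inj₁ (() , _))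

    graph : Graph
    graph = record
      { #V = nL + nR
      ; #E = nL * d
      ; ends = ends
      ; loopless = λ f u j → no-loop (joins j)
      ; no-parallel = λ f f′ u v j j′ → edge-injective (same-ends (joins j) (joins j′))
      }
      where
      no-loop : ∀ {e x} → ¬ Joins e x x
      no-loop (inj₁ (refl , ()))
      no-loop (inj₂ (refl , ()))

    module CycleWalk {k : ℕ} (v : Vec (Fin (nL + nR)) (3 + k)) (c : IsCycle graph full v) where
      open IsCycle c

      n : ℕ
      n = 3 + k

      ν : ℕ → Fin nL ⊎ Fin nR
      ν j = vertex (lookup v (j mod n))

      ε : ℕ → Fin nL × Fin d
      ε j = edge (proj₁ (closed (j mod n)))

      toℕ-mod : ∀ j → toℕ (j mod n) ≡ j % n
      toℕ-mod j = Fin.toℕ-fromℕ< _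

      ν-injective : ∀ i j → ν i ≡ ν j → i % n ≡ j % n
      ν-injective i j eq = trans (sym (toℕ-mod i))
        (trans (cong toℕ (distinct (trans (sym (Fin.join-splitAt nL nR _)) (trans (cong (Data.Fin.join nL nR) eq) (Fin.join-splitAt nL nR _))))) (toℕ-mod j))

      joins-ε : ∀ {j} → j < n → Joins (ε j) (ν j) (ν (suc j))
      joins-ε {j} j<n = subst (λ i → Joins (ε j) (ν j) (vertex (lookup v (suc i mod n))))
        (trans (toℕ-mod j) (m<n⇒m%n≡m j<n)) (joins (proj₂ (proj₂ (closed (j mod n)))))

      -- Equal consecutive edges would lead back to the vertex two places earlier, but positions j
      -- and j + 2 differ modulo the length 3 + k. In the wrapping case j + 2 is the length, so j
      -- would be 0 and the length 2.
      ε-step : ∀ {j} → suc j < n → ε j ≢ ε (suc j)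
      ε-step {j} lt eq = wrap (ℕ.m≤n⇒m<n∨m≡n lt)
        where
        j<n : j < n
        j<n = ℕ.<-trans (ℕ.n<1+n j) lt
        j≡ : j ≡ suc (suc j) % n
        j≡ = trans (sym (m<n⇒m%n≡m j<n)) (ν-injective j (suc (suc j))
          (joins-back (joins-ε j<n) (subst (λ e → Joins e (ν (suc j)) (ν (suc (suc j)))) (sym eq) (joins-ε lt))))
        wrap : suc (suc j) < n ⊎ suc (suc j) ≡ n → ⊥
        wrap (inj₁ lt′) = ℕ.<⇒≢ (ℕ.m<n⇒m<1+n (ℕ.n<1+n j)) (trans j≡ (m<n⇒m%n≡m lt′))
        wrap (inj₂ eq′) with trans j≡ (trans (cong (_% n) eq′) (n%n≡0 n))
        ... | refl with eq′
        ... | ()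

      edges : ℕ → ℕ → List (Fin nL × Fin d)
      edges j zero    = []
      edges j (suc m) = ε j ∷ edges (suc j) m

      walk : ∀ j m → j + m ≤ n → Walk (ν j) (edges j m) (ν (j + m))
      walk j zero    _  = subst (λ i → Walk (ν j) [] (ν i)) (sym (ℕ.+-identityʳ j)) []
      walk j (suc m) le = joins-ε (ℕ.≤-trans (s≤s (ℕ.m≤m+n j m)) le′) ∷
        subst (λ i → Walk (ν (suc j)) (edges (suc j) m) (ν i)) (sym (ℕ.+-suc j m)) (walk (suc j) m le′)
        where
        le′ : suc j + m ≤ n
        le′ = subst (_≤ n) (ℕ.+-suc j m) le

      linked : ∀ j m → j + m ≤ n → Linked _≢_ (edges j m)
      linked j zero          _  = []
      linked j (suc zero)    _  = [-]
      linked j (suc (suc m)) le = ε-step (ℕ.≤-trans (ℕ.m≤m+n (suc (suc j)) m) (subst (_≤ n) (ℕ.+-suc (suc j) m) le′)) ∷ linked (suc j) (suc m) le′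
        where
        le′ : suc j + suc m ≤ n
        le′ = subst (_≤ n) (ℕ.+-suc j (suc m)) le

      length-edges : ∀ j m → length (edges j m) ≡ m
      length-edges j zero    = refl
      length-edges j (suc m) = cong suc (length-edges (suc j) m)

      beyond : ∀ {K} → GirthBeyond K → K ≤ 2 + k
      beyond {K} girth = subst (K ≤_) (length-edges 1 (2 + k)) (girth closed-walk (linked 0 n ℕ.≤-refl))
        where
        closed-walk : Walk (ν 0) (edges 0 n) (ν 0)
        closed-walk = subst (λ i → Walk (ν 0) (edges 0 n) (vertex (lookup v i)))
          (Fin.toℕ-injective (trans (toℕ-mod n) (n%n≡0 n))) (walk 0 n ℕ.≤-refl)

    girthAtLeast : ∀ g → GirthBeyond ∣ g ∣ → GirthAtLeast graph g
    girthAtLeast g girth v c = ℤ.≤-trans (i≤∣i∣ g) (ℤ.+≤+ (ℕ.m≤n⇒m≤1+n (CycleWalk.beyond v c girth)))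
      where
      i≤∣i∣ : ∀ i → i ℤ.≤ ℤ.+ ∣ i ∣
      i≤∣i∣ (ℤ.+ n)     = ℤ.≤-refl
      i≤∣i∣ ℤ.-[1+ n ] = ℤ.-≤+

-- Cycles, connectivity and the number of edges in a forest.

module Forests where
  open import Data.Fin using (fromℕ; inject₁; _↑ˡ_; _↑ʳ_)
  open import Data.Fin.Relation.Unary.Top using (view; ‵fromℕ; ‵inject₁)
  open import Data.Fin.Subset using (Subset; ⁅_⁆; _∪_; _∈_; _∉_; _-_) renaming (⊥ to ∅; ⊤ to full; ∣_∣ to size)
  open import Data.Fin.Subset.Properties using (x∈⁅x⁆; p⊆p∪q; q⊆p∪q; ∣⊤∣≡n; ∈⊤; x∈p∧x≢y⇒x∈p-y; x∈p⇒∣p-x∣<∣p∣)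
  open import Data.Nat using (_+_; _*_; _≤_; s≤s)
  open import Data.Nat.DivMod using (_mod_; m<n⇒m%n≡m; n%n≡0)
  open import Data.Sum using (swap)
  open import Data.Vec using (lookup; head)
  open import Data.Vec.Relation.Unary.All using (All; []; _∷_)
  import Data.Vec.Relation.Unary.All.Properties as All
  open import Data.Vec.Relation.Unary.AllPairs using ([]; _∷_)
  open import Data.Vec.Relation.Unary.Any using (here; there)
  open import Data.Vec.Relation.Unary.Unique.Propositional using (Unique)
  open import Data.Vec.Relation.Unary.Unique.Propositional.Properties using (lookup-injective)
  import Data.Vec.Membership.Propositional as Vec
  import Data.Vec.Membership.DecPropositional as DecVec
  open import Relation.Binary.Construct.Closure.ReflexiveTransitive using (Star; ε; _◅_; _◅◅_; reverse; gmap)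
  open import Defs using (Graph; IsCycle; mkCycle; HasCycle; Acyclic)
  open Covers using (System; module SystemGraph; module Walks)

  module Cycles (G : Graph) where
    open Graph G
    open DecVec (Fin._≟_ {#V}) using (_∈?_)

    Adjacent : Subset #E → V → V → Set
    Adjacent S x y = ∃ λ f → f ∈ S × Joins f x y

    Connected : Subset #E → V → V → Set
    Connected S = Star (Adjacent S)

    adjacent-sym : ∀ {S x y} → Adjacent S x y → Adjacent S y x
    adjacent-sym (f , f∈S , j) = f , f∈S , swap j

    connected-sym : ∀ {S x y} → Connected S x y → Connected S y x
    connected-sym = reverse adjacent-sym

    connected-mono : ∀ f {S x y} → Connected S x y → Connected (⁅ f ⁆ ∪ S) x y
    connected-mono f {S} = gmap (λ x → x) (λ { (f′ , f′∈S , j) → f′ , q⊆p∪q ⁅ f ⁆ S f′∈S , j })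

    data Path (S : Subset #E) : ∀ {n} → Vec V (suc n) → V → Set where
      [-] : ∀ {x} → Path S (x ∷ []) x
      _∷_ : ∀ {n x z} {v : Vec V (suc n)} → Adjacent S x (head v) → Path S v z → Path S (x ∷ v) z

    SimplePath : Subset #E → V → V → Set
    SimplePath S x z = ∃ λ n → Σ (Vec V (suc n)) λ v → head v ≡ x × Path S v z × Unique v

    suffix : ∀ {S n x z} {v : Vec V (suc n)} → x Vec.∈ v → Path S v z → Unique v → SimplePath S x z
    suffix (here refl)         p       u       = _ , _ , refl , p , u
    suffix (there x∈v) (_ ∷ p) (_ ∷ u) = suffix x∈v p u

    all≢ : ∀ {n x} (v : Vec V n) → ¬ x Vec.∈ v → All (x ≢_) v
    all≢ []      _  = []
    all≢ (y ∷ v) x∉ = (λ eq → x∉ (here eq)) ∷ all≢ v (λ x∈ → x∉ (there x∈))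

    simplePath : ∀ {S x z} → Connected S x z → SimplePath S x z
    simplePath ε = _ , _ , refl , [-] , [] ∷ []
    simplePath {x = x} (a ◅ c) with simplePath c
    ... | n , v , refl , p , u with x ∈? v
    ...   | yes x∈v = suffix x∈v p u
    ...   | no x∉v  = suc n , x ∷ v , refl , a ∷ p , all≢ v x∉v ∷ u

    path-step : ∀ {S n z} {v : Vec V (suc n)} → Path S v z → ∀ i → Adjacent S (lookup v (inject₁ i)) (lookup v (suc i))
    path-step {v = _ ∷ _ ∷ _} (a ∷ p) zero    = a
    path-step                 (a ∷ p) (suc i) = path-step p i

    path-last : ∀ {S n z} {v : Vec V (suc n)} → Path S v z → lookup v (fromℕ n) ≡ z
    path-last [-]     = refl
    path-last (a ∷ p) = path-last p

    lookup-zero : ∀ {n} (v : Vec V (suc n)) → lookup v zero ≡ head v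
    lookup-zero (x ∷ v) = refl

    -- A simple path from `x` to `z` is completed by `f`. With no edge on the path `f` would be a
    -- loop, with one edge a parallel edge, so that at least three vertices remain.
    closes-cycle : ∀ {S f x z} → f ∉ S → Joins f x z → Connected S x z → HasCycle G (⁅ f ⁆ ∪ S)
    closes-cycle {S} {f} {x} {z} f∉S j c with simplePath c
    ... | zero , (_ ∷ []) , refl , [-] , u = contradiction j (loopless f _)
    ... | suc zero , (_ ∷ _ ∷ []) , refl , (f′ , f′∈S , j′) ∷ [-] , u =
      contradiction (subst (_∈ S) (no-parallel f′ f _ _ j′ j) f′∈S) f∉S
    ... | suc (suc k) , v , refl , p , u = k , v , mkCycle (λ {i} {i′} → lookup-injective u i i′) closed
      where
      closed : ∀ i → ∃ λ f′ → f′ ∈ ⁅ f ⁆ ∪ S × Joins f′ (lookup v i) (lookup v (suc (toℕ i) mod (3 + k)))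
      closed i with view i
      ... | ‵fromℕ = f , p⊆p∪q S (x∈⁅x⁆ f) , subst₂ (Joins f) (sym (path-last p)) (sym first) (swap j)
        where
        first : lookup v (suc (toℕ (fromℕ (2 + k))) mod (3 + k)) ≡ x
        first = trans (cong (lookup v) (Fin.toℕ-injective (trans (Fin.toℕ-fromℕ< _)
          (trans (cong (λ m → suc m Data.Nat.DivMod.% (3 + k)) (Fin.toℕ-fromℕ (2 + k))) (n%n≡0 (3 + k)))))) (lookup-zero v)
      ... | ‵inject₁ i′ with path-step p i′
      ... | f′ , f′∈S , j′ = f′ , q⊆p∪q ⁅ f ⁆ S f′∈S , subst (λ m → Joins f′ (lookup v (inject₁ i′)) (lookup v m)) (sym next) j′
        where
        next : suc (toℕ (inject₁ i′)) mod (3 + k) ≡ suc i′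
        next = Fin.toℕ-injective (trans (Fin.toℕ-fromℕ< _)
          (trans (cong (λ m → suc m Data.Nat.DivMod.% (3 + k)) (Fin.toℕ-inject₁ i′)) (m<n⇒m%n≡m (s≤s (Fin.toℕ<n i′)))))

  module SystemForests {d : ℕ} (S : System d) where
    open System S hiding (V; E)
    open SystemGraph S
    open Graph graph using (V; Joins)
    open Cycles graph

    left : Fin (nL * d) → Fin nL
    left f = proj₁ (edge f)

    leftV : Fin nL → V
    leftV u = u ↑ˡ nR

    rightV : Fin nR → V
    rightV ρ = nL ↑ʳ ρ

    right : Fin (nL * d) → Fin nR
    right f = r (left f) (proj₂ (edge f))

    joins-ends : ∀ f → Joins f (leftV (left f)) (rightV (right f))
    joins-ends f = inj₁ refl

    -- Equal labels mean: connected by A. Every edge beyond the first at a left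
    -- vertex merges two labels.
    record Components (A : Subset (nL * d)) (extra : ℕ) : Set where
      field
        label     : Fin nR → Fin nR
        live      : Subset nR
        label∈    : ∀ ρ → label ρ ∈ live
        live-size : size live + extra ≤ nR
        connected : ∀ ρ σ → label ρ ≡ label σ → Connected A (rightV ρ) (rightV σ)

    no-edges : Components ∅ 0
    no-edges = record
      { label = λ ρ → ρ ; live = full ; label∈ = λ _ → ∈⊤
      ; live-size = ℕ.≤-reflexive (trans (ℕ.+-identityʳ _) (∣⊤∣≡n nR))
      ; connected = λ { ρ σ refl → ε } }

    first-edge : ∀ {A x} f → Components A x → Components (⁅ f ⁆ ∪ A) x
    first-edge f C = record
      { label = label ; live = live ; label∈ = label∈ ; live-size = live-size
      ; connected = λ ρ σ eq → connected-mono f (connected ρ σ eq) }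
      where open Components C

    -- Both edges meet at the same left vertex, so their right ends cannot have been connected
    -- before: `f` would close a cycle. Their labels `a` and `b` therefore differ; `f` merges the
    -- two classes, which allows `a` to be retired.
    further-edge : ∀ {A x} f f′ → f ∉ A → f′ ∈ A → left f′ ≡ left f → Acyclic graph (⁅ f ⁆ ∪ A) →
                   Components A x → Components (⁅ f ⁆ ∪ A) (suc x)
    further-edge {A} {x} f f′ f∉A f′∈A same acyclic C = record
      { label = label′ ; live = live - a ; label∈ = label′∈
      ; live-size = ℕ.≤-trans (ℕ.≤-reflexive (ℕ.+-suc (size (live - a)) x))
          (ℕ.≤-trans (ℕ.+-monoˡ-≤ x (x∈p⇒∣p-x∣<∣p∣ (label∈ (right f)))) live-size)
      ; connected = conn }
      where
      open Components C
      a b : Fin nR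
      a = label (right f)
      b = label (right f′)
      to-left : Connected A (rightV (right f′)) (leftV (left f))
      to-left = (f′ , f′∈A , inj₂ (cong (λ u → leftV u , rightV (right f′)) same)) ◅ ε
      b≢a : b ≢ a
      b≢a eq = acyclic (closes-cycle f∉A (joins-ends f) (connected-sym (connected _ _ (sym eq) ◅◅ to-left)))
      label′ : Fin nR → Fin nR
      label′ ρ with label ρ Fin.≟ a
      ... | yes _ = b
      ... | no _  = label ρ
      label′∈ : ∀ ρ → label′ ρ ∈ live - a
      label′∈ ρ with label ρ Fin.≟ a
      ... | yes _ = x∈p∧x≢y⇒x∈p-y (label∈ (right f′)) b≢a
      ... | no ≢a = x∈p∧x≢y⇒x∈p-y (label∈ ρ) ≢a
      via : Connected (⁅ f ⁆ ∪ A) (rightV (right f)) (rightV (right f′))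
      via = (f , p⊆p∪q A (x∈⁅x⁆ f) , inj₂ refl) ◅ connected-mono f (connected-sym to-left)
      up : ∀ ρ σ → label ρ ≡ label σ → Connected (⁅ f ⁆ ∪ A) (rightV ρ) (rightV σ)
      up ρ σ eq = connected-mono f (connected ρ σ eq)
      conn : ∀ ρ σ → label′ ρ ≡ label′ σ → Connected (⁅ f ⁆ ∪ A) (rightV ρ) (rightV σ)
      conn ρ σ eq with label ρ Fin.≟ a | label σ Fin.≟ a
      ... | yes p | yes q = up ρ σ (trans p (sym q))
      ... | yes p | no _  = up ρ (right f) p ◅◅ via ◅◅ up (right f′) σ eq
      ... | no _  | yes q = up ρ (right f′) eq ◅◅ connected-sym via ◅◅ up (right f) σ (sym q)
      ... | no _  | no _  = up ρ σ eq

    open Walks src tgt loopless using () renaming (Joins to Joinsˢ; joins-back to joins-backˢ)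

    -- At a vertex of the cycle that lies on the left, the two cycle edges coincide.
    star-acyclic : ∀ {A} → (∀ f f′ → f ∈ A → f′ ∈ A → left f ≡ left f′ → f ≡ f′) → Acyclic graph A
    star-acyclic {A} unique (k , v , c) = side (vertex (lookup v (suc zero))) refl
      where
      open IsCycle c
      i₀ i₁ i₂ : Fin (3 + k)
      i₀ = zero
      i₁ = suc zero
      i₂ = suc (suc zero)
      vertex-injective : ∀ {x y} → vertex x ≡ vertex y → x ≡ y
      vertex-injective eq = trans (sym (Fin.join-splitAt nL nR _)) (trans (cong (Data.Fin.join nL nR) eq) (Fin.join-splitAt nL nR _))
      at-left : ∀ {f x y u} → vertex x ≡ inj₁ u → Joinsˢ (edge f) (vertex x) (vertex y) ⊎ Joinsˢ (edge f) (vertex y) (vertex x) → left f ≡ u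
      at-left {f} {x} eq (inj₁ (inj₁ (p , _))) with trans p eq
      ... | refl = refl
      at-left {f} {x} eq (inj₁ (inj₂ (p , _))) with trans p eq
      ... | ()
      at-left {f} {x} eq (inj₂ (inj₁ (_ , p))) with trans p eq
      ... | ()
      at-left {f} {x} eq (inj₂ (inj₂ (_ , p))) with trans p eq
      ... | refl = refl
      no-turn : ∀ {x y z f f′ u} → vertex y ≡ inj₁ u → f ∈ A → f′ ∈ A → Joins f x y → Joins f′ y z → x ≡ z
      no-turn {f = f} {f′} yL f∈A f′∈A j j′ with unique f f′ f∈A f′∈A (trans (at-left {f} yL (inj₂ (joins j))) (sym (at-left {f′} yL (inj₁ (joins j′)))))
      ... | refl = vertex-injective (joins-backˢ (joins j) (joins j′))
      turn : ∀ i j l → suc (toℕ i) mod (3 + k) ≡ j → suc (toℕ j) mod (3 + k) ≡ l → i ≢ l → ∀ u → vertex (lookup v j) ≡ inj₁ u → ⊥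
      turn i j l refl refl i≢l u jL with closed i | closed j
      ... | f , f∈A , jf | f′ , f′∈A , jf′ = i≢l (distinct (no-turn jL f∈A f′∈A jf jf′))
      i₃ : ∀ k → Fin (3 + k)
      i₃ zero    = zero
      i₃ (suc k) = suc (suc (suc zero))
      3mod : ∀ k → 3 mod (3 + k) ≡ i₃ k
      3mod zero    = refl
      3mod (suc k) = refl
      i₁≢i₃ : ∀ k → suc zero ≢ i₃ k
      i₁≢i₃ zero    ()
      i₁≢i₃ (suc k) ()
      -- One of two neighbouring vertices is on the left, so the turn happens at `i₁` or at `i₂`. In
      -- the second case the next vertex is `i₃ k`, which for a triangle is the vertex at the start.
      side : ∀ s → vertex (lookup v i₁) ≡ s → ⊥
      side (inj₁ u) eq = turn i₀ i₁ i₂ refl refl (λ ()) u eq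
      side (inj₂ ρ) eq with vertex (lookup v i₂) in eq₂
      ... | inj₁ u = turn i₁ i₂ (i₃ k) refl (3mod k) (i₁≢i₃ k) u eq₂
      ... | inj₂ σ = bipartite (joins (proj₂ (proj₂ (closed i₁)))) eq eq₂
        where
        bipartite : ∀ {e x y ρ σ} → Joinsˢ e x y → x ≡ inj₂ ρ → y ≡ inj₂ σ → ⊥
        bipartite (inj₁ (refl , _)) () _
        bipartite (inj₂ (_ , refl)) _ ()

-- Linearity of expectation and the resampling of one vertex.

module Expectation where
  open import Data.List.Membership.Propositional using (_∉_)
  open import Data.List.Relation.Binary.Permutation.Propositional as ↭ using (_↭_)
  open import Data.List.Relation.Unary.All using () renaming (lookup to All-lookup)
  open import Data.List.Relation.Unary.AllPairs using ([]; _∷_)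
  open import Data.List.Relation.Unary.Any using (here; there)
  open import Data.List.Relation.Unary.Unique.Propositional using (Unique)
  open import Data.Rational hiding (1/_)
  open import Data.Rational.Properties hiding (_≟_)
  open import Data.Rational.Solver using (module +-*-Solver)
  open import Data.Vec using (lookup; _[_]≔_)
  open Rationals
  open Densities
  open Online

  mix-+ : ∀ p a b a′ b′ → mix p (a + a′) (b + b′) ≡ mix p a b + mix p a′ b′
  mix-+ = solve 5 (λ p a b a′ b′ → p :* (a :+ a′) :+ (con 1ℚ :- p) :* (b :+ b′)
    := (p :* a :+ (con 1ℚ :- p) :* b) :+ (p :* a′ :+ (con 1ℚ :- p) :* b′)) refl
    where open +-*-Solver

  mix-* : ∀ p c a b → mix p (c * a) (c * b) ≡ c * mix p a b
  mix-* = solve 4 (λ p c a b → p :* (c :* a) :+ (con 1ℚ :- p) :* (c :* b) := c :* (p :* a :+ (con 1ℚ :- p) :* b)) refl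
    where open +-*-Solver

  mix-same : ∀ p c → mix p c c ≡ c
  mix-same = solve 2 (λ p c → p :* c :+ (con 1ℚ :- p) :* c := c) refl
    where open +-*-Solver

  mix-0 : ∀ a b → mix 0ℚ a b ≡ b
  mix-0 = solve 2 (λ a b → con 0ℚ :* a :+ (con 1ℚ :- con 0ℚ) :* b := b) refl
    where open +-*-Solver

  module ExpectProperties {E L : Set} (left : E → L) (_≟_ : DecidableEquality L) (N : ℕ)
    (prob : Observed E N → E → Fin N → ℚ)
    (0≤prob : ∀ h f c → 0ℚ ≤ prob h f c) (prob≤1 : ∀ h f c → prob h f c ≤ 1ℚ) where

    open Run left _≟_ N
    open Algorithmic prob 0≤prob prob≤1

    module _ (w : E → Fin N) where

      expect-+ : ∀ φ ψ h fs → expect w (λ h → φ h + ψ h) h fs ≡ expect w φ h fs + expect w ψ h fs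
      expect-+ φ ψ h []       = refl
      expect-+ φ ψ h (f ∷ fs) = trans
        (cong₂ (mix (prob h f (w f))) (expect-+ φ ψ _ fs) (expect-+ φ ψ _ fs))
        (mix-+ (prob h f (w f)) (expect w φ _ fs) (expect w φ _ fs) (expect w ψ _ fs) (expect w ψ _ fs))

      expect-* : ∀ c φ h fs → expect w (λ h → c * φ h) h fs ≡ c * expect w φ h fs
      expect-* c φ h []       = refl
      expect-* c φ h (f ∷ fs) = trans
        (cong₂ (mix (prob h f (w f))) (expect-* c φ _ fs) (expect-* c φ _ fs))
        (mix-* (prob h f (w f)) c (expect w φ _ fs) (expect w φ _ fs))

      expect-const : ∀ c h fs → expect w (λ _ → c) h fs ≡ c
      expect-const c h []       = refl
      expect-const c h (f ∷ fs) = trans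
        (cong₂ (mix (prob h f (w f))) (expect-const c _ fs) (expect-const c _ fs)) (mix-same (prob h f (w f)) c)

      expect-sum : ∀ {A : Set} (l : List A) (φ : A → Observed E N → ℚ) h fs →
                   expect w (λ h → sumL l (λ a → φ a h)) h fs ≡ sumL l (λ a → expect w (φ a) h fs)
      expect-sum []       φ h fs = expect-const 0ℚ h fs
      expect-sum (a ∷ as) φ h fs = trans (expect-+ (φ a) (λ h → sumL as (λ a → φ a h)) h fs)
        (cong (expect w (φ a) h fs +_) (expect-sum as φ h fs))

      module _ (Feasible : Observed E N → E → Set) (feasible? : ∀ h f → Dec (Feasible h f))
               (prob-0 : ∀ h f c → ¬ Feasible h f → prob h f c ≡ 0ℚ)
               (I : Observed E N → List E → Set)
               (I-step : ∀ h f fs b → I h (f ∷ fs) → (b ≡ true → Feasible h f) → I ((f , w f , b) ∷ h) fs) where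

        -- An event of probability 0 may violate the invariant.
        expect-mono : ∀ φ ψ → (∀ h → I h [] → φ h ≤ ψ h) → ∀ h fs → I h fs → expect w φ h fs ≤ expect w ψ h fs
        expect-mono φ ψ le h []       inv = le h inv
        expect-mono φ ψ le h (f ∷ fs) inv with feasible? h f
        ... | yes ok = mix-mono (0≤prob h f (w f)) (prob≤1 h f (w f))
          (expect-mono φ ψ le _ fs (I-step h f fs true inv (λ _ → ok)))
          (expect-mono φ ψ le _ fs (I-step h f fs false inv (λ ())))
        ... | no ¬ok rewrite prob-0 h f (w f) ¬ok = subst₂ _≤_
          (sym (mix-0 (expect w φ ((f , w f , true) ∷ h) fs) (expect w φ ((f , w f , false) ∷ h) fs)))
          (sym (mix-0 (expect w ψ ((f , w f , true) ∷ h) fs) (expect w ψ ((f , w f , false) ∷ h) fs)))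
          (expect-mono φ ψ le ((f , w f , false) ∷ h) fs (I-step h f fs false inv (λ ())))

  -- The coordinates are summed over in the order of arrival, each overwriting its entry of the
  -- vector. Over all coordinates, in any order, this is the sum over all vectors, and the initial
  -- vector is only a placeholder.
  ∑At : ∀ {N d} → List (Fin d) → Vec (Fin N) d → (Vec (Fin N) d → ℚ) → ℚ
  ∑At []       x f = f x
  ∑At {N} (i ∷ ls) x f = ∑Fin N (λ c → ∑At ls (x [ i ]≔ c) f)

  module _ {N d : ℕ} where

    ∑At-cong : ∀ (ls : List (Fin d)) (x : Vec (Fin N) d) {f g} → (∀ y → f y ≡ g y) → ∑At ls x f ≡ ∑At ls x g
    ∑At-cong []       x eq = eq x
    ∑At-cong (i ∷ ls) x eq = sumL-cong (allFin N) (λ c → ∑At-cong ls (x [ i ]≔ c) eq)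

    ∑At-cong-at : ∀ i (ls : List (Fin d)) (x : Vec (Fin N) d) {f g} → i ∉ ls →
                  (∀ y → lookup y i ≡ lookup x i → f y ≡ g y) → ∑At ls x f ≡ ∑At ls x g
    ∑At-cong-at i []       x i∉ eq = eq x refl
    ∑At-cong-at i (j ∷ ls) x i∉ eq = sumL-cong (allFin N) (λ c → ∑At-cong-at i ls (x [ j ]≔ c) (i∉ ∘ there)
      (λ y e → eq y (trans e (Vec.lookup∘update′ (i∉ ∘ here) x c))))

    ∑At-+ : ∀ (ls : List (Fin d)) (x : Vec (Fin N) d) f g → ∑At ls x (λ y → f y + g y) ≡ ∑At ls x f + ∑At ls x g
    ∑At-+ []       x f g = refl
    ∑At-+ (i ∷ ls) x f g = trans (sumL-cong (allFin N) (λ c → ∑At-+ ls (x [ i ]≔ c) f g))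
      (sumL-+ (allFin N) (λ c → ∑At ls (x [ i ]≔ c) f) (λ c → ∑At ls (x [ i ]≔ c) g))

    ∑At-* : ∀ (ls : List (Fin d)) (x : Vec (Fin N) d) c f → ∑At ls x (λ y → c * f y) ≡ c * ∑At ls x f
    ∑At-* []       x c f = refl
    ∑At-* (i ∷ ls) x c f = trans (sumL-cong (allFin N) (λ b → ∑At-* ls (x [ i ]≔ b) c f))
      (sumL-* (allFin N) c (λ b → ∑At ls (x [ i ]≔ b) f))

    ∑At-mix : ∀ (ls : List (Fin d)) (x : Vec (Fin N) d) p f g → ∑At ls x (λ y → mix p (f y) (g y)) ≡ mix p (∑At ls x f) (∑At ls x g)
    ∑At-mix ls x p f g = trans (∑At-+ ls x (λ y → p * f y) (λ y → (1ℚ - p) * g y))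
      (cong₂ _+_ (∑At-* ls x p f) (∑At-* ls x (1ℚ - p) g))

    ∑At-↭ : ∀ {ls ls′ : List (Fin d)} (x : Vec (Fin N) d) f → ls ↭ ls′ → ∑At ls x f ≡ ∑At ls′ x f
    ∑At-↭ x f ↭.refl         = refl
    ∑At-↭ x f (↭.prep i p)   = sumL-cong (allFin N) (λ c → ∑At-↭ (x [ i ]≔ c) f p)
    ∑At-↭ x f (↭.trans p q)  = trans (∑At-↭ x f p) (∑At-↭ x f q)
    ∑At-↭ {ls′ = _ ∷ _ ∷ ls} x f (↭.swap i j p) with i Fin.≟ j
    ... | yes refl = sumL-cong (allFin N) (λ c → sumL-cong (allFin N) (λ c′ → ∑At-↭ (x [ i ]≔ c [ i ]≔ c′) f p))
    ... | no i≢j   = trans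
      (sumL-cong (allFin N) (λ c → sumL-cong (allFin N) (λ c′ → trans (∑At-↭ (x [ i ]≔ c [ j ]≔ c′) f p)
        (cong (λ y → ∑At ls y f) (Vec.[]≔-commutes x i j i≢j)))))
      (sumL-swap (allFin N) (allFin N) (λ c c′ → ∑At ls (x [ j ]≔ c′ [ i ]≔ c) f))

  ∑At-suc : ∀ {N d} (ls : List (Fin d)) c (x : Vec (Fin N) d) f → ∑At (map suc ls) (c ∷ x) f ≡ ∑At ls x (λ y → f (c ∷ y))
  ∑At-suc []       c x f = refl
  ∑At-suc {N} (i ∷ ls) c x f = sumL-cong (allFin N) (λ b → ∑At-suc ls c (x [ i ]≔ b) f)

  ∑At-allFin : ∀ {N} d (x : Vec (Fin N) d) f → ∑At (allFin d) x f ≡ sumL (vecs (allFin N) d) f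
  ∑At-allFin zero    []      f = sym (+-identityʳ (f []))
  ∑At-allFin {N} (suc d) (b ∷ x) f = trans
    (sumL-cong (allFin N) (λ c → trans (cong (λ ls → ∑At ls (c ∷ x) f) (sym (List.map-tabulate (λ i → i) suc)))
      (trans (∑At-suc (allFin d) c x f) (∑At-allFin d x (λ y → f (c ∷ y))))))
    (sym (sumL-vecs (allFin N) d f))

  maxAt : ∀ {N d} → Vec (Fin N) d → List (Fin d) → ℕ
  maxAt x = foldr (λ i m → toℕ (lookup x i) ℕ.⊔ m) 0

  maxAt-↭ : ∀ {N d} (x : Vec (Fin N) d) {ls ls′} → ls ↭ ls′ → maxAt x ls ≡ maxAt x ls′
  maxAt-↭ x ↭.refl        = refl
  maxAt-↭ x (↭.prep i p)  = cong (toℕ (lookup x i) ℕ.⊔_) (maxAt-↭ x p)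
  maxAt-↭ x (↭.trans p q) = trans (maxAt-↭ x p) (maxAt-↭ x q)
  maxAt-↭ x (↭.swap {ys = ls} i j p) = trans (cong (λ m → a ℕ.⊔ (b ℕ.⊔ m)) (maxAt-↭ x p))
    (trans (sym (ℕ.⊔-assoc a b (maxAt x ls))) (trans (cong (ℕ._⊔ maxAt x ls) (ℕ.⊔-comm a b)) (ℕ.⊔-assoc b a (maxAt x ls))))
    where
    a = toℕ (lookup x i)
    b = toℕ (lookup x j)

  maxAt-suc : ∀ {N d} c (x : Vec (Fin N) d) ls → maxAt (c ∷ x) (map suc ls) ≡ maxAt x ls
  maxAt-suc c x []       = refl
  maxAt-suc c x (i ∷ ls) = cong (toℕ (lookup x i) ℕ.⊔_) (maxAt-suc c x ls)

  maxAt-allFin : ∀ {N d} (x : Vec (Fin N) d) → maxAt x (allFin d) ≡ maxV x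
  maxAt-allFin []      = refl
  maxAt-allFin {d = suc d} (c ∷ x) = cong (toℕ c ℕ.⊔_) (trans (cong (maxAt (c ∷ x)) (sym (List.map-tabulate (λ i → i) suc)))
    (trans (maxAt-suc c x (allFin d)) (maxAt-allFin x)))

  module Coordinates {E L : Set} (left : E → L) (_≟_ : DecidableEquality L) (N : ℕ)
    {d : ℕ} (coordinate : E → Fin d) (u : L) where

    open Run left _≟_ N using (when; degree)

    coordinates : List E → List (Fin d)
    coordinates []       = []
    coordinates (f ∷ fs) = when (left f ≟ u) (coordinate f ∷ coordinates fs) (coordinates fs)

    degree-coordinates : ∀ fs → degree u fs ≡ length (coordinates fs)
    degree-coordinates []       = refl
    degree-coordinates (f ∷ fs) with left f ≟ u
    ... | yes _ = cong suc (degree-coordinates fs)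
    ... | no _  = degree-coordinates fs

  module Resampling {E L : Set} (left : E → L) (_≟_ : DecidableEquality L) (N : ℕ)
    (prob : Observed E N → E → Fin N → ℚ)
    (0≤prob : ∀ h f c → 0ℚ ≤ prob h f c) (prob≤1 : ∀ h f c → prob h f c ≤ 1ℚ)
    {d : ℕ} (coordinate : E → Fin d) (u : L) where

    open Run left _≟_ N
    open Algorithmic prob 0≤prob prob≤1

    open Coordinates left _≟_ N coordinate u

    module _ (w : E → Fin N) (code : Vec (Fin N) d → E → Fin N)
             (code-yes : ∀ x f → left f ≡ u → code x f ≡ lookup x (coordinate f))
             (code-no : ∀ x f → left f ≢ u → code x f ≡ w f) where

      -- A code influences nothing before its edge arrives, so its sum may be carried out at the
      -- arrival. Uniqueness guarantees that no later summation overwrites a code already revealed.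
      ∑At-expect : ∀ φ h fs x → Unique (coordinates fs) →
                   ∑At (coordinates fs) x (λ y → expect (code y) φ h fs) ≡ resample u w φ h fs
      ∑At-expect φ h []       x _ = refl
      ∑At-expect φ h (f ∷ fs) x uniq with left f ≟ u
      ... | no ≢u = trans
        (∑At-cong (coordinates fs) x (λ y → cong (branch (λ h′ → expect (code y) φ h′ fs) h f) (code-no y f ≢u)))
        (trans (∑At-mix (coordinates fs) x (prob h f (w f)) _ _)
          (cong₂ (mix (prob h f (w f))) (∑At-expect φ ((f , w f , true) ∷ h) fs x uniq) (∑At-expect φ ((f , w f , false) ∷ h) fs x uniq)))
      ∑At-expect φ h (f ∷ fs) x (i∉ ∷ uniq) | yes ≡u = sumL-cong (allFin N) (λ c → trans
        (∑At-cong-at i (coordinates fs) (x [ i ]≔ c) (λ i∈ → All-lookup i∉ i∈ refl)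
          (λ y e → cong (branch (λ h′ → expect (code y) φ h′ fs) h f)
            (trans (code-yes y f ≡u) (trans e (Vec.lookup∘update i x c)))))
        (trans (∑At-mix (coordinates fs) (x [ i ]≔ c) (prob h f c) _ _)
          (cong₂ (mix (prob h f c)) (∑At-expect φ ((f , c , true) ∷ h) fs _ uniq) (∑At-expect φ ((f , c , false) ∷ h) fs _ uniq))))
        where i = coordinate f

-- Charging the accepted weight to first edges and to right vertices.

module Accounting where
  open import Data.Fin.Subset using (Subset; ⁅_⁆; _∪_; outside) renaming (⊥ to ∅; _∈_ to _∈ˢ_; _∉_ to _∉ˢ_)
  open import Data.Fin.Subset.Properties using (x∈⁅x⁆; x∈⁅y⁆⇒x≡y; p⊆p∪q; q⊆p∪q; x∈p∪q⁻; ∉⊥; _∈?_)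
  open import Data.List.Membership.Propositional using (_∈_)
  open import Data.List.Relation.Unary.All using () renaming (lookup to All-lookup)
  open import Data.List.Relation.Unary.AllPairs using ([]; _∷_)
  open import Data.List.Relation.Unary.Any using (here; there)
  open import Data.List.Relation.Unary.Unique.Propositional using (Unique)
  open import Data.Rational hiding (1/_)
  open import Data.Rational.Properties hiding (_≟_)
  open import Data.Rational.Solver using (module +-*-Solver)
  open import Data.Sum using ([_,_]′)
  open import Data.Vec using (lookup)
  open import Defs using (Acyclic)
  open Rationals
  open Densities
  open Online
  open Covers using (System; module SystemGraph)
  open Forests using (module SystemForests)

  single : ∀ {n} → Fin n → ℚ → Fin n → ℚ
  single i x j with i Fin.≟ j
  ... | yes _ = x
  ... | no _  = 0ℚ

  single-suc : ∀ {n} (i j : Fin n) x → single (suc i) x (suc j) ≡ single i x j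
  single-suc i j x with i Fin.≟ j
  ... | yes _ = refl
  ... | no _  = refl

  ∑Fin-single : ∀ n (i : Fin n) x → ∑Fin n (single i x) ≡ x
  ∑Fin-single (suc n) zero x = trans (∑Fin-suc n (single zero x))
    (trans (cong (x +_) (sumL-0 (allFin n))) (+-identityʳ x))
  ∑Fin-single (suc n) (suc i) x = trans (∑Fin-suc n (single (suc i) x))
    (trans (+-identityˡ _) (trans (sumL-cong (allFin n) (λ j → single-suc i j x)) (∑Fin-single n i x)))

  module Bookkeeping {d : ℕ} (S : System d) (N : ℕ) where
    open System S using (nL; nR)
    open SystemGraph S using (graph; edge)
    open SystemForests S

    E : Set
    E = Fin (nL ℕ.* d)

    open Run {E} left Fin._≟_ N

    acc : Observed E N → Subset (nL ℕ.* d)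
    acc []                = ∅
    acc ((f , c , b) ∷ h) = if b then ⁅ f ⁆ ∪ acc h else acc h

    Feasible : Observed E N → E → Set
    Feasible h f = Acyclic graph (⁅ f ⁆ ∪ acc h)

    chosen⇒accepted : ∀ u h {c} → chosen (state u h) ≡ just c → ∃ λ f → f ∈ˢ acc h × left f ≡ u
    chosen⇒accepted u ((f , c , b) ∷ h) eq with left f Fin.≟ u
    chosen⇒accepted u ((f , c , false) ∷ h) eq | no _ = chosen⇒accepted u h eq
    chosen⇒accepted u ((f , c , true) ∷ h) eq | no _ with chosen⇒accepted u h eq
    ... | f′ , f′∈ , l = f′ , q⊆p∪q ⁅ f ⁆ (acc h) f′∈ , l
    chosen⇒accepted u ((f , c , true) ∷ h) eq | yes l = f , p⊆p∪q (acc h) (x∈⁅x⁆ f) , l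
    chosen⇒accepted u ((f , c , false) ∷ h) eq | yes l with chosen (state u h) in eq′
    ... | just _ = chosen⇒accepted u h eq′

    chosen≤best : ∀ u h {c} → chosen (state u h) ≡ just c → toℕ c ℕ.≤ best (state u h)
    chosen≤best u ((f , c , b) ∷ h) eq with left f Fin.≟ u
    ... | no _ = chosen≤best u h eq
    ... | yes _ with chosen (state u h) in eq′
    chosen≤best u ((f , c , b) ∷ h) refl | yes _ | just c′ = ℕ.≤-trans (chosen≤best u h eq′) (ℕ.m≤n⊔m (toℕ c) (best (state u h)))
    chosen≤best u ((f , c , true) ∷ h) refl | yes _ | nothing = ℕ.m≤m⊔n (toℕ c) (best (state u h))

    occupied : Maybe (Fin N) → ℕ
    occupied (just _) = 1
    occupied nothing  = 0

    extras : Observed E N → ℕ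
    extras []                = 0
    extras ((f , c , b) ∷ h) = (if b then occupied (chosen (state (left f) h)) else 0) ℕ.+ extras h

    module Weights (wt : ℕ → ℚ) (0≤wt : ∀ c → 0ℚ ≤ wt c) (W : ℚ) (wt≤W : ∀ (c : Fin N) → wt (toℕ c) ≤ W) (w : E → Fin N) where

      contribution : Subset (nL ℕ.* d) → E → ℚ
      contribution A f = if lookup A f then wt (toℕ (w f)) else 0ℚ

      weightOf : Subset (nL ℕ.* d) → ℚ
      weightOf A = ∑Fin (nL ℕ.* d) (contribution A)

      0≤contribution : ∀ A f → 0ℚ ≤ contribution A f
      0≤contribution A f with lookup A f
      ... | true  = 0≤wt (toℕ (w f))
      ... | false = ≤-refl

      weightOf-∅ : weightOf ∅ ≡ 0ℚ
      weightOf-∅ = trans (sumL-cong (allFin _) (λ f → cong (λ b → if b then wt (toℕ (w f)) else 0ℚ) (Vec.lookup-replicate f outside)))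
        (sumL-0 (allFin (nL ℕ.* d)))

      weightOf-insert : ∀ f A → weightOf (⁅ f ⁆ ∪ A) ≤ wt (toℕ (w f)) + weightOf A
      weightOf-insert f A = begin
        weightOf (⁅ f ⁆ ∪ A)  ≤⟨ sumL-mono (allFin _) pointwise ⟩
        ∑Fin _ (λ g → single f x g + contribution A g)  ≡⟨ sumL-+ (allFin _) (single f x) (contribution A) ⟩
        ∑Fin _ (single f x) + weightOf A  ≡⟨ cong (_+ weightOf A) (∑Fin-single _ f x) ⟩
        x + weightOf A  ∎
        where
        open ≤-Reasoning
        x = wt (toℕ (w f))
        same : ∀ g → f ≢ g → lookup (⁅ f ⁆ ∪ A) g ≡ lookup A g
        same g f≢g with g ∈? A | g ∈? (⁅ f ⁆ ∪ A)
        ... | yes p | yes q = trans (Vec.[]=⇒lookup q) (sym (Vec.[]=⇒lookup p))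
        ... | yes p | no ¬q = contradiction (q⊆p∪q ⁅ f ⁆ A p) ¬q
        ... | no ¬p | yes q = [ (λ g∈ → contradiction (sym (x∈⁅y⁆⇒x≡y f g∈)) f≢g) , (λ g∈ → contradiction g∈ ¬p) ]′ (x∈p∪q⁻ ⁅ f ⁆ A q)
        ... | no ¬p | no ¬q = trans (out (⁅ f ⁆ ∪ A) ¬q) (sym (out A ¬p))
          where
          out : ∀ B → g ∉ˢ B → lookup B g ≡ outside
          out B g∉ with lookup B g in eq
          ... | true  = contradiction (Vec.lookup⇒[]= g B eq) g∉
          ... | false = refl
        pointwise : ∀ g → contribution (⁅ f ⁆ ∪ A) g ≤ single f x g + contribution A g
        pointwise g with f Fin.≟ g
        ... | no f≢g = ≤-reflexive (trans (cong (λ b → if b then wt (toℕ (w g)) else 0ℚ) (same g f≢g)) (sym (+-identityˡ _)))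
        ... | yes refl with lookup (⁅ f ⁆ ∪ A) f
        ...   | true  = ≤-diff (contribution A f) (0≤contribution A f) refl
        ...   | false = 0≤+ (0≤wt (toℕ (w f))) (0≤contribution A f)

      value : Maybe (Fin N) → ℚ
      value = maybe (λ c → wt (toℕ c)) 0ℚ

      gain : Fin nL → Observed E N → ℚ
      gain u h = value (chosen (state u h))

      0≤W : Fin N → 0ℚ ≤ W
      0≤W c = ≤-trans (0≤wt (toℕ c)) (wt≤W c)

      gains : Observed E N → ℚ
      gains h = ∑Fin nL (λ u → gain u h)

      gain-reject : ∀ u f c h → gain u ((f , c , false) ∷ h) ≡ gain u h
      gain-reject u f c h with left f Fin.≟ u
      ... | no _ = refl
      ... | yes _ with chosen (state u h)
      ...   | just _  = refl
      ...   | nothing = refl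

      gain-mono : ∀ u f c h → gain u h ≤ gain u ((f , c , true) ∷ h)
      gain-mono u f c h with left f Fin.≟ u
      ... | no _ = ≤-refl
      ... | yes _ with chosen (state u h)
      ...   | just _  = ≤-refl
      ...   | nothing = 0≤wt (toℕ c)

      gain-first : ∀ u f c h → chosen (state (left f) h) ≡ nothing →
                   single (left f) (wt (toℕ c)) u + gain u h ≤ gain u ((f , c , true) ∷ h)
      gain-first u f c h eq with left f Fin.≟ u
      ... | no _ = ≤-reflexive (+-identityˡ (gain u h))
      ... | yes refl rewrite eq = ≤-reflexive (+-identityʳ (wt (toℕ c)))

      -- The first edge at its left vertex is credited to that vertex. Any later one is paid for by
      -- `W`, and such edges are counted in `extras`.
      gains-accept : ∀ f c h → wt (toℕ c) + gains h ≤ gains ((f , c , true) ∷ h) + W * ι (occupied (chosen (state (left f) h)))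
      gains-accept f c h with chosen (state (left f) h) in eq
      ... | nothing = begin
        wt (toℕ c) + gains h  ≡⟨ cong (_+ gains h) (∑Fin-single nL (left f) (wt (toℕ c))) ⟨
        ∑Fin nL (single (left f) (wt (toℕ c))) + gains h  ≡⟨ sumL-+ (allFin nL) (single (left f) (wt (toℕ c))) (λ u → gain u h) ⟨
        ∑Fin nL (λ u → single (left f) (wt (toℕ c)) u + gain u h)  ≤⟨ sumL-mono (allFin nL) (λ u → gain-first u f c h eq) ⟩
        gains ((f , c , true) ∷ h)  ≡⟨ solve 2 (λ g w → g := g :+ w :* con 0ℚ) refl (gains ((f , c , true) ∷ h)) W ⟩
        gains ((f , c , true) ∷ h) + W * 0ℚ  ∎
        where
        open ≤-Reasoning
        open +-*-Solver
      ... | just _ = begin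
        wt (toℕ c) + gains h  ≤⟨ +-mono-≤ (wt≤W c) (sumL-mono (allFin nL) (λ u → gain-mono u f c h)) ⟩
        W + gains ((f , c , true) ∷ h)  ≡⟨ solve 2 (λ g w → w :+ g := g :+ w :* (con 1ℚ :+ con 0ℚ)) refl (gains ((f , c , true) ∷ h)) W ⟩
        gains ((f , c , true) ∷ h) + W * (1ℚ + 0ℚ)  ∎
        where
        open ≤-Reasoning
        open +-*-Solver

      -- Maintained only where accepted edges are feasible, that is, away from events of probability
      -- 0. `fresh` supplies the condition of `further-edge` that the new edge is not yet accepted;
      -- `components` limits `extras` by the number of right vertices.
      record Invariant (h : Observed E N) (fs : List E) : Set where
        field
          unique     : Unique fs
          fresh      : ∀ f → f ∈ fs → f ∉ˢ acc h
          components : Components (acc h) (extras h)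
          bound      : weightOf (acc h) ≤ gains h + W * ι (extras h)

      invariant-[] : ∀ {fs} → Unique fs → Invariant [] fs
      invariant-[] uniq = record { unique = uniq ; fresh = λ _ _ → ∉⊥ ; components = no-edges ; bound = start }
        where
        start : weightOf ∅ ≤ gains [] + W * 0ℚ
        start = ≤-reflexive (trans weightOf-∅ (sym (trans (cong₂ _+_ (sumL-0 (allFin nL)) (*-zeroʳ W)) refl)))

      invariant-step : ∀ h f fs b → Invariant h (f ∷ fs) → (b ≡ true → Feasible h f) → Invariant ((f , w f , b) ∷ h) fs
      invariant-step h f fs false inv _ = record
        { unique = tail unique ; fresh = λ g g∈ → fresh g (there g∈) ; components = components
        ; bound = subst (λ z → weightOf (acc h) ≤ z + W * ι (extras h)) (sym (sumL-cong (allFin nL) (λ u → gain-reject u f (w f) h))) bound }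
        where
        open Invariant inv
        tail : Unique (f ∷ fs) → Unique fs
        tail (_ ∷ u) = u
      invariant-step h f fs true inv ok with Invariant.unique inv
      ... | f∉fs ∷ uniq = record
        { unique = uniq
        ; fresh = λ g g∈ g∈acc → [ (λ g∈f → All-lookup f∉fs g∈ (sym (x∈⁅y⁆⇒x≡y f g∈f))) , fresh g (there g∈) ]′ (x∈p∪q⁻ ⁅ f ⁆ (acc h) g∈acc)
        ; components = grown
        ; bound = bound′ }
        where
        open Invariant inv
        grown : Components (⁅ f ⁆ ∪ acc h) (occupied (chosen (state (left f) h)) ℕ.+ extras h)
        grown with chosen (state (left f) h) in eq
        ... | nothing = first-edge f components
        ... | just c with chosen⇒accepted (left f) h eq
        ... | f′ , f′∈ , same = further-edge f f′ (fresh f (here refl)) f′∈ same (ok refl) components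
        open ≤-Reasoning
        open +-*-Solver
        o = occupied (chosen (state (left f) h))
        h′ = (f , w f , true) ∷ h
        bound′ : weightOf (⁅ f ⁆ ∪ acc h) ≤ gains h′ + W * ι (o ℕ.+ extras h)
        bound′ = begin
          weightOf (⁅ f ⁆ ∪ acc h)  ≤⟨ weightOf-insert f (acc h) ⟩
          wt (toℕ (w f)) + weightOf (acc h)  ≤⟨ +-monoʳ-≤ (wt (toℕ (w f))) bound ⟩
          wt (toℕ (w f)) + (gains h + W * ι (extras h))  ≡⟨ +-assoc (wt (toℕ (w f))) (gains h) (W * ι (extras h)) ⟨
          wt (toℕ (w f)) + gains h + W * ι (extras h)  ≤⟨ +-monoˡ-≤ (W * ι (extras h)) (gains-accept f (w f) h) ⟩
          gains h′ + W * ι o + W * ι (extras h)  ≡⟨ solve 4 (λ g w o x → g :+ w :* o :+ w :* x := g :+ w :* (o :+ x)) refl (gains h′) W (ι o) (ι (extras h)) ⟩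
          gains h′ + W * (ι o + ι (extras h))  ≡⟨ cong (λ z → gains h′ + W * z) (ι-+ o (extras h)) ⟨
          gains h′ + W * ι (o ℕ.+ extras h)  ∎

      invariant-end : 0ℚ ≤ W → ∀ h → Invariant h [] → weightOf (acc h) ≤ gains h + W * ι nR
      invariant-end 0≤W h inv = ≤-trans bound (+-monoʳ-≤ (gains h) (*-monoˡ W 0≤W (ι-mono (ℕ.≤-trans (ℕ.m≤n+m (extras h) _) (Components.live-size components)))))
        where open Invariant inv

-- The product law and the bound for rational algorithms.

module Hardness where
  open import Data.Fin using (_↑ˡ_; _↑ʳ_)
  open import Data.List.Membership.Propositional using (_∈_)
  open import Data.List.Membership.Propositional.Properties using (∈-allFin)
  open import Data.List.Membership.Propositional.Properties.WithK using (unique∧set⇒bag)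
  open import Data.List.Relation.Binary.BagAndSetEquality using (∼bag⇒↭)
  open import Data.List.Relation.Binary.Permutation.Propositional using (_↭_; ↭-sym; ↭⇒↭ₛ)
  open import Data.List.Relation.Binary.Permutation.Propositional.Properties using (∈-resp-↭; ↭-length)
  import Data.List.Relation.Binary.Permutation.Setoid.Properties as Permutationₛ
  open import Data.List.Relation.Unary.All using (tabulate) renaming (lookup to All-lookup)
  open import Data.List.Relation.Unary.AllPairs using ([]; _∷_)
  open import Data.List.Relation.Unary.Any using (here; there)
  open import Data.List.Relation.Unary.Unique.Propositional using (Unique)
  open import Data.List.Relation.Unary.Unique.Propositional.Properties using (allFin⁺)
  open import Data.Rational hiding (1/_)
  open import Data.Rational.Properties hiding (_≟_)
  open import Data.Rational.Solver using (module +-*-Solver)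
  open import Data.Fin.Subset using (Subset) renaming (_∈_ to _∈ˢ_)
  open import Data.Unit using (⊤; tt)
  open import Data.Vec using (lookup; _[_]≔_; replicate)
  open import Function using (mk⇔)
  open import Defs using (Acyclic)
  open Rationals
  open Harmonic
  open Stopping
  open Densities
  open Online
  open Expectation
  open Covers using (System; module SystemGraph)
  open Forests using (module SystemForests)
  open Accounting

  Unique-resp-↭ : ∀ {A : Set} {xs ys : List A} → xs ↭ ys → Unique xs → Unique ys
  Unique-resp-↭ {A} p = Permutationₛ.Unique-resp-↭ (setoid A) (↭⇒↭ₛ p)

  product : ∀ {A : Set} {n} → (A → ℚ) → Vec A n → ℚ
  product F []      = 1ℚ
  product F (x ∷ v) = F x * product F v

  ∑Fin-+ : ∀ m n (f : Fin (m ℕ.+ n) → ℚ) → ∑Fin (m ℕ.+ n) f ≡ ∑Fin m (λ i → f (i ↑ˡ n)) + ∑Fin n (λ j → f (m ↑ʳ j))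
  ∑Fin-+ zero    n f = sym (+-identityˡ _)
  ∑Fin-+ (suc m) n f = begin
    ∑Fin (suc m ℕ.+ n) f  ≡⟨ ∑Fin-suc (m ℕ.+ n) f ⟩
    f zero + ∑Fin (m ℕ.+ n) (f ∘ suc)  ≡⟨ cong (f zero +_) (∑Fin-+ m n (f ∘ suc)) ⟩
    f zero + (∑Fin m (λ i → f (suc (i ↑ˡ n))) + ∑Fin n (λ j → f (suc (m ↑ʳ j))))  ≡⟨ +-assoc (f zero) _ _ ⟨
    f zero + ∑Fin m (λ i → f (suc (i ↑ˡ n))) + ∑Fin n (λ j → f (suc (m ↑ʳ j)))  ≡⟨ cong (_+ ∑Fin n (λ j → f (suc (m ↑ʳ j)))) (∑Fin-suc m (λ i → f (i ↑ˡ n))) ⟨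
    ∑Fin (suc m) (λ i → f (i ↑ˡ n)) + ∑Fin n (λ j → f (suc (m ↑ʳ j)))  ∎
    where open ≡-Reasoning

  ∑Fin-combine : ∀ m n (f : Fin (m ℕ.* n) → ℚ) → ∑Fin (m ℕ.* n) f ≡ ∑Fin m (λ i → ∑Fin n (λ j → f (combine i j)))
  ∑Fin-combine zero    n f = refl
  ∑Fin-combine (suc m) n f = trans (∑Fin-+ n (m ℕ.* n) f)
    (trans (cong (∑Fin n (λ j → f (j ↑ˡ (m ℕ.* n))) +_) (∑Fin-combine m n (λ i → f (n ↑ʳ i))))
      (sym (∑Fin-suc m (λ i → ∑Fin n (λ j → f (combine i j))))))

  neg-cancel-≤ : ∀ {a b} → - b ≤ - a → a ≤ b
  neg-cancel-≤ {a} {b} le = subst₂ _≤_ (neg-neg a) (neg-neg b) (neg-antimono-≤ le)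
    where
    open +-*-Solver
    neg-neg : ∀ a → - - a ≡ a
    neg-neg = solve 1 (λ a → :- (:- a) := a) refl

  module ProductMeasure {A : Set} (l : List A) (a₀ : A) (F : A → ℚ) (0≤F : ∀ x → 0ℚ ≤ F x) (∑F : sumL l F ≡ 1ℚ) where

    0≤product : ∀ {n} (v : Vec A n) → 0ℚ ≤ product F v
    0≤product []      = 0≤1
    0≤product (x ∷ v) = 0≤* (0≤F x) (0≤product v)

    ∑product : ∀ n → sumL (vecs l n) (product F) ≡ 1ℚ
    ∑product zero    = refl
    ∑product (suc n) = begin
      sumL (vecs l (suc n)) (product F)  ≡⟨ sumL-vecs l n (product F) ⟩
      sumL l (λ x → sumL (vecs l n) (λ v → F x * product F v))  ≡⟨ sumL-cong l (λ x → sumL-* (vecs l n) (F x) (product F)) ⟩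
      sumL l (λ x → F x * sumL (vecs l n) (product F))  ≡⟨ sumL-cong l (λ x → trans (cong (F x *_) (∑product n)) (*-identityʳ (F x))) ⟩
      sumL l F  ≡⟨ ∑F ⟩
      1ℚ  ∎
      where open ≡-Reasoning

    mean-≤ : ∀ {n} (f : Vec A n → ℚ) β → (∀ v → f v ≤ β) → sumL (vecs l n) (λ v → product F v * f v) ≤ β
    mean-≤ {n} f β le = begin
      sumL (vecs l n) (λ v → product F v * f v)  ≤⟨ sumL-mono (vecs l n) (λ v → *-monoˡ (product F v) (0≤product v) (le v)) ⟩
      sumL (vecs l n) (λ v → product F v * β)  ≡⟨ sumL-*ʳ (vecs l n) β (product F) ⟩
      sumL (vecs l n) (product F) * β  ≡⟨ trans (cong (_* β) (∑product n)) (*-identityˡ β) ⟩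
      β  ∎
      where open ≤-Reasoning

    -- Conditioning on all coordinates but `u`. The element `a₀` fills the place that is overwritten
    -- anyway.
    marginal-≤ : ∀ {n} (u : Fin n) (f : Vec A n → ℚ) β → (∀ v → sumL l (λ x → F x * f (v [ u ]≔ x)) ≤ β) →
                 sumL (vecs l n) (λ v → product F v * f v) ≤ β
    marginal-≤ {suc n} zero f β le = begin
      sumL (vecs l (suc n)) (λ v → product F v * f v)
        ≡⟨ sumL-vecs l n (λ v → product F v * f v) ⟩
      sumL l (λ x → sumL (vecs l n) (λ v → F x * product F v * f (x ∷ v)))
        ≡⟨ sumL-swap l (vecs l n) (λ x v → F x * product F v * f (x ∷ v)) ⟩
      sumL (vecs l n) (λ v → sumL l (λ x → F x * product F v * f (x ∷ v)))
        ≡⟨ sumL-cong (vecs l n) (λ v → trans (sumL-cong l (λ x → solve 3 (λ a b c → a :* b :* c := b :* (a :* c)) refl (F x) (product F v) (f (x ∷ v))))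
             (sumL-* l (product F v) (λ x → F x * f (x ∷ v)))) ⟩
      sumL (vecs l n) (λ v → product F v * sumL l (λ x → F x * f (x ∷ v)))
        ≤⟨ mean-≤ (λ v → sumL l (λ x → F x * f (x ∷ v))) β (λ v → le (a₀ ∷ v)) ⟩
      β ∎
      where
      open ≤-Reasoning
      open +-*-Solver
    marginal-≤ {suc n} (suc u) f β le = begin
      sumL (vecs l (suc n)) (λ v → product F v * f v)
        ≡⟨ sumL-vecs l n (λ v → product F v * f v) ⟩
      sumL l (λ x → sumL (vecs l n) (λ v → F x * product F v * f (x ∷ v)))
        ≡⟨ sumL-cong l (λ x → trans (sumL-cong (vecs l n) (λ v → *-assoc (F x) (product F v) (f (x ∷ v))))
             (sumL-* (vecs l n) (F x) (λ v → product F v * f (x ∷ v)))) ⟩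
      sumL l (λ x → F x * sumL (vecs l n) (λ v → product F v * f (x ∷ v)))
        ≤⟨ sumL-mono l (λ x → *-monoˡ (F x) (0≤F x) (marginal-≤ u (λ v → f (x ∷ v)) β (λ v → le (x ∷ v)))) ⟩
      sumL l (λ x → F x * β)
        ≡⟨ trans (sumL-*ʳ l β F) (trans (cong (_* β) ∑F) (*-identityˡ β)) ⟩
      β ∎
      where open ≤-Reasoning

  module Orders {d : ℕ} (S : System d) where
    open System S using (nL)
    open SystemGraph S using (edge; edge-injective)
    open SystemForests S using (left)

    coordinate : Fin (nL ℕ.* d) → Fin d
    coordinate f = proj₂ (edge f)

    module _ (N : ℕ) (u : Fin nL) where
      open Coordinates left Fin._≟_ N coordinate u using () renaming (coordinates to coords)

      ∈-coords⁻ : ∀ fs {i} → i ∈ coords fs → ∃ λ f → f ∈ fs × left f ≡ u × coordinate f ≡ i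
      ∈-coords⁻ (f ∷ fs) i∈ with left f Fin.≟ u
      ∈-coords⁻ (f ∷ fs) (here refl) | yes l = f , here refl , l , refl
      ∈-coords⁻ (f ∷ fs) (there i∈) | yes l with ∈-coords⁻ fs i∈
      ... | g , g∈ , e = g , there g∈ , e
      ∈-coords⁻ (f ∷ fs) i∈ | no _ with ∈-coords⁻ fs i∈
      ... | g , g∈ , e = g , there g∈ , e

      ∈-coords⁺ : ∀ fs {f} → f ∈ fs → left f ≡ u → coordinate f ∈ coords fs
      ∈-coords⁺ (f ∷ fs) f∈ l with left f Fin.≟ u
      ∈-coords⁺ (f ∷ fs) (here refl) l | yes _ = here refl
      ∈-coords⁺ (f ∷ fs) (here refl) l | no ¬l = contradiction l ¬l
      ∈-coords⁺ (f ∷ fs) (there f∈) l | yes _ = there (∈-coords⁺ fs f∈ l)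
      ∈-coords⁺ (f ∷ fs) (there f∈) l | no _ = ∈-coords⁺ fs f∈ l

      coords-unique : ∀ fs → Unique fs → Unique (coords fs)
      coords-unique []       _ = []
      coords-unique (f ∷ fs) (f∉ ∷ uniq) with left f Fin.≟ u
      ... | no _  = coords-unique fs uniq
      ... | yes l = tabulate (λ i∈ eq → new i∈ eq) ∷ coords-unique fs uniq
        where
        new : ∀ {i} → i ∈ coords fs → coordinate f ≢ i
        new i∈ eq with ∈-coords⁻ fs i∈
        ... | g , g∈ , l′ , eq′ = All-lookup f∉ g∈ (edge-injective (cong₂ _,_ (trans l (sym l′)) (trans eq (sym eq′))))

      coords-↭ : ∀ {fs} → fs ↭ allFin (nL ℕ.* d) → coords fs ↭ allFin d
      coords-↭ {fs} p = ∼bag⇒↭ (unique∧set⇒bag (coords-unique fs (Unique-resp-↭ (↭-sym p) (allFin⁺ (nL ℕ.* d)))) (allFin⁺ d)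
        (λ {i} → mk⇔ (λ _ → ∈-allFin i) (λ _ → subst (_∈ coords fs) (cong proj₂ (Fin.remQuot-combine u i))
          (∈-coords⁺ fs (∈-resp-↭ (↭-sym p) (∈-allFin (combine u i))) (cong proj₁ (Fin.remQuot-combine u i))))))

  module HardInstance
    (d′ N : ℕ) (v : ℕ → ℚ) (SV : StoppingValue d′ v)
    (wt iw : ℕ → ℚ) (1≤wt : ∀ c → 1ℚ ≤ wt c) (0≤iw : ∀ c → 0ℚ ≤ iw c) (iw*wt : ∀ c → iw c * wt c ≡ 1ℚ)
    (κ : ℚ) (0≤κ : 0ℚ ≤ κ) (gap : ∀ {c c′} → c ℕ.< c′ → wt c ≤ κ * wt c′)
    (W : ℚ) (wt≤W : ∀ (c : Fin N) → wt (toℕ c) ≤ W) (c₀ : Fin N) (S : System (suc d′)) where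

    open System S using (nL; nR)
    open SystemGraph S using (graph; edge-injective)
    open SystemForests S using (left; star-acyclic)
    open Orders S
    open Bookkeeping S N using (acc; Feasible; chosen≤best)
    open Run left Fin._≟_ N using (state; degree; module Algorithmic)

    d : ℕ
    d = suc d′

    X : Set
    X = Vec (Fin N) d

    x₀ : X
    x₀ = replicate d c₀

    xs : List X
    xs = vecs (allFin N) d

    0≤wt : ∀ c → 0ℚ ≤ wt c
    0≤wt c = ≤-trans 0≤1 (1≤wt c)

    -- `F` is `P` divided by the maximal weight. In the product of the laws `F`, an amount earned at
    -- a vertex in units of its maximum is again measured by `P`, the law for which the secretary
    -- bound holds.
    P F : X → ℚ
    P x = density N d (maxV x)
    F x = P x * iw (maxV x)

    T Φ : ℚ
    T = totalMass N d
    Φ = sumL xs F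

    0≤P : ∀ x → 0ℚ ≤ P x
    0≤P x = 0≤density N d (maxV x)

    0≤F : ∀ x → 0ℚ ≤ F x
    0≤F x = 0≤* (0≤P x) (0≤iw (maxV x))

    Fwt : ∀ x → F x * wt (maxV x) ≡ P x
    Fwt x = trans (*-assoc (P x) (iw (maxV x)) (wt (maxV x))) (trans (cong (P x *_) (iw*wt (maxV x))) (*-identityʳ (P x)))

    F≤P : ∀ x → F x ≤ P x
    F≤P x = subst₂ _≤_ (*-identityʳ (F x)) (Fwt x) (*-monoˡ (F x) (0≤F x) (1≤wt (maxV x)))

    Φ≤T : Φ ≤ T
    Φ≤T = sumL-mono xs F≤P

    code : Vec X nL → Fin (nL ℕ.* d) → Fin N
    code w f = lookup (lookup w (left f)) (coordinate f)

    module _ (w : Vec X nL) (u : Fin nL) where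

      code-yes : ∀ x f → left f ≡ u → code (w [ u ]≔ x) f ≡ lookup x (coordinate f)
      code-yes x f refl = cong (λ y → lookup y (coordinate f)) (Vec.lookup∘update (left f) w x)

      code-no : ∀ x f → left f ≢ u → code (w [ u ]≔ x) f ≡ code w f
      code-no x f ≢u = cong (λ y → lookup y (coordinate f)) (Vec.lookup∘update′ ≢u w x)

    argmax : ∀ {n} (x : Vec (Fin N) (suc n)) → ∃ λ i → toℕ (lookup x i) ≡ maxV x
    argmax (c ∷ []) = zero , sym (ℕ.⊔-identityʳ (toℕ c))
    argmax (c ∷ x@(_ ∷ _)) with argmax x | ℕ.≤-total (maxV x) (toℕ c)
    ... | i , eq | inj₁ m≤c = zero , sym (ℕ.m≥n⇒m⊔n≡m m≤c)
    ... | i , eq | inj₂ c≤m = suc i , trans eq (sym (ℕ.m≤n⇒m⊔n≡n c≤m))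

    wt-max≤W : ∀ (x : X) → wt (maxV x) ≤ W
    wt-max≤W x with argmax x
    ... | i , eq = subst (λ c → wt c ≤ W) eq (wt≤W (lookup x i))

    T≤ΦW : T ≤ Φ * W
    T≤ΦW = subst (T ≤_) (sumL-*ʳ xs W F)
      (sumL-mono xs (λ x → subst (_≤ F x * W) (Fwt x) (*-monoˡ (F x) (0≤F x) (wt-max≤W x))))

    weightOf : (Fin (nL ℕ.* d) → Fin N) → Subset (nL ℕ.* d) → ℚ
    weightOf w = Bookkeeping.Weights.weightOf S N wt 0≤wt W wt≤W w

    benefit : Vec X nL → ℚ
    benefit w = ∑Fin nL (λ u → wt (maxV (lookup w u)))

    star : Vec X nL → Subset (nL ℕ.* d)
    star w = Data.Vec.tabulate (λ f → does (proj₁ (argmax (lookup w (left f))) Fin.≟ coordinate f))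

    ∈-star : ∀ w {f} → f ∈ˢ star w → coordinate f ≡ proj₁ (argmax (lookup w (left f)))
    ∈-star w {f} f∈ with trans (sym (Vec.lookup∘tabulate _ f)) (Vec.[]=⇒lookup f∈)
    ... | eq with proj₁ (argmax (lookup w (left f))) Fin.≟ coordinate f
    ...   | yes i≡ = sym i≡

    star-forest : ∀ w → Acyclic graph (star w)
    star-forest w = star-acyclic (λ f f′ f∈ f′∈ same → edge-injective (cong₂ _,_ same
      (trans (∈-star w f∈) (trans (cong (λ u → proj₁ (argmax (lookup w u))) same) (sym (∈-star w f′∈))))))

    weightOf-star : ∀ w → weightOf (code w) (star w) ≡ benefit w
    weightOf-star w = trans (∑Fin-combine nL d _) (sumL-cong (allFin nL) (λ u →
      trans (sumL-cong (allFin d) (λ i → at u i)) (trans (∑Fin-single d (proj₁ (argmax (lookup w u))) _) (cong wt (proj₂ (argmax (lookup w u)))))))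
      where
      at : ∀ u i → (if lookup (star w) (combine u i) then wt (toℕ (code w (combine u i))) else 0ℚ)
                   ≡ single (proj₁ (argmax (lookup w u))) (wt (toℕ (lookup (lookup w u) (proj₁ (argmax (lookup w u)))))) i
      at u i = trans (cong₂ (λ b e → if b then wt (toℕ (lookup (lookup w (proj₁ e)) (proj₂ e))) else 0ℚ)
          (trans (Vec.lookup∘tabulate _ (combine u i))
            (cong (λ e → does (proj₁ (argmax (lookup w (proj₁ e))) Fin.≟ proj₂ e)) (Fin.remQuot-combine u i))) (Fin.remQuot-combine u i))
        (pick (proj₁ (argmax (lookup w u))))
        where
        pick : ∀ j → (if does (j Fin.≟ i) then wt (toℕ (lookup (lookup w u) i)) else 0ℚ) ≡ single j (wt (toℕ (lookup (lookup w u) j))) i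
        pick j with j Fin.≟ i
        ... | yes refl = refl
        ... | no _     = refl

    configs : List (Vec X nL)
    configs = vecs xs nL

    module Normalised (Φ⁻¹ : ℚ) (0≤Φ⁻¹ : 0ℚ ≤ Φ⁻¹) (Φ⁻¹Φ : Φ⁻¹ * Φ ≡ 1ℚ) where

      open ProductMeasure xs x₀ (λ x → Φ⁻¹ * F x) (λ x → 0≤* 0≤Φ⁻¹ (0≤F x)) (trans (sumL-* xs Φ⁻¹ F) Φ⁻¹Φ) public

      law : Vec X nL → ℚ
      law = product (λ x → Φ⁻¹ * F x)

      0≤law : ∀ w → 0ℚ ≤ law w
      0≤law = 0≤product

      Z : ℚ
      Z = sumL configs (λ w → law w * benefit w)

      Z≥ : ι nL * (Φ⁻¹ * T) ≤ Z
      Z≥ = begin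
        ι nL * (Φ⁻¹ * T)
          ≡⟨ trans (sumL-const (allFin nL) (Φ⁻¹ * T)) (cong (λ n → ι n * (Φ⁻¹ * T)) (List.length-tabulate {n = nL} (λ i → i))) ⟨
        ∑Fin nL (λ _ → Φ⁻¹ * T)
          ≤⟨ sumL-mono (allFin nL) vertex ⟩
        ∑Fin nL (λ u → sumL configs (λ w → law w * wt (maxV (lookup w u))))
          ≡⟨ sumL-swap (allFin nL) configs (λ u w → law w * wt (maxV (lookup w u))) ⟩
        sumL configs (λ w → ∑Fin nL (λ u → law w * wt (maxV (lookup w u))))
          ≡⟨ sumL-cong configs (λ w → sumL-* (allFin nL) (law w) (λ u → wt (maxV (lookup w u)))) ⟩
        Z ∎
        where
        open ≤-Reasoning
        open +-*-Solver
        vertex : ∀ u → Φ⁻¹ * T ≤ sumL configs (λ w → law w * wt (maxV (lookup w u)))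
        -- `marginal-≤` bounds from above only; the negated weights turn it into the lower bound
        -- wanted here.
        vertex u = neg-cancel-≤ (subst (_≤ - (Φ⁻¹ * T))
          (trans (sumL-cong configs (λ w → solve 2 (λ a b → a :* (:- b) := (:- con 1ℚ) :* (a :* b)) refl (law w) (wt (maxV (lookup w u)))))
            (trans (sumL-* configs (- 1ℚ) (λ w → law w * wt (maxV (lookup w u)))) (solve 1 (λ a → (:- con 1ℚ) :* a := :- a) refl (sumL configs (λ w → law w * wt (maxV (lookup w u)))))))
          (marginal-≤ u (λ w → - wt (maxV (lookup w u))) (- (Φ⁻¹ * T)) (λ w → ≤-reflexive
            (trans (sumL-cong xs (λ x → trans (cong (λ y → Φ⁻¹ * F x * - wt (maxV y)) (Vec.lookup∘update u w x))
                (trans (solve 3 (λ p f w → p :* f :* (:- w) := (:- p) :* (f :* w)) refl Φ⁻¹ (F x) (wt (maxV x))) (cong (- Φ⁻¹ *_) (Fwt x)))))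
              (trans (sumL-* xs (- Φ⁻¹) P) (solve 2 (λ p t → (:- p) :* t := :- (p :* t)) refl Φ⁻¹ T))))))

    gain : Fin nL → Observed (Fin (nL ℕ.* d)) N → ℚ
    gain u h = maybe (λ c → wt (toℕ c)) 0ℚ (chosen (state u h))

    module Player (prob : Observed (Fin (nL ℕ.* d)) N → Fin (nL ℕ.* d) → Fin N → ℚ)
      (0≤prob : ∀ h f c → 0ℚ ≤ prob h f c) (prob≤1 : ∀ h f c → prob h f c ≤ 1ℚ)
      (feasible? : ∀ h f → Dec (Feasible h f)) (prob-0 : ∀ h f c → ¬ Feasible h f → prob h f c ≡ 0ℚ) where

      open Algorithmic prob 0≤prob prob≤1 using (expect; resample; module Secretary)
      open ExpectProperties left Fin._≟_ N prob 0≤prob prob≤1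

      module _ (w : Vec X nL) (u : Fin nL) (fs : List (Fin (nL ℕ.* d))) (p : fs ↭ allFin (nL ℕ.* d)) where
        open Coordinates left Fin._≟_ N coordinate u using (coordinates; degree-coordinates)
        open Resampling left Fin._≟_ N prob 0≤prob prob≤1 coordinate u
        open Secretary d′ v SV u (code w) using (win; secretary-bound)

        coordinates-↭ : coordinates fs ↭ allFin d
        coordinates-↭ = coords-↭ N u p

        module _ (x : X) where

          -- Once no coordinates are left, this identifies the maximum seen with the maximum of the
          -- whole vector.
          MaxKnown : Observed (Fin (nL ℕ.* d)) N → List (Fin (nL ℕ.* d)) → Set
          MaxKnown h gs = best (state u h) ℕ.⊔ maxAt x (coordinates gs) ≡ maxV x

          maxKnown-step : ∀ h f gs b → MaxKnown h (f ∷ gs) → (b ≡ true → ⊤) → MaxKnown ((f , code (w [ u ]≔ x) f , b) ∷ h) gs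
          maxKnown-step h f gs b inv _ with left f Fin.≟ u
          ... | no _  = inv
          ... | yes l = trans (cong (λ c → toℕ c ℕ.⊔ m ℕ.⊔ r) (code-yes w u x f l))
            (trans (cong (ℕ._⊔ r) (ℕ.⊔-comm c m)) (trans (ℕ.⊔-assoc m c r) inv))
            where
            m = best (state u h)
            r = maxAt x (coordinates gs)
            c = toℕ (lookup x (coordinate f))

          -- A chosen code below the maximum weighs at most `κ` times the maximal weight, and by
          -- `Fwt` this costs no more than `κ * P x`. Picking the maximum earns exactly `P x`, the
          -- case recorded by `win`.
          settle : ∀ h → MaxKnown h [] → F x * gain u h ≤ win (state u h) + κ * P x
          settle h inv = subst (λ m → F x * gain u h ≤ density N d m * maybe (λ c → le m (toℕ c)) 0ℚ (chosen (state u h)) + κ * P x)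
            (sym m≡) (outcome (chosen (state u h)) refl)
            where
            open ≤-Reasoning
            open +-*-Solver
            m≡ : best (state u h) ≡ maxV x
            m≡ = trans (sym (ℕ.⊔-identityʳ _)) inv
            0≤κP : 0ℚ ≤ κ * P x
            0≤κP = 0≤* 0≤κ (0≤P x)
            M = maxV x
            case : ∀ c → toℕ c ℕ.≤ M → Dec (M ℕ.≤ toℕ c) → F x * wt (toℕ c) ≤ P x * le M (toℕ c) + κ * P x
            case c c≤M (yes M≤c) = begin
              F x * wt (toℕ c)  ≡⟨ cong (λ k → F x * wt k) (ℕ.≤-antisym c≤M M≤c) ⟩
              F x * wt M  ≡⟨ Fwt x ⟩
              P x  ≡⟨ trans (cong (P x *_) (le-yes M≤c)) (*-identityʳ (P x)) ⟨
              P x * le M (toℕ c)  ≤⟨ ≤-diff (κ * P x) 0≤κP refl ⟩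
              P x * le M (toℕ c) + κ * P x  ∎
            case c c≤M (no M≰c) = begin
              F x * wt (toℕ c)  ≤⟨ *-monoˡ (F x) (0≤F x) (gap (ℕ.≰⇒> M≰c)) ⟩
              F x * (κ * wt M)  ≡⟨ solve 3 (λ a b c → a :* (b :* c) := b :* (a :* c)) refl (F x) κ (wt M) ⟩
              κ * (F x * wt M)  ≡⟨ cong (κ *_) (Fwt x) ⟩
              κ * P x  ≤⟨ ≤-diff (P x * le M (toℕ c)) (0≤* (0≤P x) (0≤le M (toℕ c))) (+-comm (P x * le M (toℕ c)) (κ * P x)) ⟩
              P x * le M (toℕ c) + κ * P x  ∎
            outcome : ∀ o → chosen (state u h) ≡ o →
                      F x * maybe (λ c → wt (toℕ c)) 0ℚ o ≤ P x * maybe (λ c → le M (toℕ c)) 0ℚ o + κ * P x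
            outcome nothing  eq = ≤-diff (κ * P x) 0≤κP (cong (_+ κ * P x) (trans (*-zeroʳ (P x)) (sym (*-zeroʳ (F x)))))
            outcome (just c) eq = case c (subst (toℕ c ℕ.≤_) m≡ (chosen≤best u h eq)) (M ℕ.≤? toℕ c)

          gain-≤ : F x * expect (code (w [ u ]≔ x)) (gain u) [] fs ≤ expect (code (w [ u ]≔ x)) (λ h → win (state u h)) [] fs + κ * P x
          gain-≤ = begin
            F x * expect c (gain u) [] fs  ≡⟨ expect-* c (F x) (gain u) [] fs ⟨
            expect c (λ h → F x * gain u h) [] fs  ≤⟨ expect-mono c (λ _ _ → ⊤) (λ _ _ → yes tt) (λ _ _ _ ¬⊤ → contradiction tt ¬⊤) MaxKnown maxKnown-step
                                                                                 (λ h → F x * gain u h) (λ h → win (state u h) + κ * P x) settle [] fs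
                                                                                 (trans (maxAt-↭ x coordinates-↭) (maxAt-allFin x)) ⟩
            expect c (λ h → win (state u h) + κ * P x) [] fs  ≡⟨ expect-+ c (λ h → win (state u h)) (λ _ → κ * P x) [] fs ⟩
            expect c (λ h → win (state u h)) [] fs + expect c (λ _ → κ * P x) [] fs  ≡⟨ cong (expect c (λ h → win (state u h)) [] fs +_) (expect-const c (κ * P x) [] fs) ⟩
            expect c (λ h → win (state u h)) [] fs + κ * P x  ∎
            where
            open ≤-Reasoning
            c = code (w [ u ]≔ x)

        -- Reordering the coordinates by arrival makes the sum over code vectors a `resample`, for
        -- which `secretary-bound` holds whatever the other vertices show.
        vertex-bound : sumL xs (λ x → F x * expect (code (w [ u ]≔ x)) (gain u) [] fs) ≤ v 0 * H N + κ * T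
        vertex-bound = begin
          sumL xs (λ x → F x * expect (code (w [ u ]≔ x)) (gain u) [] fs)
            ≤⟨ sumL-mono xs gain-≤ ⟩
          sumL xs (λ x → play x + κ * P x)
            ≡⟨ sumL-+ xs play (λ x → κ * P x) ⟩
          sumL xs play + sumL xs (λ x → κ * P x)
            ≡⟨ cong₂ _+_ (trans (sym (∑At-allFin d x₀ play)) (trans (sym (∑At-↭ x₀ play coordinates-↭))
                 (∑At-expect (code w) (λ x → code (w [ u ]≔ x)) (code-yes w u) (code-no w u) (λ h → win (state u h)) [] fs x₀
                   (Unique-resp-↭ (↭-sym coordinates-↭) (allFin⁺ d)))))
                 (sumL-* xs κ P) ⟩
          resample u (code w) (λ h → win (state u h)) [] fs + κ * T
            ≤⟨ +-monoˡ-≤ (κ * T) (secretary-bound fs (trans (degree-coordinates fs) (trans (↭-length coordinates-↭) (List.length-tabulate (λ i → i))))) ⟩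
          v 0 * H N + κ * T ∎
          where
          open ≤-Reasoning
          play : X → ℚ
          play x = expect (code (w [ u ]≔ x)) (λ h → win (state u h)) [] fs

      expected : Vec X nL → List (Fin (nL ℕ.* d)) → ℚ
      expected w = expect (code w) (λ h → weightOf (code w) (acc h)) []

      expected≤gains : ∀ w fs → Unique fs → expected w fs ≤ ∑Fin nL (λ u → expect (code w) (gain u) [] fs) + W * ι nR
      expected≤gains w fs uniq = begin
        expected w fs
          ≤⟨ expect-mono (code w) Feasible feasible? prob-0 Invariant invariant-step (λ h → weightOf (code w) (acc h)) (λ h → gains h + W * ι nR)
               (invariant-end (0≤W c₀)) [] fs (invariant-[] uniq) ⟩
        expect (code w) (λ h → gains h + W * ι nR) [] fs
          ≡⟨ expect-+ (code w) gains (λ _ → W * ι nR) [] fs ⟩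
        expect (code w) gains [] fs + expect (code w) (λ _ → W * ι nR) [] fs
          ≡⟨ cong₂ _+_ (expect-sum (code w) (allFin nL) gain [] fs) (expect-const (code w) (W * ι nR) [] fs) ⟩
        ∑Fin nL (λ u → expect (code w) (gain u) [] fs) + W * ι nR ∎
        where
        open ≤-Reasoning
        open Bookkeeping.Weights S N wt 0≤wt W wt≤W (code w) using (Invariant; invariant-step; invariant-end; invariant-[]; gains; 0≤W)

      0≤expected : ∀ w fs → 0ℚ ≤ expected w fs
      0≤expected w fs = subst (_≤ expected w fs) (expect-const (code w) 0ℚ [] fs)
        (expect-mono (code w) (λ _ _ → ⊤) (λ _ _ → yes tt) (λ _ _ _ ¬⊤ → contradiction tt ¬⊤) (λ _ _ → ⊤) (λ _ _ _ _ _ _ → tt)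
          (λ _ → 0ℚ) (λ h → weightOf (code w) (acc h)) (λ h _ → sumL-0≤ (allFin _) (0≤contribution (acc h))) [] fs tt)
        where open Bookkeeping.Weights S N wt 0≤wt W wt≤W (code w) using (0≤contribution)

      module _ (Φ⁻¹ : ℚ) (0≤Φ⁻¹ : 0ℚ ≤ Φ⁻¹) (Φ⁻¹Φ : Φ⁻¹ * Φ ≡ 1ℚ) where
        open Normalised Φ⁻¹ 0≤Φ⁻¹ Φ⁻¹Φ

        order-bound : ∀ fs → fs ↭ allFin (nL ℕ.* d) →
          sumL configs (λ w → law w * expected w fs) ≤ ι nL * (Φ⁻¹ * (v 0 * H N + κ * T)) + W * ι nR
        order-bound fs p = begin
          sumL configs (λ w → law w * expected w fs)
            ≤⟨ sumL-mono configs (λ w → *-monoˡ (law w) (0≤law w) (expected≤gains w fs (Unique-resp-↭ (↭-sym p) (allFin⁺ _)))) ⟩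
          sumL configs (λ w → law w * (∑Fin nL (λ u → g u w) + W * ι nR))
            ≡⟨ sumL-cong configs (λ w → trans (*-distribˡ-+ (law w) (∑Fin nL (λ u → g u w)) (W * ι nR))
                 (cong (_+ law w * (W * ι nR)) (sym (sumL-* (allFin nL) (law w) (λ u → g u w))))) ⟩
          sumL configs (λ w → ∑Fin nL (λ u → law w * g u w) + law w * (W * ι nR))
            ≡⟨ sumL-+ configs (λ w → ∑Fin nL (λ u → law w * g u w)) (λ w → law w * (W * ι nR)) ⟩
          sumL configs (λ w → ∑Fin nL (λ u → law w * g u w)) + sumL configs (λ w → law w * (W * ι nR))
            ≡⟨ cong₂ _+_ (sumL-swap configs (allFin nL) (λ w u → law w * g u w))
                 (trans (sumL-*ʳ configs (W * ι nR) law) (trans (cong (_* (W * ι nR)) (∑product nL)) (*-identityˡ (W * ι nR)))) ⟩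
          ∑Fin nL (λ u → sumL configs (λ w → law w * g u w)) + W * ι nR
            ≤⟨ +-monoˡ-≤ (W * ι nR) (sumL-mono (allFin nL) (λ u → marginal-≤ u (g u) β (λ w → vertex w u))) ⟩
          ∑Fin nL (λ _ → β) + W * ι nR
            ≡⟨ cong (_+ W * ι nR) (trans (sumL-const (allFin nL) β) (cong (λ n → ι n * β) (List.length-tabulate {n = nL} (λ i → i)))) ⟩
          ι nL * β + W * ι nR ∎
          where
          open ≤-Reasoning
          β = Φ⁻¹ * (v 0 * H N + κ * T)
          g : Fin nL → Vec X nL → ℚ
          g u w = expect (code w) (gain u) [] fs
          vertex : ∀ w u → sumL xs (λ x → Φ⁻¹ * F x * g u (w [ u ]≔ x)) ≤ β
          vertex w u = subst (_≤ β)
            (trans (sym (sumL-* xs Φ⁻¹ (λ x → F x * g u (w [ u ]≔ x)))) (sumL-cong xs (λ x → sym (*-assoc Φ⁻¹ (F x) (g u (w [ u ]≔ x))))))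
            (*-monoˡ Φ⁻¹ 0≤Φ⁻¹ (vertex-bound w u fs p))

        -- Three losses of `κ`: accepted codes that are not maximal, the excess of `H N` over `T`,
        -- and the additional edges at right vertices. The last is put in units of `Z` by means of
        -- `Φ≤T`.
        hardness : 0ℚ ≤ v 0 → v 0 ≤ 1ℚ → triangle d ≤ κ * T → W * ι nR ≤ κ * ι nL → 0ℚ ≤ T → ∀ fs → fs ↭ allFin (nL ℕ.* d) →
          sumL configs (λ w → law w * expected w fs) ≤ (v 0 + ι 3 * κ) * Z
        hardness 0≤v v≤1 C≤κT few 0≤T fs p = begin
          sumL configs (λ w → law w * expected w fs)
            ≤⟨ order-bound fs p ⟩
          n * (Φ⁻¹ * (v 0 * H N + κ * T)) + W * ι nR
            ≤⟨ +-mono-≤ (*-monoˡ n (0≤ι nL) (*-monoˡ Φ⁻¹ 0≤Φ⁻¹ (+-monoˡ-≤ (κ * T) v0H≤))) (≤-trans few κn≤) ⟩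
          n * (Φ⁻¹ * ((v 0 * T + κ * T) + κ * T)) + κ * n * (Φ⁻¹ * T)
            ≡⟨ solve 5 (λ n p v t k → n :* (p :* ((v :* t :+ k :* t) :+ k :* t)) :+ k :* n :* (p :* t)
                 := (v :+ (con 1ℚ :+ (con 1ℚ :+ (con 1ℚ :+ con 0ℚ))) :* k) :* (n :* (p :* t))) refl n Φ⁻¹ (v 0) T κ ⟩
          (v 0 + ι 3 * κ) * (n * (Φ⁻¹ * T))
            ≤⟨ *-monoˡ (v 0 + ι 3 * κ) (0≤+ 0≤v (0≤* (0≤ι 3) 0≤κ)) Z≥ ⟩
          (v 0 + ι 3 * κ) * Z ∎
          where
          open ≤-Reasoning
          open +-*-Solver
          n = ι nL
          0≤κT : 0ℚ ≤ κ * T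
          0≤κT = 0≤* 0≤κ 0≤T
          H≤ : H N ≤ T + κ * T
          H≤ = subst (_≤ T + κ * T) (solve 2 (λ h c → (h :- c) :+ c := h) refl (H N) (triangle d)) (+-mono-≤ (totalMass≥ N d) C≤κT)
          v0H≤ : v 0 * H N ≤ v 0 * T + κ * T
          v0H≤ = ≤-trans (*-monoˡ (v 0) 0≤v H≤) (≤-trans (≤-reflexive (*-distribˡ-+ (v 0) T (κ * T)))
            (+-monoʳ-≤ (v 0 * T) (subst (v 0 * (κ * T) ≤_) (*-identityˡ (κ * T)) (*-monoʳ (κ * T) 0≤κT v≤1))))
          κn≤ : κ * n ≤ κ * n * (Φ⁻¹ * T)
          κn≤ = subst (_≤ κ * n * (Φ⁻¹ * T)) (trans (cong (κ * n *_) Φ⁻¹Φ) (*-identityʳ (κ * n)))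
            (*-monoˡ (κ * n) (0≤* 0≤κ (0≤ι nL)) (*-monoˡ Φ⁻¹ 0≤Φ⁻¹ Φ≤T))

-- Replacing real acceptance probabilities by rational ones.

module RealAlgorithm where
  open import Data.Fin.Subset using (⁅_⁆; _∪_)
  open import Data.List.Relation.Binary.Permutation.Propositional as ↭ using (_↭_; ↭-refl)
  open import Data.List.Relation.Unary.All using (All; []; _∷_) renaming (map to All-map)
  import Data.List.Relation.Unary.All.Properties as All
  open import Data.Rational hiding (1/_)
  open import Data.Rational.Properties hiding (_≟_)
  open import Data.Rational.Solver using (module +-*-Solver)
  open import Data.Vec using (lookup)
  open import Defs using (ℝ; seq; fromℚ; 0ℝ; 1ℝ; ℝ⁺; _,⁺_; ∑; Algorithm; Weighting; History; Observation; observed; acceptedSet; expectedFrom; weight; acyclic?; 𝔼ALG; insertions; permutations; 1/_!)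
  import Defs
  open Rationals
  open Densities
  open Online
  open Covers using (System; module SystemGraph)
  open Forests using (module SystemForests)
  open Accounting

  infix 4 _≈_
  -- The relation `_≃_` on bare sequences, so that the rational approximations need no Cauchy
  -- proofs.
  _≈_ : (ℕ → ℚ) → (ℕ → ℚ) → Set
  x ≈ y = ∀ δ → 0ℚ < δ → ∃ λ N → ∀ n → N ℕ.≤ n → ∣ x n - y n ∣ ≤ δ

  ∣p∣≤ : ∀ {p q} → p ≤ q → - p ≤ q → ∣ p ∣ ≤ q
  ∣p∣≤ {p} {q} p≤q -p≤q with ∣p∣≡p∨∣p∣≡-p p
  ... | inj₁ eq = subst (_≤ q) (sym eq) p≤q
  ... | inj₂ eq = subst (_≤ q) (sym eq) -p≤q

  p≤∣p∣ : ∀ p → p ≤ ∣ p ∣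
  p≤∣p∣ p with ≤-total 0ℚ p
  ... | inj₁ 0≤p = ≤-reflexive (sym (0≤p⇒∣p∣≡p 0≤p))
  ... | inj₂ p≤0 = ≤-trans p≤0 (0≤∣p∣ p)

  ≡⇒≈ : ∀ {x y : ℕ → ℚ} → (∀ n → x n ≡ y n) → x ≈ y
  ≡⇒≈ {x} {y} eq δ 0<δ = 0 , λ n _ → subst (λ z → ∣ x n - z ∣ ≤ δ) (eq n)
    (subst (_≤ δ) (sym (cong ∣_∣ (+-inverseʳ (x n)))) (<⇒≤ 0<δ))

  abstract
    rcp-small : ∀ δ → 0ℚ < δ → ∃ λ n → rcp n ≤ δ
    rcp-small δ 0<δ = n , (begin
      rcp n  ≡⟨ *-identityʳ (rcp n) ⟨
      rcp n * 1ℚ  ≡⟨ cong (rcp n *_) (*-inverseʳ δ {{nz}}) ⟨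
      rcp n * (δ * δ⁻¹)  ≡⟨ solve 3 (λ r d e → r :* (d :* e) := d :* (r :* e)) refl (rcp n) δ δ⁻¹ ⟩
      δ * (rcp n * δ⁻¹)  ≤⟨ *-monoˡ δ (<⇒≤ 0<δ) (*-monoˡ (rcp n) (0≤rcp n) (≤-trans (proj₂ (archimedean δ⁻¹)) (ι-mono (ℕ.n≤1+n n)))) ⟩
      δ * (rcp n * ι (suc n))  ≡⟨ trans (cong (δ *_) (rcp* n)) (*-identityʳ δ) ⟩
      δ  ∎)
      where
      open ≤-Reasoning
      open +-*-Solver
      nz : NonZero δ
      nz = >-nonZero 0<δ
      δ⁻¹ : ℚ
      δ⁻¹ = (Data.Rational.1/ δ) {{nz}}
      n : ℕ
      n = proj₁ (archimedean δ⁻¹)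

    share : ∀ K δ → 0ℚ < δ → ∃ λ η → 0ℚ < η × K * η ≤ δ
    share K δ 0<δ = δ * rcp k , 0<* 0<δ (0<rcp k) , (begin
      K * (δ * rcp k)  ≤⟨ *-monoʳ (δ * rcp k) (<⇒≤ (0<* 0<δ (0<rcp k))) (≤-trans (proj₂ (archimedean K)) (ι-mono (ℕ.n≤1+n k))) ⟩
      ι (suc k) * (δ * rcp k)  ≡⟨ solve 3 (λ a d r → a :* (d :* r) := d :* (r :* a)) refl (ι (suc k)) δ (rcp k) ⟩
      δ * (rcp k * ι (suc k))  ≡⟨ trans (cong (δ *_) (rcp* k)) (*-identityʳ δ) ⟩
      δ  ∎)
      where
      open ≤-Reasoning
      open +-*-Solver
      k : ℕ
      k = proj₁ (archimedean K)

  ≈-+ : ∀ {x x′ y y′} → x ≈ x′ → y ≈ y′ → (λ n → x n + y n) ≈ (λ n → x′ n + y′ n)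
  ≈-+ {x} {x′} {y} {y′} x≈ y≈ δ 0<δ with share (ι 2) δ 0<δ
  ... | η , 0<η , 2η≤δ with x≈ η 0<η | y≈ η 0<η
  ... | M , f | N , g = M ℕ.⊔ N , λ n le → begin
    ∣ (x n + y n) - (x′ n + y′ n) ∣  ≡⟨ cong ∣_∣ (solve 4 (λ a b c d → (a :+ b) :- (c :+ d) := (a :- c) :+ (b :- d)) refl (x n) (y n) (x′ n) (y′ n)) ⟩
    ∣ (x n - x′ n) + (y n - y′ n) ∣  ≤⟨ ∣p+q∣≤∣p∣+∣q∣ (x n - x′ n) (y n - y′ n) ⟩
    ∣ x n - x′ n ∣ + ∣ y n - y′ n ∣  ≤⟨ +-mono-≤ (f n (ℕ.m⊔n≤o⇒m≤o M N le)) (g n (ℕ.m⊔n≤o⇒n≤o M N le)) ⟩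
    η + η  ≡⟨ solve 1 (λ a → a :+ a := (con 1ℚ :+ (con 1ℚ :+ con 0ℚ)) :* a) refl η ⟩
    ι 2 * η  ≤⟨ 2η≤δ ⟩
    δ  ∎
    where
    open ≤-Reasoning
    open +-*-Solver

  -- Bounds are asked of the rational side only, where they hold for every index; `x` is eventually
  -- within 1 of `x′`, which bounds it too.
  ≈-* : ∀ {x x′ y y′ A B} → (∀ n → ∣ x′ n ∣ ≤ A) → (∀ n → ∣ y′ n ∣ ≤ B) → x ≈ x′ → y ≈ y′ → (λ n → x n * y n) ≈ (λ n → x′ n * y′ n)
  ≈-* {x} {x′} {y} {y′} {A} {B} x′≤A y′≤B x≈ y≈ δ 0<δ with share (A + 1ℚ + B) δ 0<δ
  ... | η , 0<η , Kη≤δ with x≈ 1ℚ 0<1 | x≈ η 0<η | y≈ η 0<η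
  ... | L , e | M , f | N , g = L ℕ.⊔ (M ℕ.⊔ N) , λ n le → begin
    ∣ x n * y n - x′ n * y′ n ∣
      ≡⟨ cong ∣_∣ (solve 4 (λ a b c d → a :* b :- c :* d := a :* (b :- d) :+ (a :- c) :* d) refl (x n) (y n) (x′ n) (y′ n)) ⟩
    ∣ x n * (y n - y′ n) + (x n - x′ n) * y′ n ∣
      ≤⟨ ∣p+q∣≤∣p∣+∣q∣ (x n * (y n - y′ n)) ((x n - x′ n) * y′ n) ⟩
    ∣ x n * (y n - y′ n) ∣ + ∣ (x n - x′ n) * y′ n ∣
      ≡⟨ cong₂ _+_ (∣p*q∣≡∣p∣*∣q∣ (x n) (y n - y′ n)) (∣p*q∣≡∣p∣*∣q∣ (x n - x′ n) (y′ n)) ⟩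
    ∣ x n ∣ * ∣ y n - y′ n ∣ + ∣ x n - x′ n ∣ * ∣ y′ n ∣
      ≤⟨ +-mono-≤ (*-mono (0≤∣p∣ (x n)) (<⇒≤ 0<η) (∣x∣≤ n (ℕ.m⊔n≤o⇒m≤o L _ le)) (g n (ℕ.m⊔n≤o⇒n≤o M N (ℕ.m⊔n≤o⇒n≤o L _ le))))
           (*-mono (0≤∣p∣ (x n - x′ n)) (≤-trans (0≤∣p∣ (y′ n)) (y′≤B n)) (f n (ℕ.m⊔n≤o⇒m≤o M N (ℕ.m⊔n≤o⇒n≤o L _ le))) (y′≤B n)) ⟩
    (A + 1ℚ) * η + η * B
      ≡⟨ solve 3 (λ a e b → (a :+ con 1ℚ) :* e :+ e :* b := (a :+ con 1ℚ :+ b) :* e) refl A η B ⟩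
    (A + 1ℚ + B) * η
      ≤⟨ Kη≤δ ⟩
    δ ∎
    where
    open ≤-Reasoning
    open +-*-Solver
    ∣x∣≤ : ∀ n → L ℕ.≤ n → ∣ x n ∣ ≤ A + 1ℚ
    ∣x∣≤ n le = subst (λ z → ∣ z ∣ ≤ A + 1ℚ) (solve 2 (λ a b → a :+ (b :- a) := b) refl (x′ n) (x n))
      (≤-trans (∣p+q∣≤∣p∣+∣q∣ (x′ n) (x n - x′ n)) (+-mono-≤ (x′≤A n) (e n le)))

  ≈-upper : ∀ {x y} → x ≈ y → ∀ δ → 0ℚ < δ → ∃ λ N → ∀ n → N ℕ.≤ n → x n ≤ y n + δ
  ≈-upper {x} {y} x≈y δ 0<δ with x≈y δ 0<δ
  ... | N , f = N , λ n le → subst (_≤ y n + δ) (solve 2 (λ a b → b :+ (a :- b) := a) refl (x n) (y n))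
    (+-monoʳ-≤ (y n) (≤-trans (p≤∣p∣ (x n - y n)) (f n le)))
    where open +-*-Solver

  clamp : ℚ → ℚ
  clamp q with q ≤? 0ℚ | 1ℚ ≤? q
  ... | yes _ | _     = 0ℚ
  ... | no _  | yes _ = 1ℚ
  ... | no _  | no _  = q

  0≤clamp : ∀ q → 0ℚ ≤ clamp q
  0≤clamp q with q ≤? 0ℚ | 1ℚ ≤? q
  ... | yes _  | _     = ≤-refl
  ... | no _   | yes _ = 0≤1
  ... | no q≰0 | no _  = <⇒≤ (≰⇒> q≰0)

  clamp≤1 : ∀ q → clamp q ≤ 1ℚ
  clamp≤1 q with q ≤? 0ℚ | 1ℚ ≤? q
  ... | yes _ | _      = 0≤1
  ... | no _  | yes _  = ≤-refl
  ... | no _  | no 1≰q = <⇒≤ (≰⇒> 1≰q)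

  clamp-close : ∀ q δ → 0ℚ ≤ δ → 0ℚ ≤ q + δ → q ≤ 1ℚ + δ → ∣ q - clamp q ∣ ≤ δ
  clamp-close q δ 0≤δ lo hi with q ≤? 0ℚ | 1ℚ ≤? q
  ... | yes q≤0 | _ = ∣p∣≤ (≤-trans (≤-reflexive (+-identityʳ q)) (≤-trans q≤0 0≤δ))
    (≤-diff (q + δ) lo (solve 2 (λ q d → d := :- (q :- con 0ℚ) :+ (q :+ d)) refl q δ))
    where open +-*-Solver
  ... | no _ | yes 1≤q = ∣p∣≤
    (≤-diff (1ℚ + δ - q) (diff-≤ hi) (solve 2 (λ q d → d := (q :- con 1ℚ) :+ (con 1ℚ :+ d :- q)) refl q δ))
    (≤-trans (≤-diff (q - 1ℚ) (diff-≤ 1≤q) (solve 1 (λ q → con 0ℚ := :- (q :- con 1ℚ) :+ (q :- con 1ℚ)) refl q)) 0≤δ)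
    where open +-*-Solver
  ... | no _ | no _ = subst (_≤ δ) (sym (cong ∣_∣ (+-inverseʳ q))) 0≤δ

  clamp-≈ : ∀ p → 0ℝ Defs.≤ p → p Defs.≤ 1ℝ → seq p ≈ (λ n → clamp (seq p n))
  clamp-≈ p 0≤p p≤1 δ 0<δ with 0≤p δ 0<δ | p≤1 δ 0<δ
  ... | M , f | N , g = M ℕ.⊔ N , λ n le → clamp-close (seq p n) δ (<⇒≤ 0<δ) (f n (ℕ.m⊔n≤o⇒m≤o M N le)) (g n (ℕ.m⊔n≤o⇒n≤o M N le))

  gate : ∀ {A : Set} → Dec A → ℚ → ℚ
  gate (yes _) p = p
  gate (no _)  p = 0ℚ

  0≤gate : ∀ {A : Set} (a? : Dec A) {p} → 0ℚ ≤ p → 0ℚ ≤ gate a? p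
  0≤gate (yes _) 0≤p = 0≤p
  0≤gate (no _)  _   = ≤-refl

  gate≤1 : ∀ {A : Set} (a? : Dec A) {p} → p ≤ 1ℚ → gate a? p ≤ 1ℚ
  gate≤1 (yes _) p≤1 = p≤1
  gate≤1 (no _)  _   = 0≤1

  gate-0 : ∀ {A : Set} (a? : Dec A) {p} → ¬ A → gate a? p ≡ 0ℚ
  gate-0 (yes a) ¬a = contradiction a ¬a
  gate-0 (no _)  _  = refl

  seq-∑ : ∀ {k} (g : Fin k → ℝ) n → seq (∑ g) n ≡ ∑Fin k (λ i → seq (g i) n)
  seq-∑ {zero}  g n = refl
  seq-∑ {suc k} g n = trans (cong (seq (g zero) n +_) (seq-∑ (g ∘ suc) n)) (sym (∑Fin-suc k (λ i → seq (g i) n)))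

  insertions-length : ∀ {A : Set} (x : A) xs → length (insertions x xs) ≡ suc (length xs)
  insertions-length x []       = refl
  insertions-length x (y ∷ ys) = cong suc (trans (List.length-map (y ∷_) (insertions x ys)) (insertions-length x ys))

  insertions-↭ : ∀ {A : Set} (x : A) xs → All (_↭ x ∷ xs) (insertions x xs)
  insertions-↭ x []       = ↭-refl ∷ []
  insertions-↭ x (y ∷ ys) = ↭-refl ∷ All.map⁺ (All-map (λ p → ↭.trans (↭.prep y p) (↭.swap y x ↭-refl)) (insertions-↭ x ys))

  permutations-↭ : ∀ {A : Set} (xs : List A) → All (_↭ xs) (permutations xs)
  permutations-↭ []       = ↭-refl ∷ []
  permutations-↭ (x ∷ xs) = All.concat⁺ (All.map⁺ (All-map
    (λ {ys} p → All-map (λ q → ↭.trans q (↭.prep x p)) (insertions-↭ x ys)) (permutations-↭ xs)))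

  permutations-length : ∀ {A : Set} (xs : List A) → length (permutations xs) ≡ length xs !
  permutations-length []       = refl
  permutations-length (x ∷ xs) = trans (go (permutations xs) (permutations-↭ xs)) (trans (ℕ.*-comm _ (suc (length xs))) (cong (suc (length xs) ℕ.*_) (permutations-length xs)))
    where
    open import Data.List.Relation.Binary.Permutation.Propositional.Properties using (↭-length)
    go : ∀ l → All (_↭ xs) l → length (concatMap (insertions x) l) ≡ length l ℕ.* suc (length xs)
    go []       []       = refl
    go (ys ∷ l) (p ∷ ps) = trans (List.length-++ (insertions x ys))
      (cong₂ ℕ._+_ (trans (insertions-length x ys) (cong suc (↭-length p))) (go l ps))

  sumL-≤-All : ∀ {A : Set} {Q : A → Set} {l : List A} f {β} → All Q l → (∀ x → Q x → f x ≤ β) → sumL l f ≤ ι (length l) * β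
  sumL-≤-All {l = []}    f {β} []       le = ≤-reflexive (sym (*-zeroˡ β))
  sumL-≤-All {l = x ∷ l} f {β} (q ∷ qs) le = ≤-trans (+-mono-≤ (le x q) (sumL-≤-All f qs le))
    (≤-reflexive (solve 2 (λ n b → b :+ n :* b := (con 1ℚ :+ n) :* b) refl (ι (length l)) β))
    where open +-*-Solver

  module Rationalised {d : ℕ} (S : System d) (N : ℕ) (wt : ℕ → ℚ) (0<wt : ∀ c → 0ℚ < wt c)
    (W : ℚ) (wt≤W : ∀ (c : Fin N) → wt (toℕ c) ≤ W) where

    open System S using (nL; nR)
    open SystemGraph S using (graph)
    open SystemForests S using (left)
    open Bookkeeping S N using (acc; Feasible)

    E : Set
    E = Fin (nL ℕ.* d)

    0≤wt : ∀ c → 0ℚ ≤ wt c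
    0≤wt c = <⇒≤ (0<wt c)

    weightℝ : Fin N → ℝ⁺
    weightℝ c = fromℚ (wt (toℕ c)) ,⁺ (wt (toℕ c) , 0<wt (toℕ c) , 0 , λ _ _ → ≤-reflexive (+-identityˡ (wt (toℕ c))))

    observation : E × Fin N × Bool → Observation (nL ℕ.* d)
    observation (f , c , b) = observed f (weightℝ c) b

    history : Observed E N → History (nL ℕ.* d)
    history = map observation

    acceptedSet≡ : ∀ h → acceptedSet (history h) ≡ acc h
    acceptedSet≡ []                    = refl
    acceptedSet≡ ((f , c , true) ∷ h)  = cong (⁅ f ⁆ ∪_) (acceptedSet≡ h)
    acceptedSet≡ ((f , c , false) ∷ h) = acceptedSet≡ h

    feasible? : ∀ h f → Dec (Feasible h f)
    feasible? h f = acyclic? graph (⁅ f ⁆ ∪ acc h)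

    module _ (w : E → Fin N) where
      open Bookkeeping.Weights S N wt 0≤wt W wt≤W w using (weightOf; contribution)

      weighting : Weighting graph
      weighting f = weightℝ (w f)

      seq-weight : ∀ A n → seq (weight weighting A) n ≡ weightOf A
      seq-weight A n = trans (seq-∑ (λ f → if lookup A f then Defs.value (weighting f) else 0ℝ) n) (sumL-cong (allFin _) term)
        where
        term : ∀ f → seq (if lookup A f then Defs.value (weighting f) else 0ℝ) n ≡ contribution A f
        term f with lookup A f
        ... | true  = refl
        ... | false = refl

    module Play (a : Algorithm graph) where
      open Algorithm a

      acceptance : Observed E N → E → Fin N → ℝ
      acceptance h f c = accept (history h) f (weightℝ c)

      -- Clamping and zeroing do not change the real number, but make the n-th terms
      -- probabilities of a feasible rational algorithm.
      probability : ℕ → Observed E N → E → Fin N → ℚ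
      probability n h f c = gate (feasible? h f) (clamp (seq (acceptance h f c) n))

      0≤probability : ∀ n h f c → 0ℚ ≤ probability n h f c
      0≤probability n h f c = 0≤gate (feasible? h f) (0≤clamp (seq (acceptance h f c) n))

      probability≤1 : ∀ n h f c → probability n h f c ≤ 1ℚ
      probability≤1 n h f c = gate≤1 (feasible? h f) (clamp≤1 (seq (acceptance h f c) n))

      probability-0 : ∀ n h f c → ¬ Feasible h f → probability n h f c ≡ 0ℚ
      probability-0 n h f c = gate-0 (feasible? h f)

      probability-≈ : ∀ h f c → seq (acceptance h f c) ≈ (λ n → probability n h f c)
      probability-≈ h f c = go (feasible? h f)
        where
        go : ∀ ok? → seq (acceptance h f c) ≈ (λ n → gate {Feasible h f} ok? (clamp (seq (acceptance h f c) n)))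
        go (yes _)  = clamp-≈ (acceptance h f c) (accept≥0 (history h) f (weightℝ c)) (accept≤1 (history h) f (weightℝ c))
        go (no ¬ok) = feasible (history h) f (weightℝ c) (subst (λ A → ¬ Defs.Acyclic graph (⁅ f ⁆ ∪ A)) (sym (acceptedSet≡ h)) ¬ok)

      module _ (w : E → Fin N) where
        open Bookkeeping.Weights S N wt 0≤wt W wt≤W w using (weightOf; contribution; 0≤contribution)

        expectedAt : ℕ → Observed E N → List E → ℚ
        expectedAt n = Run.Algorithmic.expect left Fin._≟_ N (probability n) (0≤probability n) (probability≤1 n) w (λ h → weightOf (acc h))

        total : ℚ
        total = ∑Fin (nL ℕ.* d) (λ f → wt (toℕ (w f)))

        weightOf≤total : ∀ A → weightOf A ≤ total
        weightOf≤total A = sumL-mono (allFin _) term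
          where
          term : ∀ f → contribution A f ≤ wt (toℕ (w f))
          term f with lookup A f
          ... | true  = ≤-refl
          ... | false = 0≤wt (toℕ (w f))

        expectedAt-bounded : ∀ h fs n → ∣ expectedAt n h fs ∣ ≤ total
        expectedAt-bounded h []       n = subst (_≤ total) (sym (0≤p⇒∣p∣≡p (sumL-0≤ (allFin _) (0≤contribution (acc h))))) (weightOf≤total (acc h))
        expectedAt-bounded h (f ∷ fs) n = begin
          ∣ p * x + (1ℚ - p) * y ∣  ≤⟨ ∣p+q∣≤∣p∣+∣q∣ (p * x) ((1ℚ - p) * y) ⟩
          ∣ p * x ∣ + ∣ (1ℚ - p) * y ∣  ≡⟨ cong₂ _+_ (trans (∣p*q∣≡∣p∣*∣q∣ p x) (cong (_* ∣ x ∣) (0≤p⇒∣p∣≡p 0≤p)))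
                                                   (trans (∣p*q∣≡∣p∣*∣q∣ (1ℚ - p) y) (cong (_* ∣ y ∣) (0≤p⇒∣p∣≡p (diff-≤ p≤1)))) ⟩
          mix p ∣ x ∣ ∣ y ∣  ≤⟨ mix-≤ 0≤p p≤1 (expectedAt-bounded ((f , w f , true) ∷ h) fs n) (expectedAt-bounded ((f , w f , false) ∷ h) fs n) ⟩
          total  ∎
          where
          open ≤-Reasoning
          p = probability n h f (w f)
          0≤p = 0≤probability n h f (w f)
          p≤1 = probability≤1 n h f (w f)
          x = expectedAt n ((f , w f , true) ∷ h) fs
          y = expectedAt n ((f , w f , false) ∷ h) fs

        -- For each fixed n, `expectedAt n` is the outcome of a genuine rational algorithm, the n-th
        -- one. Such outcomes are bounded by the total weight, which makes products with the
        -- probabilities converge together.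
        expectedFrom-≈ : ∀ h fs → seq (expectedFrom a (weighting w) (history h) fs) ≈ (λ n → expectedAt n h fs)
        expectedFrom-≈ h []       = ≡⇒≈ {seq (weight (weighting w) (acceptedSet (history h)))} {λ _ → weightOf (acc h)} (λ n → trans (seq-weight w (acceptedSet (history h)) n) (cong weightOf (acceptedSet≡ h)))
        expectedFrom-≈ h (f ∷ fs) = ≈-+ {λ n → p n * x n} {λ n → p′ n * x′ n} {λ n → (1ℚ - p n) * y n} {λ n → (1ℚ - p′ n) * y′ n}
          (≈-* {p} {p′} {x} {x′} {1ℚ} {total} (λ n → ∣p∣≤1 (0≤probability n h f c) (probability≤1 n h f c)) (expectedAt-bounded ((f , c , true) ∷ h) fs)
            p≈ (expectedFrom-≈ ((f , c , true) ∷ h) fs))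
          (≈-* {λ n → 1ℚ - p n} {λ n → 1ℚ - p′ n} {y} {y′} {1ℚ} {total} (λ n → ∣p∣≤1 (diff-≤ (probability≤1 n h f c)) (1-p≤1 n)) (expectedAt-bounded ((f , c , false) ∷ h) fs)
            (≈-+ {λ _ → 1ℚ} {λ _ → 1ℚ} {λ n → - p n} {λ n → - p′ n} (≡⇒≈ {λ _ → 1ℚ} {λ _ → 1ℚ} (λ _ → refl)) (≈-neg {p} {p′} p≈)) (expectedFrom-≈ ((f , c , false) ∷ h) fs))
          where
          c = w f
          p p′ x x′ y y′ : ℕ → ℚ
          p = seq (acceptance h f c)
          p′ n = probability n h f c
          x = seq (expectedFrom a (weighting w) (history ((f , c , true) ∷ h)) fs)
          x′ n = expectedAt n ((f , c , true) ∷ h) fs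
          y = seq (expectedFrom a (weighting w) (history ((f , c , false) ∷ h)) fs)
          y′ n = expectedAt n ((f , c , false) ∷ h) fs
          p≈ : p ≈ p′
          p≈ = probability-≈ h f c
          ∣p∣≤1 : ∀ {p} → 0ℚ ≤ p → p ≤ 1ℚ → ∣ p ∣ ≤ 1ℚ
          ∣p∣≤1 0≤p p≤1 = subst (_≤ 1ℚ) (sym (0≤p⇒∣p∣≡p 0≤p)) p≤1
          1-p≤1 : ∀ n → 1ℚ - probability n h f c ≤ 1ℚ
          1-p≤1 n = ≤-trans (+-monoʳ-≤ 1ℚ (neg-antimono-≤ (0≤probability n h f c))) (≤-reflexive (+-identityʳ 1ℚ))
          ≈-neg : ∀ {x y} → x ≈ y → (λ n → - x n) ≈ (λ n → - y n)
          ≈-neg {x} {y} x≈y δ 0<δ with x≈y δ 0<δ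
          ... | K , g = K , λ n le → subst (_≤ δ) (trans (sym (∣-p∣≡∣p∣ (x n - y n))) (cong ∣_∣ (solve 2 (λ a b → :- (a :- b) := (:- a) :- (:- b)) refl (x n) (y n)))) (g n le)
            where open +-*-Solver

        averageAt : ℕ → ℚ
        averageAt n = 1/ (nL ℕ.* d) ! * sumL (permutations (allFin (nL ℕ.* d))) (expectedAt n [])

        𝔼ALG-≈ : seq (𝔼ALG a (weighting w)) ≈ averageAt
        𝔼ALG-≈ = ≈-* {λ _ → m} {λ _ → m} {seq (foldr Defs._+_ 0ℝ (map (expectedFrom a (weighting w) []) perms))} {λ n → sumL perms (expectedAt n [])} {∣ m ∣}
          (λ _ → ≤-refl) (bounded perms) (≡⇒≈ {λ _ → m} {λ _ → m} (λ _ → refl)) (sums perms)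
          where
          m = 1/ (nL ℕ.* d) !
          perms = permutations (allFin (nL ℕ.* d))
          bounded : ∀ l n → ∣ sumL l (expectedAt n []) ∣ ≤ sumL l (λ _ → total)
          bounded []       n = ≤-refl
          bounded (fs ∷ l) n = ≤-trans (∣p+q∣≤∣p∣+∣q∣ (expectedAt n [] fs) (sumL l (expectedAt n []))) (+-mono-≤ (expectedAt-bounded [] fs n) (bounded l n))
          sums : ∀ l → seq (foldr Defs._+_ 0ℝ (map (expectedFrom a (weighting w) []) l)) ≈ (λ n → sumL l (expectedAt n []))
          sums []       = ≡⇒≈ {λ _ → 0ℚ} {λ _ → 0ℚ} (λ _ → refl)
          sums (fs ∷ l) = ≈-+ {seq (expectedFrom a (weighting w) [] fs)} {λ n → expectedAt n [] fs} {seq (foldr Defs._+_ 0ℝ (map (expectedFrom a (weighting w) []) l))} (expectedFrom-≈ [] fs) (sums l)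

-- Choice of the parameters and the resulting finite hard family.

module Assembly where
  open import Data.Fin.Subset using (Subset; inside; outside)
  open import Data.Integer using (∣_∣)
  open import Data.List using (lookup)
  open import Data.List.Membership.Propositional using (_∈_)
  open import Data.List.Membership.Propositional.Properties using (∈-map⁺; ∈-filter⁺; ∈-++⁺ˡ; ∈-++⁺ʳ)
  open import Data.List.Relation.Binary.Permutation.Propositional using (_↭_)
  open import Data.List.Relation.Unary.Any using (here; there)
  open import Data.Rational hiding (1/_; ∣_∣)
  open import Data.Rational.Properties hiding (_≟_)
  open import Data.Rational.Solver using (module +-*-Solver)
  open import Defs using (ℝ; seq; 0ℝ; Graph; GirthAtLeast; Acyclic; acyclic?; Weighting; weight; subsets; OPT; Algorithm; 𝔼ALG; permutations; 1/_!; expSum)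
  import Defs
  open Rationals
  open Harmonic
  open Stopping
  open Densities
  open Covers using (System; high-girth-system; module SystemGraph)
  open Hardness
  open RealAlgorithm

  ∈-subsets : ∀ {n} (A : Subset n) → A ∈ subsets n
  ∈-subsets []            = here refl
  ∈-subsets {suc n} (false ∷ A) = ∈-++⁺ˡ (∈-map⁺ (outside ∷_) (∈-subsets A))
  ∈-subsets {suc n} (true ∷ A)  = ∈-++⁺ʳ (map (outside ∷_) (subsets n)) (∈-map⁺ (inside ∷_) (∈-subsets A))

  ≤-foldr-⊔ : ∀ (l : List ℝ) {x} n → x ∈ l → seq x n ≤ seq (foldr Defs._⊔_ 0ℝ l) n
  ≤-foldr-⊔ (y ∷ l) n (here refl) = p≤p⊔q (seq y n) _
  ≤-foldr-⊔ (y ∷ l) n (there x∈)  = ≤-trans (≤-foldr-⊔ l n x∈) (p≤q⊔p (seq y n) _)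

  weight≤OPT : ∀ G (w : Weighting G) A n → Acyclic G A → seq (weight w A) n ≤ seq (OPT G w) n
  weight≤OPT G w A n ac = ≤-foldr-⊔ _ n (∈-map⁺ (weight w) (∈-filter⁺ (acyclic? G) (∈-subsets A) ac))

  ∑Fin-lookup : ∀ {A : Set} (l : List A) f → ∑Fin (length l) (λ i → f (lookup l i)) ≡ sumL l f
  ∑Fin-lookup []      f = refl
  ∑Fin-lookup (x ∷ l) f = trans (∑Fin-suc (length l) (λ i → f (lookup (x ∷ l) i))) (cong (f x +_) (∑Fin-lookup l f))

  -- mass i · worth i is the probability of the i-th weighting; worth i bounds OPT from below.
  record HardFamily (g : ℤ) (ε : ℚ) : Set where
    field
      G          : Graph
      girth      : GirthAtLeast G g
      size       : ℕ
      weightings : Fin size → Weighting G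
      mass worth : Fin size → ℚ
      0≤mass     : ∀ i → 0ℚ ≤ mass i
      0<worth    : ∀ i → 0ℚ < worth i
      worth≤OPT  : ∀ i n → worth i ≤ seq (OPT G (weightings i)) n
      normalised : ∑Fin size (λ i → mass i * worth i) ≡ 1ℚ
      level      : ℚ
      level≤     : ∀ n → level * expSum n ≤ 1ℚ + ε
      bounded    : ∀ (a : Algorithm G) → ∃ λ (alg : Fin size → ℕ → ℚ) →
                   (∀ i n → 0ℚ ≤ alg i n) × (∀ i → seq (𝔼ALG a (weightings i)) ≈ alg i) ×
                   (∀ n → ∑Fin size (λ i → mass i * alg i n) ≤ level)

  module Powers (b : ℕ) where

    β κ : ℚ
    β = ι (suc b)
    κ = rcp b

    wt iw : ℕ → ℚ
    wt = pow β
    iw = pow κ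

    1≤β : 1ℚ ≤ β
    1≤β = ≤-diff (ι b) (0≤ι b) refl

    1≤wt : ∀ c → 1ℚ ≤ wt c
    1≤wt zero    = ≤-refl
    1≤wt (suc c) = *-mono 0≤1 (≤-trans 0≤1 (1≤wt c)) 1≤β (1≤wt c)

    0≤iw : ∀ c → 0ℚ ≤ iw c
    0≤iw zero    = 0≤1
    0≤iw (suc c) = 0≤* (0≤rcp b) (0≤iw c)

    iw*wt : ∀ c → iw c * wt c ≡ 1ℚ
    iw*wt zero    = refl
    iw*wt (suc c) = trans (solve 4 (λ k i b w → k :* i :* (b :* w) := (k :* b) :* (i :* w)) refl κ (iw c) β (wt c))
      (cong₂ _*_ (rcp* b) (iw*wt c))
      where open +-*-Solver

    wt-mono : ∀ {c c′} → c ℕ.≤ c′ → wt c ≤ wt c′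
    wt-mono {zero}  {c′} _                   = 1≤wt c′
    wt-mono {suc c} {suc c′} (ℕ.s≤s c≤c′) = *-monoˡ β (≤-trans 0≤1 1≤β) (wt-mono c≤c′)

    gap : ∀ {c c′} → c ℕ.< c′ → wt c ≤ κ * wt c′
    gap {c} {c′} c<c′ = subst (_≤ κ * wt c′)
      (trans (sym (*-assoc κ β (wt c))) (trans (cong (_* wt c) (rcp* b)) (*-identityˡ (wt c))))
      (*-monoˡ κ (0≤rcp b) (wt-mono c<c′))

  -- `large` makes the additive loss `triangle d` at most `κ * T`. `many` makes all additional
  -- edges, one of weight `W` per right vertex, worth at most `κ` per left vertex; `ratio` converts
  -- right vertices into left ones.
  module Family (g : ℤ) (ε : ℚ) (b d′ n M : ℕ) (v : ℕ → ℚ) (SV : StoppingValue d′ v) (v≤1 : v 0 ≤ 1ℚ)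
    (level≤ : ∀ m → (v 0 + ι 3 * rcp b) * expSum m ≤ 1ℚ + ε)
    (large : triangle (suc d′) + (triangle (suc d′) * ι (suc b) + 1ℚ) ≤ H (suc n))
    (many : pow (ι (suc b)) (suc n) * ι (suc d′) * ι (suc b) ≤ ι M)
    (S : System (suc d′)) (1≤nL : 1 ℕ.≤ System.nL S) (ratio : System.nL S ℕ.* suc d′ ≡ System.nR S ℕ.* M)
    (girth : System.GirthBeyond S ∣ g ∣) where

    open Powers b
    open System S using (nL; nR)
    open SystemGraph S using (graph; girthAtLeast)

    N d : ℕ
    N = suc n
    d = suc d′

    W : ℚ
    W = wt N

    wt≤W : ∀ (c : Fin N) → wt (toℕ c) ≤ W
    wt≤W c = wt-mono (ℕ.<⇒≤ (Fin.toℕ<n c))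

    0<wt : ∀ c → 0ℚ < wt c
    0<wt c = <-≤-trans 0<1 (1≤wt c)

    open HardInstance d′ N v SV wt iw 1≤wt 0≤iw iw*wt κ (0≤rcp b) gap W wt≤W zero S hiding (0≤wt; d)
    open Rationalised S N wt 0<wt W wt≤W

    0<nL : 0ℚ < ι nL
    0<nL = <-≤-trans (0<ι 0) (ι-mono 1≤nL)

    C : ℚ
    C = triangle d

    T≥ : C * β + 1ℚ ≤ T
    T≥ = ≤-trans (≤-diff (H N - (C + (C * β + 1ℚ))) (diff-≤ large) (solve 3 (λ h c x → h :- c := x :+ (h :- (c :+ x))) refl (H N) C (C * β + 1ℚ))) (totalMass≥ N d)
      where open +-*-Solver

    0≤C : ∀ k → 0ℚ ≤ triangle k
    0≤C zero    = ≤-refl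
    0≤C (suc k) = 0≤+ (0≤C k) (0≤ι (suc k))

    0<T : 0ℚ < T
    0<T = <-≤-trans 0<1 (≤-trans (≤-diff (C * β) (0≤* (0≤C d) (≤-trans 0≤1 1≤β)) (+-comm (C * β) 1ℚ)) T≥)

    C≤κT : C ≤ κ * T
    C≤κT = begin
      C  ≤⟨ ≤-diff κ (0≤rcp b) refl ⟩
      C + κ  ≡⟨ cong (_+ κ) (trans (cong (C *_) (rcp* b)) (*-identityʳ C)) ⟨
      C * (κ * β) + κ  ≡⟨ solve 3 (λ c k b → c :* (k :* b) :+ k := k :* (c :* b :+ con 1ℚ)) refl C κ β ⟩
      κ * (C * β + 1ℚ)  ≤⟨ *-monoˡ κ (0≤rcp b) T≥ ⟩
      κ * T  ∎
      where
      open ≤-Reasoning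
      open +-*-Solver

    few : W * ι nR ≤ κ * ι nL
    few = begin
      W * ι nR  ≡⟨ trans (cong₂ (λ x y → W * ι nR * (x * y)) (rcp* d′) (rcp* b)) (*-identityʳ (W * ι nR)) ⟨
      W * ι nR * ((rcp d′ * ι d) * (κ * β))  ≡⟨ solve 6 (λ w r s d k b → w :* r :* ((s :* d) :* (k :* b)) := s :* k :* r :* (w :* d :* b)) refl W (ι nR) (rcp d′) (ι d) κ β ⟩
      rcp d′ * κ * ι nR * (W * ι d * β)  ≤⟨ *-monoˡ (rcp d′ * κ * ι nR) (0≤* (0≤* (0≤rcp d′) (0≤rcp b)) (0≤ι nR)) many ⟩
      rcp d′ * κ * ι nR * ι M  ≡⟨ trans (*-assoc (rcp d′ * κ) (ι nR) (ι M)) (cong (rcp d′ * κ *_) (trans (sym (ι-* nR M)) (trans (cong ι (sym ratio)) (ι-* nL d)))) ⟩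
      rcp d′ * κ * (ι nL * ι d)  ≡⟨ solve 4 (λ s k l d → s :* k :* (l :* d) := k :* l :* (s :* d)) refl (rcp d′) κ (ι nL) (ι d) ⟩
      κ * ι nL * (rcp d′ * ι d)  ≡⟨ trans (cong (κ * ι nL *_) (rcp* d′)) (*-identityʳ (κ * ι nL)) ⟩
      κ * ι nL  ∎
      where
      open ≤-Reasoning
      open +-*-Solver

    0<Φ : 0ℚ < Φ
    0<Φ = 0<-factor 0<T (≤-trans 0≤1 (1≤wt N)) T≤ΦW

    module Recip (q : ℚ) (0<q : 0ℚ < q) where
      q⁻¹ : ℚ
      q⁻¹ = (Data.Rational.1/ q) {{>-nonZero 0<q}}
      0<q⁻¹ : 0ℚ < q⁻¹
      0<q⁻¹ = positive⁻¹ q⁻¹ {{1/pos⇒pos q {{positive 0<q}}}}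
      q⁻¹q : q⁻¹ * q ≡ 1ℚ
      q⁻¹q = *-inverseˡ q {{>-nonZero 0<q}}

    open Recip Φ 0<Φ renaming (q⁻¹ to Φ⁻¹; 0<q⁻¹ to 0<Φ⁻¹; q⁻¹q to Φ⁻¹Φ)
    open Normalised Φ⁻¹ (<⇒≤ 0<Φ⁻¹) Φ⁻¹Φ

    0<Z : 0ℚ < Z
    0<Z = <-≤-trans (0<* 0<nL (0<* 0<Φ⁻¹ 0<T)) Z≥

    open Recip Z 0<Z renaming (q⁻¹ to Z⁻¹; 0<q⁻¹ to 0<Z⁻¹; q⁻¹q to Z⁻¹Z)

    0<benefit : ∀ w → 0ℚ < benefit w
    0<benefit w = <-≤-trans 0<nL (subst (_≤ benefit w)
      (trans (sumL-const (allFin nL) 1ℚ) (trans (*-identityʳ _) (cong ι (List.length-tabulate {n = nL} (λ i → i)))))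
      (sumL-mono (allFin nL) (λ u → 1≤wt (maxV (Data.Vec.lookup w u)))))

    level : ℚ
    level = v 0 + ι 3 * κ

    0≤v : 0ℚ ≤ v 0
    0≤v = StoppingValue.0≤v SV 0 ℕ.z≤n

    m! = (nL ℕ.* d) !

    -- The estimate holds for every single arrival order, hence for their average. It is the same
    -- for every index `k`, that is, for every rational approximation of the algorithm.
    average≤ : ∀ (a : Algorithm graph) k → sumL configs (λ w → Z⁻¹ * law w * Play.averageAt a (code w) k) ≤ level
    average≤ a k = begin
      sumL configs (λ w → Z⁻¹ * law w * (r * sumL perms (λ fs → x w fs)))
        ≡⟨ sumL-cong configs (λ w → trans (solve 4 (λ z l r s → z :* l :* (r :* s) := z :* r :* (l :* s)) refl Z⁻¹ (law w) r (sumL perms (x w)))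
             (cong (Z⁻¹ * r *_) (sym (sumL-* perms (law w) (x w))))) ⟩
      sumL configs (λ w → Z⁻¹ * r * sumL perms (λ fs → law w * x w fs))
        ≡⟨ trans (sumL-* configs (Z⁻¹ * r) (λ w → sumL perms (λ fs → law w * x w fs)))
             (cong (Z⁻¹ * r *_) (sumL-swap configs perms (λ w fs → law w * x w fs))) ⟩
      Z⁻¹ * r * sumL perms (λ fs → sumL configs (λ w → law w * x w fs))
        ≤⟨ *-monoˡ (Z⁻¹ * r) (0≤* (<⇒≤ 0<Z⁻¹) 0≤r) (sumL-≤-All (λ fs → sumL configs (λ w → law w * x w fs)) (permutations-↭ (allFin (nL ℕ.* d))) order) ⟩
      Z⁻¹ * r * (ι (length perms) * (level * Z))
        ≡⟨ solve 5 (λ z r l e q → z :* r :* (l :* (e :* q)) := r :* l :* (z :* q) :* e) refl Z⁻¹ r (ι (length perms)) level Z ⟩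
      r * ι (length perms) * (Z⁻¹ * Z) * level
        ≡⟨ cong₂ (λ p q → r * ι p * q * level) (trans (permutations-length (allFin (nL ℕ.* d))) (cong _! (List.length-tabulate {n = nL ℕ.* d} (λ i → i)))) Z⁻¹Z ⟩
      r * ι m! * 1ℚ * level
        ≡⟨ cong (λ z → z * 1ℚ * level) (1/n*n m! {{(nL ℕ.* d) ℕ.!≢0}}) ⟩
      1ℚ * 1ℚ * level
        ≡⟨ solve 1 (λ l → con 1ℚ :* con 1ℚ :* l := l) refl level ⟩
      level ∎
      where
      open ≤-Reasoning
      open +-*-Solver
      open Play a
      open Player (probability k) (0≤probability k) (probability≤1 k) feasible? (probability-0 k)
      perms = permutations (allFin (nL ℕ.* d))
      r : ℚ
      r = 1/ (nL ℕ.* d) !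
      0≤r : 0ℚ ≤ r
      0≤r = <⇒≤ (positive⁻¹ r {{normalize-pos 1 m! {{(nL ℕ.* d) ℕ.!≢0}}}})
      x : Vec X nL → List (Fin (nL ℕ.* d)) → ℚ
      x w fs = expectedAt (code w) k [] fs
      order : ∀ fs → fs ↭ allFin (nL ℕ.* d) → sumL configs (λ w → law w * x w fs) ≤ level * Z
      order fs p = hardness Φ⁻¹ (<⇒≤ 0<Φ⁻¹) Φ⁻¹Φ 0≤v v≤1 C≤κT few (<⇒≤ 0<T) fs p

    0≤average : ∀ (a : Algorithm graph) w k → 0ℚ ≤ Play.averageAt a (code w) k
    0≤average a w k = 0≤* (<⇒≤ (positive⁻¹ (1/ (nL ℕ.* d) !) {{normalize-pos 1 m! {{(nL ℕ.* d) ℕ.!≢0}}}}))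
      (sumL-0≤ (permutations (allFin (nL ℕ.* d))) (λ fs → 0≤expected w fs))
      where
      open Play a
      open Player (probability k) (0≤probability k) (probability≤1 k) feasible? (probability-0 k)

    at : Fin (length configs) → Vec X nL
    at = lookup configs

    family : HardFamily g ε
    family = record
      { G = graph
      ; girth = girthAtLeast g girth
      ; size = length configs
      ; weightings = λ i → weighting (code (at i))
      ; mass = λ i → Z⁻¹ * law (at i)
      ; worth = λ i → benefit (at i)
      ; 0≤mass = λ i → 0≤* (<⇒≤ 0<Z⁻¹) (0≤law (at i))
      ; 0<worth = λ i → 0<benefit (at i)
      ; worth≤OPT = λ i k → subst (_≤ seq (OPT graph (weighting (code (at i)))) k)
          (trans (seq-weight (code (at i)) (star (at i)) k) (weightOf-star (at i)))
          (weight≤OPT graph (weighting (code (at i))) (star (at i)) k (star-forest (at i)))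
      ; normalised = trans (∑Fin-lookup configs (λ w → Z⁻¹ * law w * benefit w))
          (trans (sumL-cong configs (λ w → *-assoc Z⁻¹ (law w) (benefit w))) (trans (sumL-* configs Z⁻¹ (λ w → law w * benefit w)) Z⁻¹Z))
      ; level = level
      ; level≤ = level≤
      ; bounded = λ a → (λ i k → Play.averageAt a (code (at i)) k) , (λ i k → 0≤average a (at i) k) ,
          (λ i → Play.𝔼ALG-≈ a (code (at i))) ,
          (λ k → subst (_≤ level) (sym (∑Fin-lookup configs (λ w → Z⁻¹ * law w * Play.averageAt a (code w) k))) (average≤ a k))
      }

  choose-family : ∀ g ε → 0ℚ < ε → HardFamily g ε
  choose-family g ε 0<ε = Family.family g ε b d′ (proj₁ far) M v SV v≤1 level≤ large many (proj₁ sys) (proj₁ (proj₂ sys) (ℕ.s≤s ℕ.z≤n))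
    (proj₁ (proj₂ (proj₂ sys))) (proj₂ (proj₂ (proj₂ sys)))
    where
    -- 16 = 4 + 3 · 4: the error 4/d of the secretary value, and the three losses of `κ` multiplied
    -- by a partial sum of e, which is at most 4.
    part = share (ι 16) ε 0<ε
    η = proj₁ part
    small = rcp-small η (proj₁ (proj₂ part))
    b = proj₁ small
    sv = secretary-value b
    d′ = proj₁ sv
    b≤d′ = proj₁ (proj₂ sv)
    v = proj₁ (proj₂ (proj₂ sv))
    SV = proj₁ (proj₂ (proj₂ (proj₂ sv)))
    v≤1 = proj₁ (proj₂ (proj₂ (proj₂ (proj₂ sv))))
    near = proj₂ (proj₂ (proj₂ (proj₂ (proj₂ sv))))
    C = triangle (suc d′)
    far = H-diverges (C + (C * ι (suc b) + 1ℚ))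
    large : C + (C * ι (suc b) + 1ℚ) ≤ H (suc (proj₁ far))
    large = ≤-trans (proj₂ far) (H-mono (ℕ.n≤1+n (proj₁ far)))
    K = pow (ι (suc b)) (suc (proj₁ far)) * ι (suc d′) * ι (suc b)
    M = suc (proj₁ (archimedean K))
    many : K ≤ ι M
    many = ≤-trans (proj₂ (archimedean K)) (ι-mono (ℕ.n≤1+n (proj₁ (archimedean K))))
    sys = high-girth-system M (suc d′) ∣ g ∣
    level≤ : ∀ m → (v 0 + ι 3 * rcp b) * expSum m ≤ 1ℚ + ε
    level≤ m = begin
      (v 0 + ι 3 * rcp b) * x  ≡⟨ solve 3 (λ v r x → (v :+ con (ι 3) :* r) :* x := v :* x :+ con (ι 3) :* r :* x) refl (v 0) (rcp b) x ⟩
      v 0 * x + ι 3 * rcp b * x  ≤⟨ +-mono-≤ (near m) (*-monoˡ (ι 3 * rcp b) (0≤* (0≤ι 3) (0≤rcp b)) (expSum≤4 m)) ⟩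
      1ℚ + ι 4 * rcp d′ + ι 3 * rcp b * ι 4  ≤⟨ +-mono-≤ (+-monoʳ-≤ 1ℚ (*-monoˡ (ι 4) (0≤ι 4) (≤-trans (rcp-anti b≤d′) (proj₂ small))))
                                                     (*-monoʳ (ι 4) (0≤ι 4) (*-monoˡ (ι 3) (0≤ι 3) (proj₂ small))) ⟩
      1ℚ + ι 4 * η + ι 3 * η * ι 4  ≡⟨ solve 1 (λ h → con 1ℚ :+ con (ι 4) :* h :+ con (ι 3) :* h :* con (ι 4) := con 1ℚ :+ con (ι 16) :* h) refl η ⟩
      1ℚ + ι 16 * η  ≤⟨ +-monoʳ-≤ 1ℚ (proj₂ (proj₂ part)) ⟩
      1ℚ + ε  ∎
      where
      open ≤-Reasoning
      open +-*-Solver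
      x = expSum m

  abstract
    hardFamily : ∀ g ε → 0ℚ < ε → HardFamily g ε
    hardFamily = choose-family

-- Return to the reals: the expected ratio and the competitive ratio.

module Conclusion where
  open import Data.Rational
  open import Data.Rational.Properties
  open import Data.Rational.Solver using (module +-*-Solver)
  open import Relation.Nullary.Decidable using (toWitness)
  open import Defs using (ℝ; seq; cauchy; fromℚ; 0ℝ; inv; recip; e; 1/e; expSum; Graph; GirthAtLeast; Weighting; OPT; Algorithm; 𝔼ALG; FiniteDistribution; 𝔼; HighGirthAlgorithm; Competitive)
  import Defs
  open Rationals
  open Harmonic
  open Densities
  open RealAlgorithm
  open Assembly

  eventually-all : ∀ {k} {P : Fin k → ℕ → Set} → (∀ i → ∃ λ N → ∀ n → N ℕ.≤ n → P i n) → ∃ λ N → ∀ n → N ℕ.≤ n → ∀ i → P i n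
  eventually-all {zero}  f = 0 , λ _ _ ()
  eventually-all {suc k} f with f zero | eventually-all (f ∘ suc)
  ... | M , p | N , q = M ℕ.⊔ N , λ { n le zero → p n (ℕ.m⊔n≤o⇒m≤o M N le) ; n le (suc i) → q n (ℕ.m⊔n≤o⇒n≤o M N le) i }

  1≤expSum : ∀ n → 1ℚ ≤ expSum n
  1≤expSum n = subst (1ℚ ≤_) (expPoly-1 n) (go n)
    where
    go : ∀ n → 1ℚ ≤ expPoly n 1ℚ
    go zero    = ≤-refl
    go (suc n) = ≤-trans (go n) (≤-diff _ (0≤expTerm (suc n) 0≤1) refl)

  recip-inverse : ∀ p (0<p : 0ℚ < p) → recip p 0<p * p ≡ 1ℚ
  recip-inverse p 0<p = *-inverseˡ p {{>-nonZero 0<p}}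

  0<recip : ∀ p (0<p : 0ℚ < p) → 0ℚ < recip p 0<p
  0<recip p 0<p = positive⁻¹ (recip p 0<p) {{1/pos⇒pos p {{positive 0<p}}}}

  ≤1/e : ∀ l ε n → 0ℚ ≤ ε → l * expSum n ≤ 1ℚ + ε → l ≤ seq 1/e n + ε
  ≤1/e l ε n 0≤ε le = bound (recip p 0<p) (<⇒≤ (0<recip p 0<p)) (recip-inverse p 0<p)
    where
    open ≤-Reasoning
    open +-*-Solver
    -- The n-th term of `1/e` is the reciprocal of this: `inv` truncates at the witness 1 of `e>0`,
    -- which has no effect on partial sums that are at least 1.
    p = expSum n ⊔ 1ℚ
    0<p : 0ℚ < p
    0<p = <-≤-trans 0<1 (p≤q⊔p (expSum n) 1ℚ)
    p≡ : p ≡ expSum n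
    p≡ = p≥q⇒p⊔q≡p (1≤expSum n)
    bound : ∀ y → 0ℚ ≤ y → y * p ≡ 1ℚ → l ≤ y + ε
    bound y 0≤y yp = begin
      l  ≡⟨ trans (cong (l *_) yp) (*-identityʳ l) ⟨
      l * (y * p)  ≡⟨ cong (λ z → l * (y * z)) p≡ ⟩
      l * (y * expSum n)  ≡⟨ solve 3 (λ l y x → l :* (y :* x) := y :* (l :* x)) refl l y (expSum n) ⟩
      y * (l * expSum n)  ≤⟨ *-monoˡ y 0≤y le ⟩
      y * (1ℚ + ε)  ≡⟨ solve 2 (λ y e → y :* (con 1ℚ :+ e) := y :+ y :* e) refl y ε ⟩
      y + y * ε  ≤⟨ +-monoʳ-≤ y (*-monoʳ ε 0≤ε y≤1) ⟩
      y + 1ℚ * ε  ≡⟨ cong (y +_) (*-identityˡ ε) ⟩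
      y + ε  ∎
      where
      y≤1 : y ≤ 1ℚ
      y≤1 = subst₂ _≤_ (*-identityʳ y) yp (*-monoˡ y 0≤y (p≤q⊔p (expSum n) 1ℚ))

  module _ {g : ℤ} {ε : ℚ} (F : HardFamily g ε) where
    open HardFamily F

    distribution : FiniteDistribution (Weighting G)
    distribution = record
      { size = size
      ; outcome = weightings
      ; prob = λ i → fromℚ (mass i * worth i)
      ; prob≥0 = λ i δ 0<δ → 0 , λ _ _ → 0≤+ (0≤* (0≤mass i) (<⇒≤ (0<worth i))) (<⇒≤ 0<δ)
      ; total = ≡⇒≈ {seq (Defs.∑ (λ i → fromℚ (mass i * worth i)))} {λ _ → 1ℚ}
          (λ n → trans (seq-∑ (λ i → fromℚ (mass i * worth i)) n) normalised)
      }

    -- With `worth i` as the witness, `inv` truncates at `worth i`, so every term of the inverse of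
    -- OPT is at most 1/`worth i`.
    OPT>0 : ∀ i → 0ℝ Defs.< OPT G (weightings i)
    OPT>0 i = worth i , 0<worth i , 0 , λ n _ → subst (_≤ seq (OPT G (weightings i)) n) (sym (+-identityˡ (worth i))) (worth≤OPT i n)

    totalMassOf : ℚ
    totalMassOf = ∑Fin size mass

    slack : ∀ (x : Fin size → ℚ) σ → ∑Fin size (λ i → mass i * (x i + σ)) ≡ ∑Fin size (λ i → mass i * x i) + totalMassOf * σ
    slack x σ = trans (sumL-cong (allFin size) (λ i → *-distribˡ-+ (mass i) (x i) σ))
      (trans (sumL-+ (allFin size) (λ i → mass i * x i) (λ i → mass i * σ))
        (cong (∑Fin size (λ i → mass i * x i) +_) (sumL-*ʳ (allFin size) σ mass)))

    -- The probability `mass i * worth i` times a reciprocal of at most 1/`worth i` leaves `mass i`,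
    -- so the expected ratio becomes the weighted sum bounded by `level`. The approximation error
    -- `σ` per weighting is chosen to add up to at most `δ`.
    ratio≤ : ∀ (a : Algorithm G) δ → 0ℚ < δ → ∃ λ N → ∀ n → N ℕ.≤ n →
      seq (𝔼 distribution (λ i → 𝔼ALG a (weightings i) Defs.* inv (OPT G (weightings i)) (OPT>0 i))) n ≤ level + δ
    ratio≤ a δ 0<δ = go (bounded a) (share totalMassOf δ 0<δ)
      where
      go : (∃ λ (alg : Fin size → ℕ → ℚ) → (∀ i n → 0ℚ ≤ alg i n) × (∀ i → seq (𝔼ALG a (weightings i)) ≈ alg i) ×
             (∀ n → ∑Fin size (λ i → mass i * alg i n) ≤ level)) →
           (∃ λ σ → 0ℚ < σ × totalMassOf * σ ≤ δ) → ∃ λ N → ∀ n → N ℕ.≤ n →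
           seq (𝔼 distribution (λ i → 𝔼ALG a (weightings i) Defs.* inv (OPT G (weightings i)) (OPT>0 i))) n ≤ level + δ
      go (alg , 0≤alg , close , alg≤) (σ , 0<σ , Mσ≤δ) = proj₁ ev , λ n le → begin
        seq (𝔼 distribution (λ i → 𝔼ALG a (weightings i) Defs.* inv (OPT G (weightings i)) (OPT>0 i))) n
          ≡⟨ seq-∑ (λ i → fromℚ (mass i * worth i) Defs.* (𝔼ALG a (weightings i) Defs.* inv (OPT G (weightings i)) (OPT>0 i))) n ⟩
        ∑Fin size (λ i → mass i * worth i * (seq (𝔼ALG a (weightings i)) n * seq (inv (OPT G (weightings i)) (OPT>0 i)) n))
          ≤⟨ sumL-mono (allFin size) (λ i → term i n (proj₂ ev n le i)) ⟩
        ∑Fin size (λ i → mass i * (alg i n + σ))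
          ≡⟨ slack (λ i → alg i n) σ ⟩
        ∑Fin size (λ i → mass i * alg i n) + totalMassOf * σ
          ≤⟨ +-mono-≤ (alg≤ n) Mσ≤δ ⟩
        level + δ ∎
        where
        open ≤-Reasoning
        ev : ∃ λ N → ∀ n → N ℕ.≤ n → ∀ i → seq (𝔼ALG a (weightings i)) n ≤ alg i n + σ
        ev = eventually-all (λ i → ≈-upper {seq (𝔼ALG a (weightings i))} {alg i} (close i) σ 0<σ)
        term : ∀ i n → seq (𝔼ALG a (weightings i)) n ≤ alg i n + σ →
               mass i * worth i * (seq (𝔼ALG a (weightings i)) n * seq (inv (OPT G (weightings i)) (OPT>0 i)) n) ≤ mass i * (alg i n + σ)
        term i n x≤ = bound (seq (𝔼ALG a (weightings i)) n) (recip p 0<p) x≤ (<⇒≤ (0<recip p 0<p)) (recip-inverse p 0<p)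
          where
          p = seq (OPT G (weightings i)) n ⊔ worth i
          0<p : 0ℚ < p
          0<p = <-≤-trans (0<worth i) (p≤q⊔p (seq (OPT G (weightings i)) n) (worth i))
          m = mass i
          b = worth i
          bound : ∀ x ρ → x ≤ alg i n + σ → 0ℚ ≤ ρ → ρ * p ≡ 1ℚ → m * b * (x * ρ) ≤ m * (alg i n + σ)
          bound x ρ x≤ 0≤ρ ρp = begin
            m * b * (x * ρ)  ≡⟨ solve 4 (λ m b x r → m :* b :* (x :* r) := m :* (r :* b) :* x) refl m b x ρ ⟩
            m * (ρ * b) * x  ≤⟨ *-monoˡ (m * (ρ * b)) (0≤* (0≤mass i) (0≤* 0≤ρ (<⇒≤ (0<worth i)))) x≤ ⟩
            m * (ρ * b) * (alg i n + σ)  ≤⟨ *-monoʳ (alg i n + σ) (0≤+ (0≤alg i n) (<⇒≤ 0<σ))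
                                               (*-monoˡ m (0≤mass i) (subst (ρ * b ≤_) ρp (*-monoˡ ρ 0≤ρ (p≤q⊔p (seq (OPT G (weightings i)) n) b)))) ⟩
            m * 1ℚ * (alg i n + σ)  ≡⟨ cong (_* (alg i n + σ)) (*-identityʳ m) ⟩
            m * (alg i n + σ)  ∎
            where open +-*-Solver

  HardDistribution : ℝ → ℤ → Set
  HardDistribution ε g =
    Σ[ G ∈ Graph ] GirthAtLeast G g ×
    (Σ[ D ∈ FiniteDistribution (Weighting G) ]
     let open FiniteDistribution D in
     Σ[ OPT>0 ∈ (∀ (i : Fin size) → 0ℝ Defs.< OPT G (outcome i)) ]
     ((a : Algorithm G) →
       𝔼 D (λ i → 𝔼ALG a (outcome i) Defs.* inv (OPT G (outcome i)) (OPT>0 i)) Defs.< 1/e Defs.+ ε))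

  hard-distribution : ∀ ε → 0ℝ Defs.< ε → ∀ g → HardDistribution ε g
  -- Three parts: the distance of `level` from 1/e, the error in `ratio≤`, and the margin that makes
  -- the inequality strict.
  hard-distribution ε (η , 0<η , M , η≤ε) g = go (share (ι 3) η 0<η)
    where
    go : (∃ λ δ → 0ℚ < δ × ι 3 * δ ≤ η) → HardDistribution ε g
    go (δ , 0<δ , 3δ≤η) = HardFamily.G F , (λ {k} → HardFamily.girth F {k}) , distribution F , OPT>0 F , λ a →
      δ , 0<δ , M ℕ.⊔ proj₁ (ratio≤ F a δ 0<δ) , λ n le →
        final n (proj₂ (ratio≤ F a δ 0<δ) n (ℕ.m⊔n≤o⇒n≤o M _ le)) (η≤ε n (ℕ.m⊔n≤o⇒m≤o M _ le))
      where
      F : HardFamily g δ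
      F = hardFamily g δ 0<δ
      open HardFamily F using (level; level≤)
      final : ∀ n {x} → x ≤ level + δ → 0ℚ + η ≤ seq ε n → x + δ ≤ seq 1/e n + seq ε n
      final n {x} x≤ η≤ = begin
        x + δ  ≤⟨ +-monoˡ-≤ δ x≤ ⟩
        level + δ + δ  ≤⟨ +-monoˡ-≤ δ (+-monoˡ-≤ δ (≤1/e level δ n (<⇒≤ 0<δ) (level≤ n))) ⟩
        seq 1/e n + δ + δ + δ  ≡⟨ solve 2 (λ y d → y :+ d :+ d :+ d := y :+ con (ι 3) :* d) refl (seq 1/e n) δ ⟩
        seq 1/e n + ι 3 * δ  ≤⟨ +-monoʳ-≤ (seq 1/e n) (≤-trans 3δ≤η (subst (_≤ seq ε n) (+-identityˡ η) η≤)) ⟩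
        seq 1/e n + seq ε n  ∎
        where
        open ≤-Reasoning
        open +-*-Solver

  eventually-bounded : ∀ (x : ℝ) → ∃ λ K → 0ℚ ≤ K × ∃ λ N → ∀ n → N ℕ.≤ n → ∣ seq x n ∣ ≤ K
  eventually-bounded x = go (cauchy x 1ℚ 0<1)
    where
    open +-*-Solver
    go : (∃ λ N → ∀ m n → N ℕ.≤ m → N ℕ.≤ n → ∣ seq x m - seq x n ∣ ≤ 1ℚ) → ∃ λ K → 0ℚ ≤ K × ∃ λ N → ∀ n → N ℕ.≤ n → ∣ seq x n ∣ ≤ K
    go (N , f) = ∣ seq x N ∣ + 1ℚ , 0≤+ (0≤∣p∣ (seq x N)) 0≤1 , N , λ n le →
      subst (λ z → ∣ z ∣ ≤ ∣ seq x N ∣ + 1ℚ) (solve 2 (λ a b → a :+ (b :- a) := b) refl (seq x N) (seq x n))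
        (≤-trans (∣p+q∣≤∣p∣+∣q∣ (seq x N) (seq x n - seq x N)) (+-monoʳ-≤ ∣ seq x N ∣ (f n N le ℕ.≤-refl)))

  -- From  1 ≤ (x - δ) s + τ ,  x s ≤ 1 + τ  and  x ≤ 4 : s is not small, so δ s is not either.
  gap-contradiction : ∀ δ τ x s → 0ℚ < τ → δ ≤ 1ℚ → 0ℚ ≤ δ → ι 16 * τ ≤ δ → 0ℚ ≤ s → x ≤ ι 4 →
                      x * s ≤ 1ℚ + τ → 1ℚ ≤ (x - δ) * s + τ → ⊥
  gap-contradiction δ τ x s 0<τ δ≤1 0≤δ 16τ≤δ 0≤s x≤4 xs≤ 1≤ = <-irrefl refl (<-≤-trans 9τ<16τ (begin
    ι 16 * τ  ≤⟨ 16τ≤δ ⟩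
    δ  ≡⟨ *-identityʳ δ ⟨
    δ * 1ℚ  ≤⟨ *-monoˡ δ 0≤δ 1≤4s+τ ⟩
    δ * (ι 4 * s + τ)  ≡⟨ solve 3 (λ d s t → d :* (con (ι 4) :* s :+ t) := con (ι 4) :* (d :* s) :+ d :* t) refl δ s τ ⟩
    ι 4 * (δ * s) + δ * τ  ≤⟨ +-mono-≤ (*-monoˡ (ι 4) (0≤ι 4) δs≤) (*-monoʳ τ (<⇒≤ 0<τ) δ≤1) ⟩
    ι 4 * (τ + τ) + 1ℚ * τ  ≡⟨ solve 1 (λ t → con (ι 4) :* (t :+ t) :+ con 1ℚ :* t := con (ι 9) :* t) refl τ ⟩
    ι 9 * τ  ∎))
    where
    open ≤-Reasoning
    open +-*-Solver
    9τ<16τ : ι 9 * τ < ι 16 * τ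
    9τ<16τ = *-monoˡ-<-pos τ {{positive 0<τ}} (toWitness {a? = ι 9 <? ι 16} _)
    1≤4s+τ : 1ℚ ≤ ι 4 * s + τ
    1≤4s+τ = ≤-trans 1≤ (+-monoˡ-≤ τ (*-monoʳ s 0≤s (≤-trans (≤-diff {x - δ} {x} δ 0≤δ (solve 2 (λ x d → x := x :- d :+ d) refl x δ)) x≤4)))
    δs≤ : δ * s ≤ τ + τ
    δs≤ = begin
      δ * s  ≤⟨ ≤-diff ((x - δ) * s + τ - 1ℚ) (diff-≤ 1≤) refl ⟩
      δ * s + ((x - δ) * s + τ - 1ℚ)  ≡⟨ solve 4 (λ d x s t → d :* s :+ ((x :- d) :* s :+ t :- con 1ℚ) := x :* s :+ (t :- con 1ℚ)) refl δ x s τ ⟩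
      x * s + (τ - 1ℚ)  ≤⟨ +-monoˡ-≤ (τ - 1ℚ) xs≤ ⟩
      1ℚ + τ + (τ - 1ℚ)  ≡⟨ solve 1 (λ t → con 1ℚ :+ t :+ (t :- con 1ℚ) := t :+ t) refl τ ⟩
      τ + τ  ∎

  -- Competitiveness bounds each `worth i` by α times the performance. Summing with the masses gives
  -- 1 ≤ (e - δ) s up to errors, where s ≤ `level`, against e · `level` ≤ 1 + τ. Working with the
  -- masses directly avoids any division by OPT.
  not-competitive : ∀ (g : ℤ) (α : ℝ) → α Defs.< e → ¬ (∃ λ (a : HighGirthAlgorithm g) → Competitive g α a)
  not-competitive g α (δ₀ , 0<δ₀ , N₀ , α<e) (a , comp) = go (share (ι 16) δ 0<δ) (eventually-bounded α)
    where
    -- `gap-contradiction` estimates δ τ by τ, which requires δ to be at most 1.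
    δ = δ₀ ⊓ 1ℚ
    0<δ : 0ℚ < δ
    0<δ with ≤-total δ₀ 1ℚ
    ... | inj₁ le = subst (0ℚ <_) (sym (p≤q⇒p⊓q≡p le)) 0<δ₀
    ... | inj₂ le = subst (0ℚ <_) (sym (p≥q⇒p⊓q≡q le)) 0<1
    α+δ≤ : ∀ n → N₀ ℕ.≤ n → seq α n + δ ≤ expSum n
    α+δ≤ n le = ≤-trans (+-monoʳ-≤ (seq α n) (p⊓q≤p δ₀ 1ℚ)) (α<e n le)
    go : (∃ λ τ → 0ℚ < τ × ι 16 * τ ≤ δ) → (∃ λ K → 0ℚ ≤ K × ∃ λ N → ∀ n → N ℕ.≤ n → ∣ seq α n ∣ ≤ K) → ⊥
    go (τ , 0<τ , 16τ≤δ) (K , 0≤K , N₁ , α≤K) = go′ (bounded (a G girth)) (share ((K + 1ℚ) * totalMassOf F) τ 0<τ)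
      where
      F : HardFamily g τ
      F = hardFamily g τ 0<τ
      open HardFamily F
      go′ : (∃ λ (alg : Fin size → ℕ → ℚ) → (∀ i n → 0ℚ ≤ alg i n) × (∀ i → seq (𝔼ALG (a G girth) (weightings i)) ≈ alg i) ×
             (∀ n → ∑Fin size (λ i → mass i * alg i n) ≤ level)) →
            (∃ λ σ → 0ℚ < σ × (K + 1ℚ) * totalMassOf F * σ ≤ τ) → ⊥
      go′ (alg , 0≤alg , close , alg≤) (σ , 0<σ , small) =
        gap-contradiction δ τ (expSum n) s 0<τ (p⊓q≤q δ₀ 1ℚ) (<⇒≤ 0<δ) 16τ≤δ
          (sumL-0≤ (allFin size) (λ i → 0≤* (0≤mass i) (0≤alg i n))) (expSum≤4 n)
          (≤-trans (*-monoˡ (expSum n) (≤-trans 0≤1 (1≤expSum n)) (alg≤ n)) (≤-trans (≤-reflexive (*-comm (expSum n) level)) (level≤ n)))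
          (begin
            1ℚ
              ≡⟨ normalised ⟨
            ∑Fin size (λ i → mass i * worth i)
              ≤⟨ sumL-mono (allFin size) (λ i → *-monoˡ (mass i) (0≤mass i) (each i)) ⟩
            ∑Fin size (λ i → mass i * ((expSum n - δ) * alg i n + (K + 1ℚ) * σ))
              ≡⟨ slack F (λ i → (expSum n - δ) * alg i n) ((K + 1ℚ) * σ) ⟩
            ∑Fin size (λ i → mass i * ((expSum n - δ) * alg i n)) + totalMassOf F * ((K + 1ℚ) * σ)
              ≡⟨ cong₂ _+_ (trans (sumL-cong (allFin size) (λ i → solve 3 (λ m x y → m :* (x :* y) := x :* (m :* y)) refl (mass i) (expSum n - δ) (alg i n)))
                   (sumL-* (allFin size) (expSum n - δ) (λ i → mass i * alg i n)))
                   (solve 3 (λ t k s → t :* (k :* s) := k :* t :* s) refl (totalMassOf F) (K + 1ℚ) σ) ⟩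
            (expSum n - δ) * s + (K + 1ℚ) * totalMassOf F * σ
              ≤⟨ +-monoʳ-≤ ((expSum n - δ) * s) small ⟩
            (expSum n - δ) * s + τ ∎)
        where
        open ≤-Reasoning
        open +-*-Solver
        near : ∃ λ N → ∀ n → N ℕ.≤ n → ∀ i → ∣ seq (𝔼ALG (a G girth) (weightings i)) n - alg i n ∣ ≤ σ
        near = eventually-all (λ i → close i σ 0<σ)
        competes : ∃ λ N → ∀ n → N ℕ.≤ n → ∀ i → seq (OPT G (weightings i)) n ≤ seq α n * seq (𝔼ALG (a G girth) (weightings i)) n + σ
        competes = eventually-all (λ i → comp G girth (weightings i) σ 0<σ)
        n : ℕ
        n = (N₀ ℕ.⊔ N₁) ℕ.⊔ (proj₁ near ℕ.⊔ proj₁ competes)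
        N₀≤n : N₀ ℕ.≤ n
        N₀≤n = ℕ.≤-trans (ℕ.m≤m⊔n N₀ N₁) (ℕ.m≤m⊔n (N₀ ℕ.⊔ N₁) _)
        N₁≤n : N₁ ℕ.≤ n
        N₁≤n = ℕ.≤-trans (ℕ.m≤n⊔m N₀ N₁) (ℕ.m≤m⊔n (N₀ ℕ.⊔ N₁) _)
        near≤n : proj₁ near ℕ.≤ n
        near≤n = ℕ.≤-trans (ℕ.m≤m⊔n (proj₁ near) (proj₁ competes)) (ℕ.m≤n⊔m (N₀ ℕ.⊔ N₁) _)
        competes≤n : proj₁ competes ℕ.≤ n
        competes≤n = ℕ.≤-trans (ℕ.m≤n⊔m (proj₁ near) (proj₁ competes)) (ℕ.m≤n⊔m (N₀ ℕ.⊔ N₁) _)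
        s = ∑Fin size (λ i → mass i * alg i n)
        -- The sign of α is unknown, so passing from the real performance to `alg i n` costs up to K
        -- σ, where K bounds the absolute value of α; another σ is the tolerance in the competitive
        -- inequality.
        each : ∀ i → worth i ≤ (expSum n - δ) * alg i n + (K + 1ℚ) * σ
        each i = bound (seq α n) (seq (𝔼ALG (a G girth) (weightings i)) n) (α≤K n N₁≤n) (α+δ≤ n N₀≤n)
          (proj₂ near n near≤n i) (≤-trans (worth≤OPT i n) (proj₂ competes n competes≤n i))
          where
          bound : ∀ α x → ∣ α ∣ ≤ K → α + δ ≤ expSum n → ∣ x - alg i n ∣ ≤ σ → worth i ≤ α * x + σ → worth i ≤ (expSum n - δ) * alg i n + (K + 1ℚ) * σ
          bound α x α≤K α+δ≤ x≈ le = begin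
            worth i  ≤⟨ le ⟩
            α * x + σ  ≡⟨ solve 4 (λ a x y s → a :* x :+ s := a :* y :+ (a :* (x :- y) :+ s)) refl α x (alg i n) σ ⟩
            α * alg i n + (α * (x - alg i n) + σ)  ≤⟨ +-mono-≤ (*-monoʳ (alg i n) (0≤alg i n) (≤-diff {α} {expSum n - δ} (expSum n - (α + δ)) (diff-≤ α+δ≤) (solve 3 (λ e d a → e :- d := a :+ (e :- (a :+ d))) refl (expSum n) δ α)))
                                                                        (+-monoˡ-≤ σ (≤-trans (p≤∣p∣ (α * (x - alg i n))) (≤-trans (≤-reflexive (∣p*q∣≡∣p∣*∣q∣ α (x - alg i n)))
                                                                          (*-mono (0≤∣p∣ α) (<⇒≤ 0<σ) α≤K x≈)))) ⟩
            (expSum n - δ) * alg i n + (K * σ + σ)  ≡⟨ cong ((expSum n - δ) * alg i n +_) (solve 2 (λ k s → k :* s :+ s := (k :+ con 1ℚ) :* s) refl K σ) ⟩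
            (expSum n - δ) * alg i n + (K + 1ℚ) * σ  ∎

open import Defs

theorem3 : (∀ (ε : ℝ) → 0ℝ < ε → ∀ (g : ℤ) →
    Σ[ G ∈ Graph ] GirthAtLeast G g ×
    (Σ[ D ∈ FiniteDistribution (Weighting G) ]
    let open FiniteDistribution D in
    Σ[ OPT>0 ∈ (∀ (i : Fin size) → 0ℝ < OPT G (outcome i)) ]
    ((a : Algorithm G) →
    𝔼 D (λ i → 𝔼ALG a (outcome i) * inv (OPT G (outcome i)) (OPT>0 i)) < 1/e + ε)))
    ×
    (∀ (g : ℤ) (α : ℝ) → α < e → ¬ (∃ λ (a : HighGirthAlgorithm g) → Competitive g α a))
theorem3 = Conclusion.hard-distribution , Conclusion.not-competitive
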